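{- Model checking and satisfiability of $\mathrm{InqLTL}({\sim})$ are undecidable. In particular, truth in second-order arithmetic is reducible to $\mathrm{InqLTL}({\sim})$ model checking and to $\mathrm{InqLTL}({\sim})$ satisfiability.
   Context: For a finite set $AP$ of atomic propositions (given with the input), a trace is an infinite word $w$ over $2^{AP}$; $w(i)$ ($i\ge 0$) is its $(i+1)$-th letter and $w_{\ge i}=w(i)w(i+1)\cdots$. A team is a set $\mathcal L$ of traces, and $\mathcal L_{\ge i}=\{w_{\ge i}\mid w\in\mathcal L\}$. $\mathrm{InqLTL}({\sim})$ formulas over $AP$: $\varphi::=\bot\mid p\mid \varphi\vee_b\varphi\mid\varphi\wedge\varphi\mid\varphi\to\varphi\mid \mathsf X\varphi\mid\varphi\,\mathsf U\,\varphi\mid\varphi\,\mathsf R\,\varphi\mid{\sim}\varphi$, with $p\in AP$. Satisfaction by a team $\mathcal L$: - $\mathcal L\models\bot$ iff $\mathcal L=\emptyset$; - $\mathcal L\models p$ iff $p\in w(0)$ for each $w\in\mathcal L$; - $\mathcal L\models\varphi_1\vee_b\varphi_2$ iff $\mathcal L\models\varphi_1$ or $\mathcal L\models\varphi_2$; - $\mathcal L\models\varphi_1\wedge\varphi_2$ iff $\mathcal L\models\varphi_1$ and $\mathcal L\models\varphi_2$; - $\mathcal L\models\varphi_1\to\varphi_2$ iff for all $\mathcal L'\subseteq\mathcal L$, $\mathcal L'\models\varphi_1$ implies $\mathcal L'\models\varphi_2$; - $\mathcal L\models\mathsf X\varphi$ iff $\mathcal L_{\ge1}\models\varphi$; - $\mathcal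 L\models\varphi_1\mathsf U\varphi_2$ iff for some $i\ge0$, $\mathcal L_{\ge i}\models\varphi_2$ and $\mathcal L_{\ge k}\models\varphi_1$ for all $0\le k<i$; - $\mathcal L\models\varphi_1\mathsf R\varphi_2$ iff for each $i\ge0$, $\mathcal L_{\ge i}\models\varphi_2$ or $\mathcal L_{\ge k}\models\varphi_1$ for some $0\le k<i$; - $\mathcal L\models{\sim}\varphi$ iff $\mathcal L\not\models\varphi$. A Kripke structure over $AP$ is $K=\langle S,S_0,R,Lab\rangle$ with $S$ a nonempty set of states, $S_0\subseteq S$ initial states, $R\subseteq S\times S$ left-total, $Lab:S\to2^{AP}$. A path is an infinite word $s_0s_1\cdots$ over $S$ with $(s_i,s_{i+1})\in R$ for all $i$; it is initial if $s_0\in S_0$; it induces the trace $Lab(s_0)Lab(s_1)\cdots$. $\mathcal L(K)$ is the set of traces induced by initial paths. Satisfiability: given $\varphi$, is there a nonempty team satisfying $\varphi$? Model checking: given a finite Kripke structure $K$ and $\varphi$, does $\mathcal L(K)\models\varphi$? Truth in second-order arithmetic: given a sentence of second-order predicate logic with equality over the signature $(<,+,*,\in)$, with first-order variables ranging over natural numbers and second-order variables ranging over sets of natural numbers (standard interpretation of $<,+,*,\in$), is it true over $\mathbb N$? Reducible means by a computable many-one reduction. -}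

module Defs where

open import Level using (0ℓ; Lift)
open import Data.Bool using (Bool; true; false)
open import Data.Fin using (Fin; toℕ)
open import Data.Fin.Subset using (Subset) renaming (_∈_ to _∈ₛ_; Nonempty to Nonemptyₛ)
open import Data.Nat using (ℕ; zero; suc; _+_; _*_; _<_)
open import Data.Product using (Σ; ∃; ∃-syntax; _×_; _,_)
open import Data.Sum using (_⊎_)
open import Data.Vec using (Vec; []; _∷_; lookup)
open import Data.Vec.Relation.Binary.Pointwise.Inductive using (Pointwise)
open import Function using (_∘_; _⇔_)
open import Relation.Binary.PropositionalEquality using (_≡_; _≗_; sym; trans)
open import Relation.Nullary using (¬_)
open import Relation.Unary using (Pred; _∈_; _⊆_; Empty; Satisfiable)
open import Relation.Binary using (_Respects_)

infix 4 _⊨_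

-- Kleene's partial recursive functions of the given arity, and their graphs.

data Rec : ℕ → Set where
  zeroᶠ : ∀ {n} → Rec n
  sucᶠ  : Rec 1
  proj  : ∀ {n} → Fin n → Rec n
  comp  : ∀ {m n} → Rec m → Vec (Rec n) m → Rec n
  prec  : ∀ {n} → Rec n → Rec (2 + n) → Rec (1 + n)
  μ     : ∀ {n} → Rec (1 + n) → Rec n

infix 4 _·_⇓_

data _·_⇓_ : ∀ {n} → Rec n → Vec ℕ n → ℕ → Set where
  ⇓-zero     : ∀ {n} {xs : Vec ℕ n} → zeroᶠ · xs ⇓ 0
  ⇓-suc      : ∀ {x} → sucᶠ · x ∷ [] ⇓ suc x
  ⇓-proj     : ∀ {n} {xs : Vec ℕ n} (i : Fin n) → proj i · xs ⇓ lookup xs i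
  ⇓-comp     : ∀ {m n} {f : Rec m} {gs : Vec (Rec n) m} {xs ys z} →
               Pointwise (λ g y → g · xs ⇓ y) gs ys →
               f · ys ⇓ z →
               comp f gs · xs ⇓ z
  ⇓-prec-zero : ∀ {n} {f : Rec n} {g xs y} →
               f · xs ⇓ y →
               prec f g · 0 ∷ xs ⇓ y
  ⇓-prec-suc : ∀ {n} {f : Rec n} {g xs k y z} →
               prec f g · k ∷ xs ⇓ y →
               g · k ∷ y ∷ xs ⇓ z →
               prec f g · suc k ∷ xs ⇓ z
  ⇓-μ        : ∀ {n} {f : Rec (1 + n)} {xs k} →
               f · k ∷ xs ⇓ 0 →
               (∀ i → i < k → ∃[ y ] f · i ∷ xs ⇓ suc y) →
               μ f · xs ⇓ k

-- Only the codes of instances matter as inputs: nothing is required of an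
-- algorithm on numbers that code no instance.

record Problem : Set₂ where
  field
    Instance : Set
    code     : Instance → ℕ
    Yes      : Instance → Set₁

Decidable : Problem → Set₁
Decidable P = ∃[ f ] ∀ x →
    (Yes x → f · code x ∷ [] ⇓ 1)
  × (¬ Yes x → f · code x ∷ [] ⇓ 0)
  where open Problem P

Undecidable : Problem → Set₁
Undecidable P = ¬ Decidable P

infix 4 _≤ₘ_

_≤ₘ_ : Problem → Problem → Set₁
P ≤ₘ Q = Σ (P.Instance → Q.Instance) λ r →
    (∃[ f ] ∀ x → f · P.code x ∷ [] ⇓ Q.code (r x))
  × (∀ x → P.Yes x ⇔ Q.Yes (r x))
  where
  module P = Problem P
  module Q = Problem Q

-- Cantor pairing. All codes below are injective on objects of known indices
-- (up to the leftTotal proof of a finite Kripke structure), so the code of an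
-- instance includes its number of atomic propositions.

triangle : ℕ → ℕ
triangle zero    = 0
triangle (suc n) = suc n + triangle n

⟨_,_⟩ : ℕ → ℕ → ℕ
⟨ x , y ⟩ = triangle (x + y) + y

codeBool : Bool → ℕ
codeBool false = 0
codeBool true  = 1

codeVec : ∀ {A : Set} {n} → (A → ℕ) → Vec A n → ℕ
codeVec c []       = 0
codeVec c (x ∷ xs) = ⟨ c x , codeVec c xs ⟩

codeSubset : ∀ {n} → Subset n → ℕ
codeSubset = codeVec codeBool

Trace : ℕ → Set
Trace n = ℕ → Subset n

suffix : ∀ {n} → ℕ → Trace n → Trace n
suffix i w j = w (i + j)

-- Words are compared pointwise (function extensionality is not assumed), so
-- a set of traces is a predicate that is invariant under _≗_.

record Team (n : ℕ) : Set₁ where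
  constructor team
  field
    ∣_∣  : Pred (Trace n) 0ℓ
    resp : ∣_∣ Respects _≗_

open Team public using (∣_∣)

_≥[_] : ∀ {n} → Team n → ℕ → Team n
L ≥[ i ] = team
  (λ v → ∃[ w ] w ∈ ∣ L ∣ × v ≗ suffix i w)
  (λ { v≗v′ (w , w∈L , v≗w) → w , w∈L , λ j → trans (sym (v≗v′ j)) (v≗w j) })

-- The atomic propositions are the elements of Fin n.

infixr 7 _∧_
infixr 6 _∨ᵇ_
infixr 5 _⇒_
infix  8 _U_ _R_

data InqLTL (n : ℕ) : Set where
  ⊥ᶠ   : InqLTL n
  atom : Fin n → InqLTL n
  _∨ᵇ_ : InqLTL n → InqLTL n → InqLTL n
  _∧_  : InqLTL n → InqLTL n → InqLTL n
  _⇒_  : InqLTL n → InqLTL n → InqLTL n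
  X    : InqLTL n → InqLTL n
  _U_  : InqLTL n → InqLTL n → InqLTL n
  _R_  : InqLTL n → InqLTL n → InqLTL n
  ∼_   : InqLTL n → InqLTL n

_⊨_ : ∀ {n} → Team n → InqLTL n → Set₁
L ⊨ ⊥ᶠ     = Lift _ (Empty ∣ L ∣)
L ⊨ atom p = Lift _ (∀ w → w ∈ ∣ L ∣ → p ∈ₛ w 0)
L ⊨ φ ∨ᵇ ψ = L ⊨ φ ⊎ L ⊨ ψ
L ⊨ φ ∧ ψ  = L ⊨ φ × L ⊨ ψ
L ⊨ φ ⇒ ψ  = ∀ L′ → ∣ L′ ∣ ⊆ ∣ L ∣ → L′ ⊨ φ → L′ ⊨ ψ
L ⊨ X φ    = L ≥[ 1 ] ⊨ φ
L ⊨ φ U ψ  = ∃[ i ] L ≥[ i ] ⊨ ψ × (∀ k → k < i → L ≥[ k ] ⊨ φ)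
L ⊨ φ R ψ  = ∀ i → L ≥[ i ] ⊨ ψ ⊎ (∃[ k ] k < i × L ≥[ k ] ⊨ φ)
L ⊨ ∼ φ    = ¬ (L ⊨ φ)

codeInqLTL : ∀ {n} → InqLTL n → ℕ
codeInqLTL ⊥ᶠ       = ⟨ 0 , 0 ⟩
codeInqLTL (atom p) = ⟨ 1 , toℕ p ⟩
codeInqLTL (φ ∨ᵇ ψ) = ⟨ 2 , ⟨ codeInqLTL φ , codeInqLTL ψ ⟩ ⟩
codeInqLTL (φ ∧ ψ)  = ⟨ 3 , ⟨ codeInqLTL φ , codeInqLTL ψ ⟩ ⟩
codeInqLTL (φ ⇒ ψ)  = ⟨ 4 , ⟨ codeInqLTL φ , codeInqLTL ψ ⟩ ⟩
codeInqLTL (X φ)    = ⟨ 5 , codeInqLTL φ ⟩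
codeInqLTL (φ U ψ)  = ⟨ 6 , ⟨ codeInqLTL φ , codeInqLTL ψ ⟩ ⟩
codeInqLTL (φ R ψ)  = ⟨ 7 , ⟨ codeInqLTL φ , codeInqLTL ψ ⟩ ⟩
codeInqLTL (∼ φ)    = ⟨ 8 , codeInqLTL φ ⟩

record Kripke (n : ℕ) : Set₁ where
  field
    State     : Set
    nonempty  : State
    Initial   : Pred State 0ℓ
    _⟶_       : State → State → Set
    leftTotal : ∀ s → ∃[ t ] s ⟶ t
    Lab       : State → Subset n

  IsPath : (ℕ → State) → Set
  IsPath π = ∀ i → π i ⟶ π (suc i)

  traces : Team n
  traces = team
    (λ w → ∃[ π ] IsPath π × π 0 ∈ Initial × w ≗ Lab ∘ π)
    (λ { w≗w′ (π , path , init , w≗π) →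
         π , path , init , λ i → trans (sym (w≗w′ i)) (w≗π i) })

-- A finite Kripke structure as input data; its states are Fin (suc size).

record FiniteKripke (n : ℕ) : Set where
  field
    size       : ℕ
    initial    : Subset (suc size)
    successors : Vec (Subset (suc size)) (suc size)
    leftTotal  : ∀ s → Nonemptyₛ (lookup successors s)
    labels     : Vec (Subset n) (suc size)

toKripke : ∀ {n} → FiniteKripke n → Kripke n
toKripke K = record
  { State     = Fin (suc size)
  ; nonempty  = Fin.zero
  ; Initial   = _∈ₛ initial
  ; _⟶_       = λ s t → t ∈ₛ lookup successors s
  ; leftTotal = leftTotal
  ; Lab       = lookup labels
  }
  where open FiniteKripke K

codeKripke : ∀ {n} → FiniteKripke n → ℕ
codeKripke K =
  ⟨ size , ⟨ codeSubset initial
         , ⟨ codeVec codeSubset successors , codeVec codeSubset labels ⟩ ⟩ ⟩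
  where open FiniteKripke K

InqLTL-ModelChecking : Problem
InqLTL-ModelChecking = record
  { Instance = ∃[ n ] FiniteKripke n × InqLTL n
  ; code     = λ { (n , K , φ) → ⟨ n , ⟨ codeKripke K , codeInqLTL φ ⟩ ⟩ }
  ; Yes      = λ { (n , K , φ) → Kripke.traces (toKripke K) ⊨ φ }
  }

InqLTL-Satisfiability : Problem
InqLTL-Satisfiability = record
  { Instance = ∃[ n ] InqLTL n
  ; code     = λ { (n , φ) → ⟨ n , codeInqLTL φ ⟩ }
  ; Yes      = λ { (n , φ) → Σ (Team n) λ L → Satisfiable ∣ L ∣ × L ⊨ φ }
  }

-- Variables are de Bruijn indices, separately for the two sorts: n is the
-- number of free first-order and m that of free second-order variables.

data Term (n : ℕ) : Set where
  var : Fin n → Term n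
  _⊕_ : Term n → Term n → Term n
  _⊗_ : Term n → Term n → Term n

data SOFormula (n m : ℕ) : Set where
  _≐_ : Term n → Term n → SOFormula n m
  _≺_ : Term n → Term n → SOFormula n m
  _ϵ_ : Term n → Fin m → SOFormula n m
  ¬ᶠ_ : SOFormula n m → SOFormula n m
  _∧_ : SOFormula n m → SOFormula n m → SOFormula n m
  _∨_ : SOFormula n m → SOFormula n m → SOFormula n m
  _⇒_ : SOFormula n m → SOFormula n m → SOFormula n m
  ∀₁_ : SOFormula (suc n) m → SOFormula n m
  ∃₁_ : SOFormula (suc n) m → SOFormula n m
  ∀₂_ : SOFormula n (suc m) → SOFormula n m
  ∃₂_ : SOFormula n (suc m) → SOFormula n m

SOSentence : Set
SOSentence = SOFormula 0 0

⟦_⟧ : ∀ {n} → Term n → Vec ℕ n → ℕ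
⟦ var x ⟧ ρ = lookup ρ x
⟦ s ⊕ t ⟧ ρ = ⟦ s ⟧ ρ + ⟦ t ⟧ ρ
⟦ s ⊗ t ⟧ ρ = ⟦ s ⟧ ρ * ⟦ t ⟧ ρ

Holds : ∀ {n m} → Vec ℕ n → Vec (Pred ℕ 0ℓ) m → SOFormula n m → Set₁
Holds ρ σ (s ≐ t) = Lift _ (⟦ s ⟧ ρ ≡ ⟦ t ⟧ ρ)
Holds ρ σ (s ≺ t) = Lift _ (⟦ s ⟧ ρ < ⟦ t ⟧ ρ)
Holds ρ σ (t ϵ A) = Lift _ (⟦ t ⟧ ρ ∈ lookup σ A)
Holds ρ σ (¬ᶠ φ)  = ¬ Holds ρ σ φ
Holds ρ σ (φ ∧ ψ) = Holds ρ σ φ × Holds ρ σ ψ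
Holds ρ σ (φ ∨ ψ) = Holds ρ σ φ ⊎ Holds ρ σ ψ
Holds ρ σ (φ ⇒ ψ) = Holds ρ σ φ → Holds ρ σ ψ
Holds ρ σ (∀₁ φ)  = ∀ x → Holds (x ∷ ρ) σ φ
Holds ρ σ (∃₁ φ)  = ∃[ x ] Holds (x ∷ ρ) σ φ
Holds ρ σ (∀₂ φ)  = ∀ A → Holds ρ (A ∷ σ) φ
Holds ρ σ (∃₂ φ)  = ∃[ A ] Holds ρ (A ∷ σ) φ

codeTerm : ∀ {n} → Term n → ℕ
codeTerm (var x) = ⟨ 0 , toℕ x ⟩
codeTerm (s ⊕ t) = ⟨ 1 , ⟨ codeTerm s , codeTerm t ⟩ ⟩
codeTerm (s ⊗ t) = ⟨ 2 , ⟨ codeTerm s , codeTerm t ⟩ ⟩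

codeSOFormula : ∀ {n m} → SOFormula n m → ℕ
codeSOFormula (s ≐ t) = ⟨ 0 , ⟨ codeTerm s , codeTerm t ⟩ ⟩
codeSOFormula (s ≺ t) = ⟨ 1 , ⟨ codeTerm s , codeTerm t ⟩ ⟩
codeSOFormula (t ϵ A) = ⟨ 2 , ⟨ codeTerm t , toℕ A ⟩ ⟩
codeSOFormula (¬ᶠ φ)  = ⟨ 3 , codeSOFormula φ ⟩
codeSOFormula (φ ∧ ψ) = ⟨ 4 , ⟨ codeSOFormula φ , codeSOFormula ψ ⟩ ⟩
codeSOFormula (φ ∨ ψ) = ⟨ 5 , ⟨ codeSOFormula φ , codeSOFormula ψ ⟩ ⟩
codeSOFormula (φ ⇒ ψ) = ⟨ 6 , ⟨ codeSOFormula φ , codeSOFormula ψ ⟩ ⟩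
codeSOFormula (∀₁ φ)  = ⟨ 7 , codeSOFormula φ ⟩
codeSOFormula (∃₁ φ)  = ⟨ 8 , codeSOFormula φ ⟩
codeSOFormula (∀₂ φ)  = ⟨ 9 , codeSOFormula φ ⟩
codeSOFormula (∃₂ φ)  = ⟨ 10 , codeSOFormula φ ⟩

SecondOrderTruth : Problem
SecondOrderTruth = record
  { Instance = SOSentence
  ; code     = codeSOFormula
  ; Yes      = Holds [] []
  }

{-# OPTIONS --safe #-}

-- Truth in second-order arithmetic is undecidable by Tarski's argument: the
-- graph of every recursive function is definable, so that a decision procedure
-- would yield a liar sentence.
--
-- It reduces to InqLTL(∼) because a team can be read as an assignment of binary
-- relations to slots: a trace stands for a pair of numbers, tagged with a slot
-- and a sign, and a slot is in use if it contains every pair with exactly one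
-- sign. A quantifier chooses a subteam in which one more slot is in use. What
-- makes this work is that a formula can express that every slot still contains
-- every pair, and every unused slot with both signs, since G reaches all
-- positions of the marks: a choice can thus neither damage the relations chosen
-- before nor restrict those that can be chosen later. A number a is represented
-- by the relation {(a , a)}, the successor relation by a reserved slot, and
-- addition and multiplication are defined by second-order induction.

module Submission where

open import Defs
open import Level using (0ℓ; Lift; lift; lower) renaming (suc to lsuc)
open import Axiom.ExcludedMiddle using (ExcludedMiddle)
open import Data.Bool using (Bool; true; false; T)
open import Data.Bool.Properties using (¬-not; not-¬)
open import Data.Empty using (⊥; ⊥-elim)
open import Data.Fin using (Fin; zero; suc; toℕ; fromℕ; inject₁; _↑ʳ_)
open import Data.Fin.Patterns using (0F; 1F; 2F; 3F; 4F; 5F)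
open import Data.Fin.Subset using (Subset; ⊤) renaming (_∈_ to _∈ₛ_)
open import Data.Fin.Subset.Properties using (∈⊤)
open import Data.Nat using (ℕ; zero; suc; pred; _+_; _*_; _∸_; _≤_; _<_; z≤n; s≤s; s≤s⁻¹)
open import Data.Nat.Properties
open import Data.Nat.Tactic.RingSolver using (solve-∀)
open import Data.Product using (Σ; ∃-syntax; _×_; _,_; proj₁; proj₂)
open import Data.Sum using (_⊎_; inj₁; inj₂)
open import Data.Unit using (tt) renaming (⊤ to Unit)
open import Data.Vec as Vec using (Vec; []; _∷_; _∷ʳ_; _++_; lookup; map; replicate; tabulate)
open import Data.Vec.Membership.Propositional using () renaming (_∈_ to _∈ᵥ_)
open import Data.Vec.Membership.Propositional.Properties using (∈-++⁺ˡ; ∈-++⁺ʳ; ∈-map⁺)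
open import Data.Vec.Properties using ([]=⇒lookup; lookup⇒[]=; lookup-map; lookup-replicate; map-∘; map-cong; tabulate-∘; tabulate∘lookup)
open import Data.Vec.Relation.Binary.Pointwise.Inductive using (Pointwise; []; _∷_)
open import Data.Vec.Relation.Unary.Any using (here; index)
open import Data.Vec.Relation.Unary.Any.Properties using (lookup-index)
open import Function using (_∘_; id; case_of_; _⇔_; mk⇔; Equivalence)
open import Relation.Binary using (_Respects_; tri<; tri≈; tri>)
open import Relation.Binary.PropositionalEquality
open import Relation.Nullary using (¬_; yes; no)
open import Relation.Nullary.Decidable using (decidable-stable; dec-true; does)
open import Relation.Nullary.Reflects using (Reflects; ofʸ; ofⁿ)
open import Relation.Unary using (Pred; _∈_; _⊆_; Satisfiable)

-- Quantification over subteams only shrinks a team, and a lost trace cannot be brought back. The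
-- signs answer this: choosing a relation removes from each pair of a slot the wrong sign and never
-- the pair itself, so that any further loss shows up as a missing pair. Slots are positions of a
-- trace rather than propositions. Hence six propositions are enough for all sentences, and the
-- model-checking instances share one Kripke structure, which produces all traces. One formula
-- serves both problems: if the sentence is false, no team satisfies it; if the sentence is true,
-- the team of all traces does. The relations are binary although sentences speak of sets, because
-- addition and multiplication are iterations and their definitions quantify over a relation that
-- can be the graph of the iteration. A set is read off the diagonal of a relation.

open Equivalence

-- Computable functions

record Comp (n : ℕ) : Set where
  constructor mkComp
  field
    fun      : Vec ℕ n → ℕ
    rec      : Rec n
    computes : ∀ xs → rec · xs ⇓ fun xs

open Comp public

infix 8 _⟪_⟫

_⟪_⟫ : ∀ {m n} → Comp m → Vec (Comp n) m → Comp n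
f ⟪ gs ⟫ = mkComp
  (λ xs → fun f (Vec.map (λ g → fun g xs) gs))
  (comp (rec f) (Vec.map rec gs))
  (λ xs → ⇓-comp (args gs xs) (computes f _))
  where
  args : ∀ {m n} (gs : Vec (Comp n) m) xs →
         Pointwise (λ g y → g · xs ⇓ y) (Vec.map rec gs) (Vec.map (λ g → fun g xs) gs)
  args []       xs = []
  args (g ∷ gs) xs = computes g xs ∷ args gs xs

withFun : ∀ {n} (f : Comp n) (h : Vec ℕ n → ℕ) → (∀ xs → fun f xs ≡ h xs) → Comp n
withFun f h eq = mkComp h (rec f) (λ xs → subst (rec f · xs ⇓_) (eq xs) (computes f xs))

$ : ∀ {n} → Fin n → Comp n
$ i = mkComp (λ xs → lookup xs i) (proj i) (λ _ → ⇓-proj i)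

sucᶜ : Comp 1
sucᶜ = mkComp (λ { (x ∷ []) → suc x }) sucᶠ (λ { (x ∷ []) → ⇓-suc })

const : ∀ {n} → ℕ → Comp n
const c = mkComp (λ _ → c) (constᶠ c) (⇓-const c)
  where
  constᶠ : ∀ {n} → ℕ → Rec n
  constᶠ zero    = zeroᶠ
  constᶠ (suc c) = comp sucᶠ (constᶠ c ∷ [])

  ⇓-const : ∀ {n} c (xs : Vec ℕ n) → constᶠ c · xs ⇓ c
  ⇓-const zero    xs = ⇓-zero
  ⇓-const (suc c) xs = ⇓-comp (⇓-const c xs ∷ []) ⇓-suc

primRec : ∀ {n} → Comp n → Comp (2 + n) → Comp (1 + n)
primRec f g = mkComp (λ { (k ∷ xs) → h k xs }) (prec (rec f) (rec g)) (λ { (k ∷ xs) → ⇓-h k xs })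
  where
  h : ℕ → _ → ℕ
  h zero    xs = fun f xs
  h (suc k) xs = fun g (k ∷ h k xs ∷ xs)

  ⇓-h : ∀ k xs → prec (rec f) (rec g) · k ∷ xs ⇓ h k xs
  ⇓-h zero    xs = ⇓-prec-zero (computes f xs)
  ⇓-h (suc k) xs = ⇓-prec-suc (⇓-h k xs) (computes g _)

dropFirst : ∀ {n} → Comp n → Comp (1 + n)
dropFirst f = withFun (f ⟪ tabulate (λ i → $ (Fin.suc i)) ⟫) (λ { (x ∷ xs) → fun f xs })
  (λ { (x ∷ xs) → cong (fun f) (args x xs) })
  where
  args : ∀ {n} x (xs : Vec ℕ n) → Vec.map (λ g → fun g (x ∷ xs)) (tabulate (λ i → $ (Fin.suc i))) ≡ xs
  args x xs = trans (sym (tabulate-∘ (λ g → fun g (x ∷ xs)) (λ i → $ (Fin.suc i))))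
                    (tabulate∘lookup xs)

cases : ∀ {n} → Comp n → Comp (1 + n) → Comp (1 + n)
cases f g = withFun (primRec f (skip g)) (λ { (zero ∷ xs) → fun f xs ; (suc k ∷ xs) → fun g (k ∷ xs) })
  (λ { (zero ∷ xs) → refl ; (suc k ∷ xs) → cong (fun g) (cong (k ∷_) (args k _ xs)) })
  where
  skip : ∀ {n} → Comp (1 + n) → Comp (2 + n)
  skip g = g ⟪ $ 0F ∷ tabulate (λ i → $ (Fin.suc (Fin.suc i))) ⟫
  args : ∀ {n} x y (xs : Vec ℕ n) → Vec.map (λ g → fun g (x ∷ y ∷ xs)) (tabulate (λ i → $ (Fin.suc (Fin.suc i)))) ≡ xs
  args x y xs = trans (sym (tabulate-∘ (λ g → fun g (x ∷ y ∷ xs)) (λ i → $ (Fin.suc (Fin.suc i)))))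
                      (tabulate∘lookup xs)

-- A first argument that is too large for the list falls through to `d`, which therefore also serves
-- as the case of the last constructor.
switch : ∀ {n r} → Vec (Comp n) r → Comp n → Comp (1 + n)
switch []       d = dropFirst d
switch (f ∷ fs) d = cases f (switch fs d)

add : Comp 2
add = withFun (primRec ($ 0F) (sucᶜ ⟪ $ 1F ∷ [] ⟫)) (λ { (x ∷ y ∷ []) → x + y }) (λ { (x ∷ y ∷ []) → eq x y })
  where
  eq : ∀ x y → fun (primRec ($ 0F) (sucᶜ ⟪ $ 1F ∷ [] ⟫)) (x ∷ y ∷ []) ≡ x + y
  eq zero    y = refl
  eq (suc x) y = cong suc (eq x y)

predᶜ : Comp 1
predᶜ = withFun (cases (const 0) ($ 0F)) (λ { (x ∷ []) → pred x })
  (λ { (zero ∷ []) → refl ; (suc x ∷ []) → refl })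

monus : Comp 2
monus = withFun (flipped ⟪ $ 1F ∷ $ 0F ∷ [] ⟫) (λ { (x ∷ y ∷ []) → x ∸ y }) (λ { (x ∷ y ∷ []) → eq x y })
  where
  flipped : Comp 2
  flipped = primRec ($ 0F) (predᶜ ⟪ $ 1F ∷ [] ⟫)
  eq : ∀ x y → fun flipped (y ∷ x ∷ []) ≡ x ∸ y
  eq x zero    = refl
  eq x (suc y) = trans (cong pred (eq x y)) (pred[m∸n]≡m∸[1+n] x y)

-- Inverting the Cantor pairing

triangleᶜ : Comp 1
triangleᶜ = withFun body (λ { (x ∷ []) → triangle x }) (λ { (x ∷ []) → eq x })
  where
  body : Comp 1
  body = primRec (const 0) (add ⟪ sucᶜ ⟪ $ 0F ∷ [] ⟫ ∷ $ 1F ∷ [] ⟫)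
  eq : ∀ x → fun body (x ∷ []) ≡ triangle x
  eq zero    = refl
  eq (suc x) = cong (suc x +_) (eq x)

-- The largest `s` with `triangle s ≤ n`, that is, the diagonal of the Cantor pairing on which `n`
-- lies. Counting up works because a step from `n` to `suc n` advances by at most one diagonal.
root : ℕ → ℕ
root zero    = 0
root (suc n) with triangle (suc (root n)) ∸ suc n
... | zero  = suc (root n)
... | suc _ = root n

root-up : ∀ n → triangle (suc (root n)) ≤ suc n → root (suc n) ≡ suc (root n)
root-up n le with triangle (suc (root n)) ∸ suc n in eq
... | zero  = refl
... | suc _ with () ← trans (sym eq) (m≤n⇒m∸n≡0 le)

root-stay : ∀ n → suc n < triangle (suc (root n)) → root (suc n) ≡ root n
root-stay n lt with triangle (suc (root n)) ∸ suc n in eq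
... | zero  with () ← <⇒≱ lt (m∸n≡0⇒m≤n eq)
... | suc _ = refl

-- Induction along the enumeration of pairs: `root` stays put inside a diagonal and goes up on the
-- step from `triangle s + s`, the last number of diagonal `s`, to `triangle (suc s)`.
root-triangle : ∀ s y → y ≤ s → root (triangle s + y) ≡ s
root-triangle zero    zero    _   = refl
root-triangle (suc s) zero    _   = begin
  root (suc (s + triangle s) + 0)  ≡⟨ cong root (trans (+-identityʳ _) (cong suc (+-comm s _))) ⟩
  root (suc (triangle s + s))      ≡⟨ root-up _ (≤-reflexive (cong suc (trans (cong (λ r → r + triangle r) ih) (+-comm s _)))) ⟩
  suc (root (triangle s + s))      ≡⟨ cong suc ih ⟩
  suc s                            ∎
  where
  open ≡-Reasoning
  ih = root-triangle s s ≤-refl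
root-triangle s (suc y) y<s = begin
  root (triangle s + suc y)    ≡⟨ cong root (+-suc (triangle s) y) ⟩
  root (suc (triangle s + y))  ≡⟨ root-stay _ (s≤s (subst (suc (triangle s + y) ≤_)
                                   (trans (+-comm (triangle s) s) (cong (λ r → r + triangle r) (sym ih)))
                                   (+-monoʳ-< (triangle s) y<s))) ⟩
  root (triangle s + y)        ≡⟨ ih ⟩
  s                            ∎
  where
  open ≡-Reasoning
  ih = root-triangle s y (<⇒≤ y<s)

rootᶜ : Comp 1
rootᶜ = withFun body (λ { (x ∷ []) → root x }) (λ { (x ∷ []) → eq x })
  where
  test : Comp 3
  test = cases (sucᶜ ⟪ $ 1F ∷ [] ⟫) ($ 2F)
  body : Comp 1
  body = primRec (const 0)
    (test ⟪ monus ⟪ triangleᶜ ⟪ sucᶜ ⟪ $ 1F ∷ [] ⟫ ∷ [] ⟫ ∷ sucᶜ ⟪ $ 0F ∷ [] ⟫ ∷ [] ⟫ ∷ $ 0F ∷ $ 1F ∷ [] ⟫)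
  eq : ∀ x → fun body (x ∷ []) ≡ root x
  eq zero    = refl
  eq (suc x) rewrite eq x with triangle (suc (root x)) ∸ suc x
  ... | zero  = refl
  ... | suc _ = refl

-- Codes of closed formulas are astronomically large numerals: the pairing
-- function is kept opaque so that they are never evaluated.
opaque
  pair : ℕ → ℕ → ℕ
  pair = ⟨_,_⟩

  pair≡ : ∀ x y → pair x y ≡ ⟨ x , y ⟩
  pair≡ x y = refl

  fst snd : ℕ → ℕ
  snd n = n ∸ triangle (root n)
  fst n = root n ∸ snd n

  snd-pair : ∀ x y → snd (pair x y) ≡ y
  snd-pair x y rewrite root-triangle (x + y) y (m≤n+m y x) = m+n∸m≡n (triangle (x + y)) y

  fst-pair : ∀ x y → fst (pair x y) ≡ x
  fst-pair x y = trans (cong (root (pair x y) ∸_) (snd-pair x y))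
    (trans (cong (_∸ y) (root-triangle (x + y) y (m≤n+m y x))) (m+n∸n≡m x y))

  pair-≥ : ∀ x y → x + y ≤ pair x y
  pair-≥ x y = +-mono-≤ {x} (≤-trans (m≤m+n x y) (n≤triangle (x + y))) ≤-refl
    where
    n≤triangle : ∀ n → n ≤ triangle n
    n≤triangle zero    = z≤n
    n≤triangle (suc n) = m≤m+n (suc n) (triangle n)

  snd≡ : ∀ n → n ∸ triangle (root n) ≡ snd n
  snd≡ n = refl

  fst≡ : ∀ n → root n ∸ snd n ≡ fst n
  fst≡ n = refl

pairᶜ : Comp 2
pairᶜ = withFun (add ⟪ triangleᶜ ⟪ add ∷ [] ⟫ ∷ $ 1F ∷ [] ⟫)
  (λ { (x ∷ y ∷ []) → pair x y }) (λ { (x ∷ y ∷ []) → sym (pair≡ x y) })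

sndᶜ : Comp 1
sndᶜ = withFun (monus ⟪ $ 0F ∷ triangleᶜ ⟪ rootᶜ ∷ [] ⟫ ∷ [] ⟫)
  (λ { (x ∷ []) → snd x }) (λ { (x ∷ []) → snd≡ x })

fstᶜ : Comp 1
fstᶜ = withFun (monus ⟪ rootᶜ ∷ sndᶜ ∷ [] ⟫)
  (λ { (x ∷ []) → fst x }) (λ { (x ∷ []) → fst≡ x })

-- The successor keeps nonempty lists apart from `0`, the empty list, by which `dispatch` recognizes
-- that no task is left.
cons : ℕ → ℕ → ℕ
cons x l = suc (pair x l)

consᶜ : Comp 2
consᶜ = withFun (sucᶜ ⟪ pairᶜ ∷ [] ⟫) (λ { (x ∷ l ∷ []) → cons x l }) (λ { (x ∷ l ∷ []) → refl })

-- Recursion over trees whose nodes are numbers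

module TreeEvaluation (leaf value left right : Comp 1) (combine : Comp 3) where

  data Eval (v : ℕ) : ℕ → ℕ → Set where
    at-leaf : fun leaf (v ∷ []) ≡ 0 → Eval v (fun value (v ∷ [])) 1
    at-node : ∀ {k y z s t} → fun leaf (v ∷ []) ≡ suc k →
              Eval (fun left (v ∷ [])) y s → Eval (fun right (v ∷ [])) z t →
              Eval v (fun combine (v ∷ y ∷ z ∷ [])) (suc (t + (s + 1)))

  -- A stack machine; its state consists of a list of tasks (0 , v) to
  -- evaluate v or (1 , v) to combine the two topmost results at v, and of
  -- a list of results.
  private
    todo combining : ℕ → ℕ
    todo      = pair 0
    combining = pair 1

    isLeaf evalLeaf goLeft goRight : ℕ → ℕ
    isLeaf v   = fun leaf (v ∷ [])
    evalLeaf v = fun value (v ∷ [])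
    goLeft v   = fun left (v ∷ [])
    goRight v  = fun right (v ∷ [])

    hd tl : ℕ → ℕ
    hd l = fst (pred l)
    tl l = snd (pred l)

    evaluate : ℕ → ℕ → ℕ → ℕ → ℕ
    evaluate zero    v ts o = pair ts (cons (evalLeaf v) o)
    evaluate (suc _) v ts o = pair (cons (todo (goLeft v)) (cons (todo (goRight v)) (cons (combining v) ts))) o

    perform : ℕ → ℕ → ℕ → ℕ → ℕ
    perform zero    v ts o = evaluate (isLeaf v) v ts o
    -- The right child is evaluated last, so its result lies on top.
    perform (suc _) v ts o = pair ts (cons (fun combine (v ∷ hd (tl o) ∷ hd o ∷ [])) (tl (tl o)))

    dispatch : ℕ → ℕ → ℕ
    dispatch zero    o = pair 0 o
    dispatch (suc l) o = perform (fst (fst l)) (snd (fst l)) (snd l) o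

    step : ℕ → ℕ
    step s = dispatch (fst s) (snd s)

    hdᶜ tlᶜ todoᶜ combiningᶜ : Comp 1
    hdᶜ        = withFun (fstᶜ ⟪ predᶜ ∷ [] ⟫) (λ { (l ∷ []) → hd l }) (λ { (l ∷ []) → refl })
    tlᶜ        = withFun (sndᶜ ⟪ predᶜ ∷ [] ⟫) (λ { (l ∷ []) → tl l }) (λ { (l ∷ []) → refl })
    todoᶜ      = withFun (pairᶜ ⟪ const 0 ∷ $ 0F ∷ [] ⟫) (λ { (v ∷ []) → todo v }) (λ { (v ∷ []) → refl })
    combiningᶜ = withFun (pairᶜ ⟪ const 1 ∷ $ 0F ∷ [] ⟫) (λ { (v ∷ []) → combining v }) (λ { (v ∷ []) → refl })

    evaluateᶜ : Comp 4
    evaluateᶜ = withFun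
      (cases
        (pairᶜ ⟪ $ 1F ∷ consᶜ ⟪ value ⟪ $ 0F ∷ [] ⟫ ∷ $ 2F ∷ [] ⟫ ∷ [] ⟫)
        (pairᶜ ⟪ consᶜ ⟪ todoᶜ ⟪ left ⟪ $ 1F ∷ [] ⟫ ∷ [] ⟫
             ∷ consᶜ ⟪ todoᶜ ⟪ right ⟪ $ 1F ∷ [] ⟫ ∷ [] ⟫
             ∷ consᶜ ⟪ combiningᶜ ⟪ $ 1F ∷ [] ⟫ ∷ $ 2F ∷ [] ⟫ ∷ [] ⟫ ∷ [] ⟫
             ∷ $ 3F ∷ [] ⟫))
      (λ { (k ∷ v ∷ ts ∷ o ∷ []) → evaluate k v ts o })
      (λ { (zero ∷ v ∷ ts ∷ o ∷ []) → refl ; (suc k ∷ v ∷ ts ∷ o ∷ []) → refl })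

    performᶜ : Comp 4
    performᶜ = withFun
      (cases
        (evaluateᶜ ⟪ leaf ⟪ $ 0F ∷ [] ⟫ ∷ $ 0F ∷ $ 1F ∷ $ 2F ∷ [] ⟫)
        (pairᶜ ⟪ $ 2F ∷ consᶜ ⟪ combine ⟪ $ 1F ∷ hdᶜ ⟪ tlᶜ ⟪ $ 3F ∷ [] ⟫ ∷ [] ⟫ ∷ hdᶜ ⟪ $ 3F ∷ [] ⟫ ∷ [] ⟫
                              ∷ tlᶜ ⟪ tlᶜ ⟪ $ 3F ∷ [] ⟫ ∷ [] ⟫ ∷ [] ⟫ ∷ [] ⟫))
      (λ { (k ∷ v ∷ ts ∷ o ∷ []) → perform k v ts o })
      (λ { (zero ∷ v ∷ ts ∷ o ∷ []) → refl ; (suc k ∷ v ∷ ts ∷ o ∷ []) → refl })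

    dispatchᶜ : Comp 2
    dispatchᶜ = withFun
      (cases
        (pairᶜ ⟪ const 0 ∷ $ 0F ∷ [] ⟫)
        (performᶜ ⟪ fstᶜ ⟪ fstᶜ ⟪ $ 0F ∷ [] ⟫ ∷ [] ⟫ ∷ sndᶜ ⟪ fstᶜ ⟪ $ 0F ∷ [] ⟫ ∷ [] ⟫ ∷ sndᶜ ⟪ $ 0F ∷ [] ⟫ ∷ $ 1F ∷ [] ⟫))
      (λ { (k ∷ o ∷ []) → dispatch k o })
      (λ { (zero ∷ o ∷ []) → refl ; (suc k ∷ o ∷ []) → refl })

    stepᶜ : Comp 1
    stepᶜ = withFun (dispatchᶜ ⟪ fstᶜ ∷ sndᶜ ∷ [] ⟫) (λ { (s ∷ []) → step s }) (λ { (s ∷ []) → refl })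

    run : ℕ → ℕ → ℕ
    run zero    s = s
    run (suc k) s = step (run k s)

    run-+ : ∀ a b s → run (a + b) s ≡ run a (run b s)
    run-+ zero    b s = refl
    run-+ (suc a) b s = cong step (run-+ a b s)

    step-halted : ∀ o → step (pair 0 o) ≡ pair 0 o
    step-halted o rewrite fst-pair 0 o | snd-pair 0 o = refl

    run-halted : ∀ k o → run k (pair 0 o) ≡ pair 0 o
    run-halted zero    o = refl
    run-halted (suc k) o = trans (cong step (run-halted k o)) (step-halted o)

    step-leaf : ∀ v ts o → fun leaf (v ∷ []) ≡ 0 →
                step (pair (cons (todo v) ts) o) ≡ pair ts (cons (fun value (v ∷ [])) o)
    step-leaf v ts o eq
      rewrite fst-pair (cons (todo v) ts) o | snd-pair (cons (todo v) ts) o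
            | fst-pair (todo v) ts | snd-pair (todo v) ts | fst-pair 0 v | snd-pair 0 v | eq = refl

    step-node : ∀ v ts o {k} → fun leaf (v ∷ []) ≡ suc k →
                step (pair (cons (todo v) ts) o) ≡
                pair (cons (todo (fun left (v ∷ []))) (cons (todo (fun right (v ∷ []))) (cons (combining v) ts))) o
    step-node v ts o eq
      rewrite fst-pair (cons (todo v) ts) o | snd-pair (cons (todo v) ts) o
            | fst-pair (todo v) ts | snd-pair (todo v) ts | fst-pair 0 v | snd-pair 0 v | eq = refl

    step-combine : ∀ v y z ts o →
                   step (pair (cons (combining v) ts) (cons z (cons y o))) ≡
                   pair ts (cons (fun combine (v ∷ y ∷ z ∷ [])) o)
    step-combine v y z ts o
      rewrite fst-pair (cons (combining v) ts) (cons z (cons y o)) | snd-pair (cons (combining v) ts) (cons z (cons y o))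
            | fst-pair (combining v) ts | snd-pair (combining v) ts | fst-pair 1 v | snd-pair 1 v
            | fst-pair z (cons y o) | snd-pair z (cons y o) | fst-pair y o | snd-pair y o = refl

    -- The statement for arbitrary remaining tasks `ts` and results `o` is what the induction needs:
    -- the left child is evaluated with its sibling still pending, the right one with the result of
    -- the left one already stored.
    run-eval : ∀ {v y s} → Eval v y s → ∀ ts o →
               run s (pair (cons (todo v) ts) o) ≡ pair ts (cons y o)
    run-eval {v} (at-leaf eq) ts o = step-leaf v ts o eq
    run-eval {v} (at-node {y = y} {z} {s} {t} eq ey ez) ts o = begin
      step (run (t + (s + 1)) start)       ≡⟨ cong step (trans (run-+ t (s + 1) start) (cong (run t) (run-+ s 1 start))) ⟩
      step (run t (run s (step start)))    ≡⟨ cong (step ∘ run t ∘ run s) (step-node v ts o eq) ⟩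
      step (run t (run s _))               ≡⟨ cong (step ∘ run t) (run-eval ey _ o) ⟩
      step (run t _)                       ≡⟨ cong step (run-eval ez _ _) ⟩
      step _                               ≡⟨ step-combine v y z ts o ⟩
      _                                    ∎
      where
      open ≡-Reasoning
      start = pair (cons (todo v) ts) o

    runᶜ : Comp 2
    runᶜ = withFun body (λ { (k ∷ s ∷ []) → run k s }) (λ { (k ∷ s ∷ []) → eq k s })
      where
      body : Comp 2
      body = primRec ($ 0F) (stepᶜ ⟪ $ 1F ∷ [] ⟫)
      eq : ∀ k s → fun body (k ∷ s ∷ []) ≡ run k s
      eq zero    s = refl
      eq (suc k) s = cong step (eq k s)

  evalWithin : Comp 2
  evalWithin = hdᶜ ⟪ sndᶜ ⟪ runᶜ ⟪ $ 0F ∷ pairᶜ ⟪ consᶜ ⟪ pairᶜ ⟪ const 0 ∷ $ 1F ∷ [] ⟫ ∷ const 0 ∷ [] ⟫ ∷ const 0 ∷ [] ⟫ ∷ [] ⟫ ∷ [] ⟫ ∷ [] ⟫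

  -- Surplus fuel is harmless, since a state without tasks is a fixed point of `step`; an upper
  -- bound on the number of steps thus suffices.
  evalWithin-correct : ∀ {v y s fuel} → Eval v y s → s ≤ fuel → fun evalWithin (fuel ∷ v ∷ []) ≡ y
  evalWithin-correct {v} {y} {s} {fuel} e s≤fuel
    rewrite sym (m∸n+n≡m s≤fuel) | run-+ (fuel ∸ s) s (pair (cons (todo v) 0) 0) | run-eval e 0 0
          | run-halted (fuel ∸ s) (cons y 0) | snd-pair 0 (cons y 0) | fst-pair y 0 = refl

-- Codes of terms and formulas

pair₃ : ℕ → ℕ → ℕ → ℕ
pair₃ t x y = pair t (pair x y)

pair-cong : ∀ {x x′ y y′} → x ≡ x′ → y ≡ y′ → pair x y ≡ ⟨ x′ , y′ ⟩
pair-cong {x} {y = y} refl refl = pair≡ x y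

codeT : ∀ {n} → Term n → ℕ
codeT (var x) = pair 0 (toℕ x)
codeT (s ⊕ t) = pair₃ 1 (codeT s) (codeT t)
codeT (s ⊗ t) = pair₃ 2 (codeT s) (codeT t)

codeT≡ : ∀ {n} (t : Term n) → codeT t ≡ codeTerm t
codeT≡ (var x) = pair≡ _ _
codeT≡ (s ⊕ t) = pair-cong refl (pair-cong (codeT≡ s) (codeT≡ t))
codeT≡ (s ⊗ t) = pair-cong refl (pair-cong (codeT≡ s) (codeT≡ t))

codeSO : ∀ {n m} → SOFormula n m → ℕ
codeSO (s ≐ t) = pair₃ 0 (codeT s) (codeT t)
codeSO (s ≺ t) = pair₃ 1 (codeT s) (codeT t)
codeSO (t ϵ A) = pair₃ 2 (codeT t) (toℕ A)
codeSO (¬ᶠ φ)  = pair 3 (codeSO φ)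
codeSO (φ ∧ ψ) = pair₃ 4 (codeSO φ) (codeSO ψ)
codeSO (φ ∨ ψ) = pair₃ 5 (codeSO φ) (codeSO ψ)
codeSO (φ ⇒ ψ) = pair₃ 6 (codeSO φ) (codeSO ψ)
codeSO (∀₁ φ)  = pair 7 (codeSO φ)
codeSO (∃₁ φ)  = pair 8 (codeSO φ)
codeSO (∀₂ φ)  = pair 9 (codeSO φ)
codeSO (∃₂ φ)  = pair 10 (codeSO φ)

codeSO≡ : ∀ {n m} (φ : SOFormula n m) → codeSO φ ≡ codeSOFormula φ
codeSO≡ (s ≐ t) = pair-cong refl (pair-cong (codeT≡ s) (codeT≡ t))
codeSO≡ (s ≺ t) = pair-cong refl (pair-cong (codeT≡ s) (codeT≡ t))
codeSO≡ (t ϵ A) = pair-cong refl (pair-cong (codeT≡ t) refl)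
codeSO≡ (¬ᶠ φ)  = pair-cong refl (codeSO≡ φ)
codeSO≡ (φ ∧ ψ) = pair-cong refl (pair-cong (codeSO≡ φ) (codeSO≡ ψ))
codeSO≡ (φ ∨ ψ) = pair-cong refl (pair-cong (codeSO≡ φ) (codeSO≡ ψ))
codeSO≡ (φ ⇒ ψ) = pair-cong refl (pair-cong (codeSO≡ φ) (codeSO≡ ψ))
codeSO≡ (∀₁ φ)  = pair-cong refl (codeSO≡ φ)
codeSO≡ (∃₁ φ)  = pair-cong refl (codeSO≡ φ)
codeSO≡ (∀₂ φ)  = pair-cong refl (codeSO≡ φ)
codeSO≡ (∃₂ φ)  = pair-cong refl (codeSO≡ φ)

codeI : ∀ {n} → InqLTL n → ℕ
codeI ⊥ᶠ       = pair 0 0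
codeI (atom p) = pair 1 (toℕ p)
codeI (φ ∨ᵇ ψ) = pair₃ 2 (codeI φ) (codeI ψ)
codeI (φ ∧ ψ)  = pair₃ 3 (codeI φ) (codeI ψ)
codeI (φ ⇒ ψ)  = pair₃ 4 (codeI φ) (codeI ψ)
codeI (X φ)    = pair 5 (codeI φ)
codeI (φ U ψ)  = pair₃ 6 (codeI φ) (codeI ψ)
codeI (φ R ψ)  = pair₃ 7 (codeI φ) (codeI ψ)
codeI (∼ φ)    = pair 8 (codeI φ)

codeI≡ : ∀ {n} (φ : InqLTL n) → codeI φ ≡ codeInqLTL φ
codeI≡ ⊥ᶠ       = pair≡ 0 0
codeI≡ (atom p) = pair≡ _ _
codeI≡ (φ ∨ᵇ ψ) = pair-cong refl (pair-cong (codeI≡ φ) (codeI≡ ψ))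
codeI≡ (φ ∧ ψ)  = pair-cong refl (pair-cong (codeI≡ φ) (codeI≡ ψ))
codeI≡ (φ ⇒ ψ)  = pair-cong refl (pair-cong (codeI≡ φ) (codeI≡ ψ))
codeI≡ (X φ)    = pair-cong refl (codeI≡ φ)
codeI≡ (φ U ψ)  = pair-cong refl (pair-cong (codeI≡ φ) (codeI≡ ψ))
codeI≡ (φ R ψ)  = pair-cong refl (pair-cong (codeI≡ φ) (codeI≡ ψ))
codeI≡ (∼ φ)    = pair-cong refl (codeI≡ φ)

-- Undefinability of truth

mutual
  ⇓-deterministic : ∀ {n} {f : Rec n} {xs y z} → f · xs ⇓ y → f · xs ⇓ z → y ≡ z
  ⇓-deterministic ⇓-zero ⇓-zero = refl
  ⇓-deterministic ⇓-suc ⇓-suc = refl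
  ⇓-deterministic (⇓-proj i) (⇓-proj .i) = refl
  ⇓-deterministic (⇓-comp ps p) (⇓-comp qs q) with ⇓-deterministics ps qs
  ... | refl = ⇓-deterministic p q
  ⇓-deterministic (⇓-prec-zero p) (⇓-prec-zero q) = ⇓-deterministic p q
  ⇓-deterministic (⇓-prec-suc p p′) (⇓-prec-suc q q′) with ⇓-deterministic p q
  ... | refl = ⇓-deterministic p′ q′
  ⇓-deterministic {y = j} {k} (⇓-μ p p<) (⇓-μ q q<) with <-cmp j k
  ... | tri≈ _ eq _ = eq
  ... | tri< j<k _ _ with () ← ⇓-deterministic p (proj₂ (q< j j<k))
  ... | tri> _ _ k<j with () ← ⇓-deterministic (proj₂ (p< k k<j)) q

  ⇓-deterministics : ∀ {m n} {gs : Vec (Rec n) m} {xs ys zs} →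
                     Pointwise (λ g y → g · xs ⇓ y) gs ys → Pointwise (λ g y → g · xs ⇓ y) gs zs → ys ≡ zs
  ⇓-deterministics []       []       = refl
  ⇓-deterministics (p ∷ ps) (q ∷ qs) = cong₂ _∷_ (⇓-deterministic p q) (⇓-deterministics ps qs)

isZero : ∀ {n m} → Fin n → SOFormula n m
isZero y = ∀₁ (¬ᶠ (var 0F ≺ var (suc y)))

isSuc : ∀ {n m} → Fin n → Fin n → SOFormula n m
isSuc x y = (var x ≺ var y) ∧ (¬ᶠ (∃₁ ((var (suc x) ≺ var 0F) ∧ (var 0F ≺ var (suc y)))))

module _ {n m : ℕ} (ρ : Vec ℕ n) (σ : Vec (Pred ℕ 0ℓ) m) where

  isZero-correct : ∀ y → Holds ρ σ (isZero y) ⇔ lookup ρ y ≡ 0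
  isZero-correct y = mk⇔ (λ h → n<1⇒n≡0 (s≤s (≮⇒≥ (λ lt → h 0 (lift lt)))))
                         (λ eq x lt → n≮0 (subst (x <_) eq (lower lt)))

  isSuc-correct : ∀ x y → Holds ρ σ (isSuc x y) ⇔ suc (lookup ρ x) ≡ lookup ρ y
  isSuc-correct x y = mk⇔
    (λ { (lt , h) → ≤-antisym (lower lt) (≮⇒≥ (λ lt′ → h (suc (lookup ρ x) , lift ≤-refl , lift lt′))) })
    (λ eq → lift (≤-reflexive eq) ,
            (λ { (z , lt , lt′) → <⇒≱ (lower lt) (s≤s⁻¹ (subst (z <_) (sym eq) (lower lt′))) }))

-- A pairing that is a polynomial, hence a term of the language: through it a set variable can stand
-- for a binary relation.
squarePair : ∀ {n} → Term n → Term n → Term n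
squarePair s t = ((s ⊕ t) ⊗ (s ⊕ t)) ⊕ s

square-pair : ℕ → ℕ → ℕ
square-pair k y = (k + y) * (k + y) + k

-- With `s = k + y`, the value `s * s + k` lies below the square of `suc s` because `k ≤ s`. So it
-- determines `s`, then `k` and finally `y`.
square-pair-injective : ∀ {k y l z} → square-pair k y ≡ square-pair l z → k ≡ l × y ≡ z
square-pair-injective {k} {y} {l} {z} eq = k≡l , +-cancelˡ-≡ k y z (trans sums (cong (_+ z) (sym k≡l)))
  where
  mono : ∀ {k y l z} → k + y < l + z → square-pair k y < square-pair l z
  mono {k} {y} {l} {z} lt = begin-strict
    (k + y) * (k + y) + k              ≤⟨ +-monoʳ-≤ ((k + y) * (k + y)) (m≤m+n k y) ⟩
    (k + y) * (k + y) + (k + y)        ≡⟨ +-comm ((k + y) * (k + y)) (k + y) ⟩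
    suc (k + y) * (k + y)              <⟨ *-monoʳ-< (suc (k + y)) (n<1+n (k + y)) ⟩
    suc (k + y) * suc (k + y)          ≤⟨ *-mono-≤ lt lt ⟩
    (l + z) * (l + z)                  ≤⟨ m≤m+n ((l + z) * (l + z)) l ⟩
    (l + z) * (l + z) + l              ∎
    where open ≤-Reasoning
  sums : k + y ≡ l + z
  sums with <-cmp (k + y) (l + z)
  ... | tri≈ _ e _ = e
  ... | tri< lt _ _ = ⊥-elim (<-irrefl eq (mono {k} {y} {l} {z} lt))
  ... | tri> _ _ gt = ⊥-elim (<-irrefl (sym eq) (mono {l} {z} {k} {y} gt))
  k≡l : k ≡ l
  k≡l = +-cancelˡ-≡ ((k + y) * (k + y)) k l (trans eq (cong (λ s → s * s + l) (sym sums)))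

values : ∀ {n k} → Vec ℕ n → Vec (Fin n) k → Vec ℕ k
values ρ = map (lookup ρ)

mutual
  -- Primitive recursion is the case that uses second-order quantification: `(k , y)` lies in every
  -- set of coded pairs that contains the initial values and is closed under the recursion step. No
  -- coding of computation sequences is involved.
  graph : ∀ {k n m} → Rec k → Vec (Fin n) k → Fin n → SOFormula n m
  graph zeroᶠ       xs       y = isZero y
  graph sucᶠ        (x ∷ []) y = isSuc x y
  graph (proj i)    xs       y = var (lookup xs i) ≐ var y
  graph (comp f gs) xs       y = graphs gs xs (λ r ys → graph f ys (r y))
  graph (prec f g)  (k ∷ xs) y = ∀₂ (start ⇒ (next ⇒ (squarePair (var k) (var y) ϵ 0F)))
    where
    start = ∀₁ (∀₁ (isZero 1F ⇒ (graph f (map (2 ↑ʳ_) xs) 0F ⇒ (squarePair (var 1F) (var 0F) ϵ 0F))))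
    next  = ∀₁ (∀₁ (∀₁ (∀₁ ((squarePair (var 3F) (var 1F) ϵ 0F) ⇒ (isSuc 3F 2F ⇒
              (graph g (3F ∷ 1F ∷ map (4 ↑ʳ_) xs) 0F ⇒ (squarePair (var 2F) (var 0F) ϵ 0F)))))))
  graph (μ f)       xs       y =
      ∃₁ (isZero 0F ∧ graph f (suc y ∷ map suc xs) 0F)
    ∧ ∀₁ ((var 0F ≺ var (suc y)) ⇒ (∃₁ (∃₁ (isSuc 0F 1F ∧ graph f (2F ∷ map (3 ↑ʳ_) xs) 1F))))

  -- The intermediate values are bound one after the other, and each binder shifts the variables
  -- outside. The continuation therefore receives both the renaming of the old variables and the
  -- variables of the values.
  graphs : ∀ {k j n m} → Vec (Rec k) j → Vec (Fin n) k →
           (∀ {n′} → (Fin n → Fin n′) → Vec (Fin n′) j → SOFormula n′ m) → SOFormula n m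
  graphs []       xs K = K id []
  graphs (g ∷ gs) xs K = ∃₁ (graph g (map suc xs) 0F ∧
                             graphs gs (map suc xs) (λ r ys → K (λ x → r (suc x)) (r 0F ∷ ys)))

values-weaken : ∀ {n n′ k} (ρ : Vec ℕ n) (ρ′ : Vec ℕ n′) (r : Fin n → Fin n′) (xs : Vec (Fin n) k) →
                (∀ x → lookup ρ′ (r x) ≡ lookup ρ x) → values ρ′ (map r xs) ≡ values ρ xs
values-weaken ρ ρ′ r xs eq = trans (sym (map-∘ (lookup ρ′) r xs)) (map-cong eq xs)

module _ {n k : ℕ} (ρ : Vec ℕ n) (xs : Vec (Fin n) k) where

  weaken₁ : ∀ a → values (a ∷ ρ) (map suc xs) ≡ values ρ xs
  weaken₁ a = values-weaken ρ (a ∷ ρ) suc xs (λ _ → refl)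

  weaken₂ : ∀ a b → values (a ∷ b ∷ ρ) (map (2 ↑ʳ_) xs) ≡ values ρ xs
  weaken₂ a b = values-weaken ρ (a ∷ b ∷ ρ) (2 ↑ʳ_) xs (λ _ → refl)

  weaken₃ : ∀ a b c → values (a ∷ b ∷ c ∷ ρ) (map (3 ↑ʳ_) xs) ≡ values ρ xs
  weaken₃ a b c = values-weaken ρ (a ∷ b ∷ c ∷ ρ) (3 ↑ʳ_) xs (λ _ → refl)

  weaken₄ : ∀ a b c d → values (a ∷ b ∷ c ∷ d ∷ ρ) (map (4 ↑ʳ_) xs) ≡ values ρ xs
  weaken₄ a b c d = values-weaken ρ (a ∷ b ∷ c ∷ d ∷ ρ) (4 ↑ʳ_) xs (λ _ → refl)

infix 6 _▸_
_▸_ : ∀ {k} {f : Rec k} {xs xs′ y} → xs ≡ xs′ → f · xs ⇓ y → f · xs′ ⇓ y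
refl ▸ p = p

infixl 5 _◂_
_◂_ : ∀ {k} {f : Rec k} {xs y z} → f · xs ⇓ y → y ≡ z → f · xs ⇓ z
p ◂ refl = p

mutual
  graph-correct : ∀ {k n m} (f : Rec k) (ρ : Vec ℕ n) (σ : Vec (Pred ℕ 0ℓ) m) xs y →
                  Holds ρ σ (graph f xs y) ⇔ f · values ρ xs ⇓ lookup ρ y
  graph-correct zeroᶠ ρ σ xs y = mk⇔
    (λ h → ⇓-zero ◂ sym (to (isZero-correct ρ σ y) h))
    (λ p → from (isZero-correct ρ σ y) (⇓-deterministic p ⇓-zero))
  graph-correct sucᶠ ρ σ (x ∷ []) y = mk⇔
    (λ h → ⇓-suc ◂ to (isSuc-correct ρ σ x y) h)
    (λ p → from (isSuc-correct ρ σ x y) (⇓-deterministic ⇓-suc p))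
  graph-correct (proj i) ρ σ xs y = mk⇔
    (λ h → ⇓-proj i ◂ trans (lookup-map i (lookup ρ) xs) (lower h))
    (λ p → lift (trans (sym (lookup-map i (lookup ρ) xs)) (⇓-deterministic (⇓-proj i) p)))
  graph-correct (comp f gs) ρ σ xs y = mk⇔
    (λ h → let zs , ps , p = to (graphs-correct gs ρ σ xs _ (λ zs → f · zs ⇓ lookup ρ y) correct) h
           in ⇓-comp ps p)
    (λ { (⇓-comp ps p) → from (graphs-correct gs ρ σ xs _ (λ zs → f · zs ⇓ lookup ρ y) correct) (_ , ps , p) })
    where
    correct : ∀ {n′} (ρ′ : Vec ℕ n′) r → (∀ x → lookup ρ′ (r x) ≡ lookup ρ x) → ∀ ys →
              Holds ρ′ σ (graph f ys (r y)) ⇔ f · values ρ′ ys ⇓ lookup ρ y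
    correct ρ′ r eq ys = subst (λ z → Holds ρ′ σ (graph f ys (r y)) ⇔ f · values ρ′ ys ⇓ z) (eq y)
                               (graph-correct f ρ′ σ ys (r y))
  graph-correct (prec f g) ρ σ (k ∷ xs) y = mk⇔ complete (λ p A s n → sound A s n p)
    where
    vs = values ρ xs
    Graph : Pred ℕ 0ℓ
    Graph c = ∃[ l ] ∃[ z ] c ≡ square-pair l z × prec f g · l ∷ vs ⇓ z

    complete : Holds ρ σ (graph (prec f g) (k ∷ xs) y) → prec f g · lookup ρ k ∷ vs ⇓ lookup ρ y
    -- The quantified set is instantiated with the coded graph of the recursion itself; its two
    -- closure conditions are the two rules for `prec`.
    complete h with h Graph
      (λ i z i≡0 p → lift (i , z , refl , subst (λ i → prec f g · i ∷ vs ⇓ z) (sym (to (isZero-correct (z ∷ i ∷ ρ) (Graph ∷ σ) 1F) i≡0))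
        (⇓-prec-zero (weaken₂ ρ xs z i ▸ to (graph-correct f (z ∷ i ∷ ρ) _ _ 0F) p))))
      (λ { i i′ w z (lift (l , w′ , eq , p)) i′≡ q → lift (i′ , z , refl , next {i} {w = w} {w′ = w′} eq p (to (isSuc-correct (z ∷ w ∷ i′ ∷ i ∷ ρ) (Graph ∷ σ) 3F 2F) i′≡)
             (cong (λ vs → i ∷ w ∷ vs) (weaken₄ ρ xs z w i′ i) ▸ to (graph-correct g (z ∷ w ∷ i′ ∷ i ∷ ρ) _ _ 0F) q)) })
      where
      next : ∀ {i i′ w z l w′} → square-pair i w ≡ square-pair l w′ → prec f g · l ∷ vs ⇓ w′ → suc i ≡ i′ →
             g · i ∷ w ∷ vs ⇓ z → prec f g · i′ ∷ vs ⇓ z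
      next {i} {w = w} {l = l} {w′} eq p refl q with refl , refl ← square-pair-injective {i} {w} {l} {w′} eq = ⇓-prec-suc p q
    ... | lift (l , z , eq , p) with k≡l , y≡z ← square-pair-injective {lookup ρ k} {lookup ρ y} {l} {z} eq =
      subst₂ (λ l z → prec f g · l ∷ vs ⇓ z) (sym k≡l) (sym y≡z) p

    sound : ∀ A → _ → _ → ∀ {l z} → prec f g · l ∷ vs ⇓ z → Lift _ (A (square-pair l z))
    sound A start next {z = z} (⇓-prec-zero p) = start 0 z (from (isZero-correct (z ∷ 0 ∷ ρ) (A ∷ σ) 1F) refl)
      (from (graph-correct f (z ∷ 0 ∷ ρ) (A ∷ σ) (map (2 ↑ʳ_) xs) 0F) (sym (weaken₂ ρ xs z 0) ▸ p))
    sound A start next {suc l} {z} (⇓-prec-suc {y = w} p q) =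
      next l (suc l) w z (sound A start next p) (from (isSuc-correct (z ∷ w ∷ suc l ∷ l ∷ ρ) (A ∷ σ) 3F 2F) refl)
      (from (graph-correct g (z ∷ w ∷ suc l ∷ l ∷ ρ) (A ∷ σ) (3F ∷ 1F ∷ map (4 ↑ʳ_) xs) 0F)
        (cong (λ vs → l ∷ w ∷ vs) (sym (weaken₄ ρ xs z w (suc l) l)) ▸ q))
  graph-correct (μ f) ρ σ xs y = mk⇔
    (λ { ((z , z≡0 , p) , h) → ⇓-μ
      ((cong (lookup ρ y ∷_) (weaken₁ ρ xs z) ▸ to (graph-correct f (z ∷ ρ) σ _ 0F) p) ◂ to (isZero-correct (z ∷ ρ) σ 0F) z≡0)
      (λ i i<y → let z , u , z≡ , q = h i (lift i<y) in
        u , (cong (i ∷_) (weaken₃ ρ xs u z i) ▸ to (graph-correct f (u ∷ z ∷ i ∷ ρ) σ _ 1F) q)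
             ◂ sym (to (isSuc-correct (u ∷ z ∷ i ∷ ρ) σ 0F 1F) z≡)) })
    (λ { (⇓-μ p h) →
        (0 , from (isZero-correct (0 ∷ ρ) σ 0F) refl ,
             from (graph-correct f (0 ∷ ρ) σ (suc y ∷ map suc xs) 0F) (cong (lookup ρ y ∷_) (sym (weaken₁ ρ xs 0)) ▸ p)) ,
        (λ i i<y → let u , q = h i (lower i<y) in
          suc u , u , from (isSuc-correct (u ∷ suc u ∷ i ∷ ρ) σ 0F 1F) refl ,
          from (graph-correct f (u ∷ suc u ∷ i ∷ ρ) σ (2F ∷ map (3 ↑ʳ_) xs) 1F)
            (cong (i ∷_) (sym (weaken₃ ρ xs u (suc u) i)) ▸ q)) })

  graphs-correct : ∀ {k j n m} (gs : Vec (Rec k) j) (ρ : Vec ℕ n) (σ : Vec (Pred ℕ 0ℓ) m) xs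
    (K : ∀ {n′} → (Fin n → Fin n′) → Vec (Fin n′) j → SOFormula n′ m) (P : Vec ℕ j → Set) →
    (∀ {n′} (ρ′ : Vec ℕ n′) r → (∀ x → lookup ρ′ (r x) ≡ lookup ρ x) → ∀ ys → Holds ρ′ σ (K r ys) ⇔ P (values ρ′ ys)) →
    Holds ρ σ (graphs gs xs K) ⇔ (∃[ zs ] Pointwise (λ g z → g · values ρ xs ⇓ z) gs zs × P zs)
  graphs-correct []       ρ σ xs K P correct = mk⇔
    (λ h → [] , [] , to (correct ρ id (λ _ → refl) []) h)
    (λ { ([] , [] , p) → from (correct ρ id (λ _ → refl) []) p })
  graphs-correct (g ∷ gs) ρ σ xs K P correct = mk⇔
    (λ { (z , p , h) → let zs , ps , q = to (rest z) h in
         z ∷ zs , (weaken z ▸ to (graph-correct g (z ∷ ρ) σ (map suc xs) 0F) p)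
                  ∷ subst (λ vs → Pointwise (λ g z → g · vs ⇓ z) gs zs) (weaken z) ps , q })
    (λ { (z ∷ zs , p ∷ ps , q) →
         z , from (graph-correct g (z ∷ ρ) σ (map suc xs) 0F) (sym (weaken z) ▸ p) ,
         from (rest z) (zs , subst (λ vs → Pointwise (λ g z → g · vs ⇓ z) gs zs) (sym (weaken z)) ps , q) })
    where
    weaken : ∀ z → values (z ∷ ρ) (map suc xs) ≡ values ρ xs
    weaken z = weaken₁ ρ xs z
    rest : ∀ z → _
    rest z = graphs-correct gs (z ∷ ρ) σ (map suc xs) (λ r ys → K (λ x → r (suc x)) (r 0F ∷ ys)) (λ zs → P (z ∷ zs))
      (λ ρ′ r eq ys → subst (λ v → Holds ρ′ σ (K (λ x → r (suc x)) (r 0F ∷ ys)) ⇔ P (v ∷ values ρ′ ys)) (eq 0F)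
                            (correct ρ′ (λ x → r (suc x)) (λ x → eq (suc x)) (r 0F ∷ ys)))

numeral : ∀ {n m} → ℕ → SOFormula (suc n) m
numeral zero    = isZero 0F
numeral (suc c) = ∃₁ (numeral c ∧ isSuc 0F 1F)

numeral-correct : ∀ {n m} c x (ρ : Vec ℕ n) (σ : Vec (Pred ℕ 0ℓ) m) → Holds (x ∷ ρ) σ (numeral c) ⇔ x ≡ c
numeral-correct zero    x ρ σ = isZero-correct (x ∷ ρ) σ 0F
numeral-correct (suc c) x ρ σ = mk⇔
  (λ { (z , h , h′) → trans (sym (to (isSuc-correct (z ∷ x ∷ ρ) σ 0F 1F) h′)) (cong suc (to (numeral-correct c z (x ∷ ρ) σ) h)) })
  (λ eq → c , from (numeral-correct c c (x ∷ ρ) σ) refl , from (isSuc-correct (c ∷ x ∷ ρ) σ 0F 1F) (sym eq))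

-- The sentence "the number coded by φ satisfies φ".
diagonalize : SOFormula 1 0 → SOSentence
diagonalize φ = ∃₁ (numeral (codeSO φ) ∧ φ)

numeralᶜ : Comp 1
numeralᶜ = primRec (const (codeSO {1} {0} (isZero 0F)))
  (pairᶜ ⟪ const 8 ∷ pairᶜ ⟪ const 4 ∷ pairᶜ ⟪ $ 1F ∷ const (codeSO {2} {0} (isSuc 0F 1F)) ∷ [] ⟫ ∷ [] ⟫ ∷ [] ⟫)

-- Stated for all `n` because `numeral (suc c)` contains `numeral c` with one more free variable.
-- Codes do not record the number of free variables, so a single recursion covers all of them.
numeralᶜ-code : ∀ {n} c → fun numeralᶜ (c ∷ []) ≡ codeSO {suc n} {0} (numeral c)
numeralᶜ-code zero    = refl
numeralᶜ-code (suc c) = cong (λ k → pair 8 (pair 4 (pair k (codeSO {2} {0} (isSuc 0F 1F))))) (numeralᶜ-code c)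

diagonalizeᶜ : Comp 1
diagonalizeᶜ = pairᶜ ⟪ const 8 ∷ pairᶜ ⟪ const 4 ∷ pairᶜ ⟪ numeralᶜ ∷ $ 0F ∷ [] ⟫ ∷ [] ⟫ ∷ [] ⟫

diagonalizeᶜ-code : ∀ φ → fun diagonalizeᶜ (codeSO φ ∷ []) ≡ codeSO (diagonalize φ)
diagonalizeᶜ-code φ = cong (λ k → pair 8 (pair 4 (pair k (codeSO φ)))) (numeralᶜ-code (codeSO φ))

-- `S` says that `d` does not answer `1` on the code of `S`. If `S` held, `d` would answer `1`,
-- contrary to `S`. So `S` fails and `d` answers `0`; then by determinism it does not answer `1`,
-- and `S` holds after all.
SecondOrderTruth-undecidable : Undecidable SecondOrderTruth
SecondOrderTruth-undecidable (d , decides) = S-false S-true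
  where
  f : Rec 1
  f = comp d (rec diagonalizeᶜ ∷ [])

  liar : SOFormula 1 0
  liar = ¬ᶠ ∃₁ (numeral 1 ∧ graph f (1F ∷ []) 0F)

  S : SOSentence
  S = diagonalize liar

  codeS : fun diagonalizeᶜ (codeSO liar ∷ []) ≡ codeSOFormula S
  codeS = trans (diagonalizeᶜ-code liar) (codeSO≡ S)

  S⇒ : Holds [] [] S → ¬ (f · codeSO liar ∷ [] ⇓ 1)
  S⇒ (c , c≡ , h) p = h (1 , from (numeral-correct 1 1 (c ∷ []) []) refl ,
    from (graph-correct f (1 ∷ c ∷ []) [] (1F ∷ []) 0F)
      (cong (_∷ []) (sym (to (numeral-correct (codeSO liar) c [] []) c≡)) ▸ p))

  S⇐ : ¬ (f · codeSO liar ∷ [] ⇓ 1) → Holds [] [] S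
  S⇐ np = codeSO liar , from (numeral-correct (codeSO liar) (codeSO liar) [] []) refl ,
    (λ { (y , y≡1 , h) → np (to (graph-correct f (y ∷ codeSO liar ∷ []) [] (1F ∷ []) 0F) h
                              ◂ to (numeral-correct 1 y (codeSO liar ∷ []) []) y≡1) })

  f-at-liar : ∀ {y} → d · codeSOFormula S ∷ [] ⇓ y → f · codeSO liar ∷ [] ⇓ y
  f-at-liar p = ⇓-comp (computes diagonalizeᶜ (codeSO liar ∷ []) ∷ []) (cong (_∷ []) (sym codeS) ▸ p)

  S-false : ¬ Holds [] [] S
  S-false s = S⇒ s (f-at-liar (proj₁ (decides S) s))

  S-true : Holds [] [] S
  S-true = S⇐ (λ p → case ⇓-deterministic p (f-at-liar (proj₂ (decides S) S-false)) of λ ())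

-- Formulas

private variable n : ℕ

-- Negation trace by trace: for a flat `φ` no trace of the team satisfies it. In contrast `∼`
-- negates a statement about the whole team, so `∼ neg φ` asserts that some trace satisfies `φ`.
neg : InqLTL n → InqLTL n
neg φ = φ ⇒ ⊥ᶠ

top never : InqLTL n
top   = ⊥ᶠ ⇒ ⊥ᶠ
never = ∼ top

-- A subteam satisfies `φ`. Since `never` fails even on the empty team, the empty subteam counts;
-- nonemptiness has to be demanded where it is wanted.
some : InqLTL n → InqLTL n
some φ = ∼ (φ ⇒ never)

F G : InqLTL n → InqLTL n
F φ = top U φ
G φ = never R φ

X^ : ℕ → InqLTL n → InqLTL n
X^ zero    φ = φ
X^ (suc i) φ = X (X^ i φ)

lit : Fin n → Bool → InqLTL n
lit x true  = atom x
lit x false = neg (atom x)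

-- Disjunction trace by trace, whereas `∨ᵇ` makes all traces of the team satisfy the same disjunct.
either : InqLTL n → InqLTL n → InqLTL n
either φ ψ = neg (neg φ ∧ neg ψ)

-- Here the uniformity of `∨ᵇ` is exploited: at each position all traces of the team agree on `x`.
-- This is how different traces are compared.
constG : Fin n → InqLTL n
constG x = G (lit x true ∨ᵇ lit x false)

-- At most once; that the position exists is a separate demand of `wellFormed`.
once : Fin n → InqLTL n
once x = G (atom x ⇒ X (G (neg (atom x))))

-- At each position, `some` passes to traces with `x` there, and the inner `G` may then use a
-- different one of them for each later position of `y`. Suffixes look only forward, so this reaches
-- the pairs in which `y` does not precede `x`; `pairs` uses it in both directions.
half : Fin n → Fin n → InqLTL n
half x y = G (some (atom x ∧ G (∼ neg (atom y))))

Formula : Set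
Formula = InqLTL 6

-- A trace stands for the pair (a , b), with a sign, in a numbered slot of one
-- of two sorts (true for numbers, false for relations): tag holds at the
-- number of the slot, where sort and sign are read, end holds at a position N
-- beyond all slots in use, and the marks hold at N + a and N + b.
pattern tag   = 0F
pattern sort  = 1F
pattern sign  = 2F
pattern end   = 3F
pattern mark₁  = 4F
pattern mark₂  = 5F

wellFormed : ℕ → Formula
wellFormed N = once tag ∧ (once end ∧ (once mark₁ ∧ (once mark₂ ∧
       (X^ N (atom end) ∧ (X^ N (neg (G (neg (atom mark₁)))) ∧ X^ N (neg (G (neg (atom mark₂)))))))))

-- `F` leads to the common position of `end`, from which the marks are counted.
pairs : Formula
pairs = F (atom end ∧ (half mark₁ mark₂ ∧ half mark₂ mark₁))

-- The until lets j range over the slots d ≤ j < N.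
fromSlot : ℕ → Formula → Formula
fromSlot d α = X^ d (some (α ∧ pairs) U atom end)

slot : Bool → Formula
slot κ = lit tag true ∧ lit sort κ

signed : Bool → Bool → Formula
signed κ s = slot κ ∧ lit sign s

slotAt : Bool → ℕ → Formula
slotAt κ j = X^ j (slot κ)

signedAt : Bool → Bool → ℕ → Formula
signedAt κ s j = X^ j (signed κ s)

-- Every pair stays in every slot, with both signs in the slots from d on.
keep : Bool → ℕ → Formula
keep κ d = fromSlot 0 (slot κ) ∧ (fromSlot d (signed κ true) ∧ fromSlot d (signed κ false))

keepBoth : ℕ → ℕ → Formula
keepBoth n m = (∼ ⊥ᶠ) ∧ (keep true n ∧ keep false m)

-- Two traces of slot j with the same marks have the same sign.
decided : Bool → ℕ → Formula
decided κ j = (slotAt κ j ∧ (constG mark₁ ∧ constG mark₂)) ⇒ (X^ j (lit sign true) ∨ᵇ X^ j (lit sign false))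

choose₁ choose₂ : ℕ → ℕ → Formula → Formula
choose₁ n m ψ = some (keepBoth (suc n) m ∧ (decided true n ∧ ψ))
choose₂ n m ψ = some (keepBoth n (suc m) ∧ (decided false m ∧ ψ))

-- The conjuncts make the relation nonempty, with a single first coordinate, and contained in the
-- diagonal.
isPoint : ℕ → Formula
isPoint n = (∼ neg (signedAt true true n)) ∧
           ((signedAt true true n ⇒ constG mark₁) ∧ (signedAt true true n ⇒ G (atom mark₁ ⇒ atom mark₂)))

-- Both signs need a condition: positive traces lie on the graph of the successor, negative ones off
-- it.
isNext : ℕ → Formula
isNext m = (signedAt false true m ⇒ G (atom mark₁ ⇒ X (atom mark₂))) ∧
         (signedAt false false m ⇒ G (atom mark₁ ⇒ X (neg (atom mark₂))))

-- A subteam has positive traces in all three slots, where those of `A` share the first mark with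
-- those of `x` and the second mark with those of `y`. Each comparison is `constG` on the team of
-- both kinds of traces, which `either` collects.
related : ℕ → ℕ → ℕ → Formula
related A x y = some ((∼ neg (signedAt false true A)) ∧ ((∼ neg (signedAt true true x)) ∧ ((∼ neg (signedAt true true y)) ∧
  ((either (signedAt false true A) (signedAt true true x) ⇒ constG mark₁) ∧
   (either (signedAt false true A) (signedAt true true y) ⇒ constG mark₂)))))

opaque
  rel : ℕ → ℕ → ℕ → Formula
  rel = related

  rel≡ : ∀ A x y → related A x y ≡ rel A x y
  rel≡ A x y = refl

-- Flat formulas

-- Satisfaction of a flat formula can be checked trace by trace, as in ordinary linear temporal
-- logic. Only the formulas that choose or compare traces have to be treated as statements about
-- teams.
record Flat {n} (φ : InqLTL n) (P : Pred (Trace n) 0ℓ) : Set₁ where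
  constructor mkFlat
  field
    flat   : ∀ L → L ⊨ φ ⇔ (∀ w → w ∈ ∣ L ∣ → P w)
    stable : P Respects _≗_

open Flat

suffix-cong : ∀ i {v w : Trace n} → v ≗ w → suffix i v ≗ suffix i w
suffix-cong i v≗w j = v≗w (i + j)

self-suffix : ∀ {L : Team n} i {w} → w ∈ ∣ L ∣ → suffix i w ∈ ∣ L ≥[ i ] ∣
self-suffix i w∈L = _ , w∈L , λ _ → refl

only : Trace n → Team n
only w = team (_≗ w) (λ v≗v′ v≗w j → trans (sym (v≗v′ j)) (v≗w j))

only⊆ : ∀ {w} (L : Team n) → w ∈ ∣ L ∣ → ∣ only w ∣ ⊆ ∣ L ∣
only⊆ L w∈L v≗w = Team.resp L (λ j → sym (v≗w j)) w∈L

≗-sym : ∀ {v w : Trace n} → v ≗ w → w ≗ v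
≗-sym v≗w j = sym (v≗w j)

filter : ∀ (L : Team n) (P : Pred (Trace n) 0ℓ) → P Respects _≗_ → Team n
filter L P st = team (λ w → w ∈ ∣ L ∣ × P w) (λ v≗w (v∈L , pv) → Team.resp L v≗w v∈L , st v≗w pv)

bit : Trace n → ℕ → Fin n → Bool
bit w i x = lookup (w i) x

bit-cong : ∀ {v w : Trace n} → v ≗ w → ∀ i x → bit v i x ≡ bit w i x
bit-cong v≗w i x = cong (λ S → lookup S x) (v≗w i)

flat-⊥ : Flat {n} ⊥ᶠ (λ _ → ⊥)
flat-⊥ = mkFlat (λ L → mk⇔ (λ h w w∈L → lower h w w∈L) (λ h → lift h)) (λ _ b → b)

-- Singleton subteams turn an implication over all subteams into one about each trace.
flat-⇒ : ∀ {φ ψ : InqLTL n} {P Q} → Flat φ P → Flat ψ Q → Flat (φ ⇒ ψ) (λ w → P w → Q w)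
flat-⇒ {φ = φ} {ψ} {P} f g = mkFlat
  (λ L → mk⇔
    (λ h w w∈L pw → to (flat g (only w)) (h (only w) (λ {v} → only⊆ L w∈L {v}) (from (flat f (only w)) (λ v v≗w → stable f (≗-sym v≗w) pw))) w (λ _ → refl))
    (λ h L′ L′⊆L l → from (flat g L′) (λ w w∈L′ → h w (L′⊆L w∈L′) (to (flat f L′) l w w∈L′))))
  (λ v≗w h pw → stable g v≗w (h (stable f (≗-sym v≗w) pw)))

flat-neg : ∀ {φ : InqLTL n} {P} → Flat φ P → Flat (neg φ) (λ w → ¬ P w)
flat-neg f = flat-⇒ f flat-⊥

flat-∧ : ∀ {φ ψ : InqLTL n} {P Q} → Flat φ P → Flat ψ Q → Flat (φ ∧ ψ) (λ w → P w × Q w)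
flat-∧ f g = mkFlat
  (λ L → mk⇔ (λ (h , h′) w w∈L → to (flat f L) h w w∈L , to (flat g L) h′ w w∈L)
             (λ h → from (flat f L) (λ w w∈L → proj₁ (h w w∈L)) , from (flat g L) (λ w w∈L → proj₂ (h w w∈L))))
  (λ v≗w (p , q) → stable f v≗w p , stable g v≗w q)

flat-≥ : ∀ {φ : InqLTL n} {P} → Flat φ P → ∀ L i → L ≥[ i ] ⊨ φ ⇔ (∀ w → w ∈ ∣ L ∣ → P (suffix i w))
flat-≥ f L i = mk⇔
  (λ h w w∈L → to (flat f (L ≥[ i ])) h _ (self-suffix {L = L} i w∈L))
  (λ h → from (flat f (L ≥[ i ])) (λ { v (w , w∈L , v≗w) → stable f (≗-sym v≗w) (h w w∈L) }))

flat-X : ∀ {φ : InqLTL n} {P} → Flat φ P → Flat (X φ) (P ∘ suffix 1)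
flat-X f = mkFlat (λ L → flat-≥ f L 1) (λ v≗w → stable f (suffix-cong 1 v≗w))

flat-X^ : ∀ {φ : InqLTL n} {P} j → Flat φ P → Flat (X^ j φ) (P ∘ suffix j)
flat-X^ zero    f = f
flat-X^ (suc j) f = flat-X (flat-X^ j f)

top-true : ∀ (L : Team n) → L ⊨ top
top-true L L′ L′⊆L h = h

G-correct : ∀ {φ : InqLTL n} L → L ⊨ G φ ⇔ (∀ i → L ≥[ i ] ⊨ φ)
G-correct L = mk⇔
  (λ h i → case h i of λ { (inj₁ x) → x ; (inj₂ (k , _ , ¬top)) → ⊥-elim (¬top (top-true (L ≥[ k ]))) })
  (λ h i → inj₁ (h i))

F-correct : ∀ {φ : InqLTL n} L → L ⊨ F φ ⇔ (∃[ i ] L ≥[ i ] ⊨ φ)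
F-correct L = mk⇔ (λ (i , h , _) → i , h) (λ (i , h) → i , h , λ k _ → top-true (L ≥[ k ]))

flat-G : ∀ {φ : InqLTL n} {P} → Flat φ P → Flat (G φ) (λ w → ∀ i → P (suffix i w))
flat-G {φ = φ} f = mkFlat
  (λ L → mk⇔ (λ h w w∈L i → to (flat-≥ f L i) (to (G-correct {φ = φ} L) h i) w w∈L)
             (λ h → from (G-correct {φ = φ} L) (λ i → from (flat-≥ f L i) (λ w w∈L → h w w∈L i))))
  (λ v≗w h i → stable f (suffix-cong i v≗w) (h i))

flat-resp : ∀ {φ : InqLTL n} {P Q : Pred (Trace n) 0ℓ} → (∀ w → P w ⇔ Q w) → Flat φ P → Flat φ Q
flat-resp P⇔Q f = mkFlat
  (λ L → mk⇔ (λ h w w∈L → to (P⇔Q w) (to (flat f L) h w w∈L))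
             (λ h → from (flat f L) (λ w w∈L → from (P⇔Q w) (h w w∈L))))
  (λ {v} {w} v≗w q → to (P⇔Q w) (stable f v≗w (from (P⇔Q v) q)))

flat-atom : ∀ (x : Fin n) → Flat (atom x) (λ w → bit w 0 x ≡ true)
flat-atom x = mkFlat
  (λ L → mk⇔ (λ h w w∈L → []=⇒lookup (lower h w w∈L)) (λ h → lift (λ w w∈L → lookup⇒[]= x (w 0) (h w w∈L))))
  (λ v≗w eq → trans (sym (bit-cong v≗w 0 x)) eq)

flat-lit : ∀ (x : Fin n) b → Flat (lit x b) (λ w → bit w 0 x ≡ b)
flat-lit x true  = flat-atom x
flat-lit x false = flat-resp (λ w → mk⇔ ¬-not (λ eq eq′ → not-¬ eq eq′)) (flat-neg (flat-atom x))

infix 4 _≅_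
_≅_ : Team n → Team n → Set
L ≅ L′ = ∣ L ∣ ⊆ ∣ L′ ∣ × ∣ L′ ∣ ⊆ ∣ L ∣

≅-sym : ∀ {L L′ : Team n} → L ≅ L′ → L′ ≅ L
≅-sym (a , b) = b , a

≥-mono : ∀ {L L′ : Team n} i → ∣ L ∣ ⊆ ∣ L′ ∣ → ∣ L ≥[ i ] ∣ ⊆ ∣ L′ ≥[ i ] ∣
≥-mono i L⊆L′ (w , w∈L , eq) = w , L⊆L′ w∈L , eq

≥-cong : ∀ {L L′ : Team n} i → L ≅ L′ → L ≥[ i ] ≅ L′ ≥[ i ]
≥-cong {L = L} {L′} i (a , b) = (λ {v} → ≥-mono {L = L} {L′} i a {v}) , (λ {v} → ≥-mono {L = L′} {L} i b {v})

⊨-cong : ∀ (φ : InqLTL n) {L L′} → L ≅ L′ → L ⊨ φ → L′ ⊨ φ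
⊨-cong ⊥ᶠ       (a , b) h = lift (λ w w∈ → lower h w (b w∈))
⊨-cong (atom p) (a , b) h = lift (λ w w∈ → lower h w (b w∈))
⊨-cong (φ ∨ᵇ ψ) eq (inj₁ h) = inj₁ (⊨-cong φ eq h)
⊨-cong (φ ∨ᵇ ψ) eq (inj₂ h) = inj₂ (⊨-cong ψ eq h)
⊨-cong (φ ∧ ψ)  eq (h , h′) = ⊨-cong φ eq h , ⊨-cong ψ eq h′
⊨-cong (φ ⇒ ψ)  (a , b) h = λ M M⊆L′ → h M (λ w∈ → b (M⊆L′ w∈))
⊨-cong (X φ) {L} {L′} eq h = ⊨-cong φ (≥-cong {L = L} {L′} 1 eq) h
⊨-cong (φ U ψ) {L} {L′} eq (i , h , h′) = i , ⊨-cong ψ (≥-cong {L = L} {L′} i eq) h , λ k k<i → ⊨-cong φ (≥-cong {L = L} {L′} k eq) (h′ k k<i)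
⊨-cong (φ R ψ) {L} {L′} eq h i with h i
... | inj₁ h₁ = inj₁ (⊨-cong ψ (≥-cong {L = L} {L′} i eq) h₁)
... | inj₂ (k , k<i , h₂) = inj₂ (k , k<i , ⊨-cong φ (≥-cong {L = L} {L′} k eq) h₂)
⊨-cong (∼ φ) {L} {L′} eq h h′ = h (⊨-cong φ (≅-sym {L = L} {L′} eq) h′)

≥-0 : ∀ (L : Team n) → L ≥[ 0 ] ≅ L
≥-0 L = (λ (w , w∈L , v≗w) → Team.resp L (≗-sym v≗w) w∈L) , (λ {w} w∈L → w , w∈L , λ _ → refl)

≥-≥ : ∀ (L : Team n) i j → (L ≥[ i ]) ≥[ j ] ≅ L ≥[ i + j ]
≥-≥ L i j = (λ { (u , (w , w∈L , u≗w) , v≗u) → w , w∈L , λ k → trans (v≗u k) (trans (u≗w (j + k)) (cong w (sym (+-assoc i j k)))) })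
          , (λ { (w , w∈L , v≗w) → suffix i w , self-suffix {L = L} i w∈L , λ k → trans (v≗w k) (cong w (+-assoc i j k)) })

unnest : ∀ (φ : InqLTL n) L i j → (L ≥[ i ]) ≥[ j ] ⊨ φ → L ≥[ i + j ] ⊨ φ
unnest φ L i j = ⊨-cong φ {(L ≥[ i ]) ≥[ j ]} {L ≥[ i + j ]} (≥-≥ L i j)

nest : ∀ (φ : InqLTL n) L i j → L ≥[ i + j ] ⊨ φ → (L ≥[ i ]) ≥[ j ] ⊨ φ
nest φ L i j = ⊨-cong φ {L ≥[ i + j ]} {(L ≥[ i ]) ≥[ j ]} (≅-sym {L = (L ≥[ i ]) ≥[ j ]} {L ≥[ i + j ]} (≥-≥ L i j))

X^-correct : ∀ (φ : InqLTL n) i L → L ⊨ X^ i φ ⇔ L ≥[ i ] ⊨ φ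
X^-correct φ zero    L = mk⇔ (⊨-cong φ {L} {L ≥[ 0 ]} (≅-sym {L = L ≥[ 0 ]} {L} (≥-0 L))) (⊨-cong φ {L ≥[ 0 ]} {L} (≥-0 L))
X^-correct φ (suc i) L = mk⇔
  (λ h → unnest φ L 1 i (to (X^-correct φ i (L ≥[ 1 ])) h))
  (λ h → from (X^-correct φ i (L ≥[ 1 ])) (nest φ L 1 i h))

Once : Fin n → Pred (Trace n) 0ℓ
Once x w = ∀ i j → bit w i x ≡ true → bit w j x ≡ true → i ≡ j

flat-once : ∀ (x : Fin n) → Flat (once x) (Once x)
flat-once x = flat-resp (λ w → mk⇔ (there w) (back w)) (flat-G (flat-⇒ (flat-atom x) (flat-X (flat-G (flat-neg (flat-atom x))))))
  where
  Later : Trace _ → Set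
  Later w = ∀ i → bit w (i + 0) x ≡ true → ∀ j → ¬ bit w (i + (1 + (j + 0))) x ≡ true
  apart : ∀ w → Later w → ∀ i j → i < j → bit w i x ≡ true → ¬ bit w j x ≡ true
  apart w h i j i<j hi hj with d , refl ← m≤n⇒∃[o]m+o≡n i<j =
    h i (subst (λ k → bit w k x ≡ true) (sym (+-identityʳ i)) hi) d
        (subst (λ k → bit w k x ≡ true) (trans (sym (+-suc i d)) (cong (λ d → i + suc d) (sym (+-identityʳ d)))) hj)
  there : ∀ w → Later w → Once x w
  there w h i j hi hj with <-cmp i j
  ... | tri< i<j _ _ = ⊥-elim (apart w h i j i<j hi hj)
  ... | tri≈ _ eq _  = eq
  ... | tri> _ _ j<i = ⊥-elim (apart w h j i j<i hj hi)
  back : ∀ w → Once x w → Later w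
  back w h i hi j hj = m≢1+m+n (i + 0) (trans (h _ _ hi hj) (lemma i j))
    where
    lemma : ∀ i j → i + (1 + (j + 0)) ≡ suc (i + 0 + (j + 0))
    lemma i j = trans (+-suc i (j + 0)) (cong (λ k → suc (k + (j + 0))) (sym (+-identityʳ i)))

-- Pools of traces

InSlot : Bool → ℕ → Trace 6 → Set
InSlot κ j w = bit w j tag ≡ true × bit w j sort ≡ κ

Signed : Bool → Bool → ℕ → Trace 6 → Set
Signed κ s j w = InSlot κ j w × bit w j sign ≡ s

Marks : ℕ → ℕ → ℕ → Trace 6 → Set
Marks N a b w = bit w (N + a) mark₁ ≡ true × bit w (N + b) mark₂ ≡ true

WellFormed : ℕ → Trace 6 → Set
WellFormed N w = Once tag w × (Once end w × (Once mark₁ w × (Once mark₂ w ×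
         (bit w N end ≡ true × ((∃[ a ] bit w (N + a) mark₁ ≡ true) × (∃[ b ] bit w (N + b) mark₂ ≡ true))))))

Signed-resp : ∀ {κ s j v w} → v ≗ w → Signed κ s j v → Signed κ s j w
Signed-resp {j = j} v≗w ((t , k) , s) =
  (trans (sym (bit-cong v≗w j tag)) t , trans (sym (bit-cong v≗w j sort)) k) , trans (sym (bit-cong v≗w j sign)) s

Marks-resp : ∀ {N a b v w} → v ≗ w → Marks N a b v → Marks N a b w
Marks-resp {N} {a} {b} v≗w (p , q) =
  trans (sym (bit-cong v≗w (N + a) mark₁)) p , trans (sym (bit-cong v≗w (N + b) mark₂)) q

flat-X^lit : ∀ j (x : Fin n) b → Flat (X^ j (lit x b)) (λ w → bit w j x ≡ b)
flat-X^lit j x b = flat-resp (λ w → shift w) (flat-X^ j (flat-lit x b))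
  where
  shift : ∀ w → (bit (suffix j w) 0 x ≡ b) ⇔ (bit w j x ≡ b)
  shift w rewrite +-identityʳ j = mk⇔ id id

flat-slot : ∀ κ → Flat (slot κ) (InSlot κ 0)
flat-slot κ = flat-∧ (flat-lit tag true) (flat-lit sort κ)

flat-signed : ∀ κ s → Flat (signed κ s) (Signed κ s 0)
flat-signed κ s = flat-∧ (flat-slot κ) (flat-lit sign s)

flat-slotAt : ∀ κ j → Flat (slotAt κ j) (InSlot κ j)
flat-slotAt κ j = flat-resp (λ w → shift w) (flat-X^ j (flat-slot κ))
  where
  shift : ∀ w → InSlot κ 0 (suffix j w) ⇔ InSlot κ j w
  shift w rewrite +-identityʳ j = mk⇔ id id

flat-signedAt : ∀ κ s j → Flat (signedAt κ s j) (Signed κ s j)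
flat-signedAt κ s j = flat-resp (λ w → shift w) (flat-X^ j (flat-signed κ s))
  where
  shift : ∀ w → Signed κ s 0 (suffix j w) ⇔ Signed κ s j w
  shift w rewrite +-identityʳ j = mk⇔ id id

constG-same : ∀ (x : Fin n) L → L ⊨ constG x → ∀ {v w} → v ∈ ∣ L ∣ → w ∈ ∣ L ∣ → ∀ i → bit v i x ≡ bit w i x
constG-same x L h {v} {w} v∈L w∈L i = subst (λ i → bit v i x ≡ bit w i x) (+-identityʳ i) (go (to (G-correct {φ = lit x true ∨ᵇ lit x false} L) h i))
  where
  agree : ∀ b → L ≥[ i ] ⊨ lit x b → bit v (i + 0) x ≡ bit w (i + 0) x
  agree b h = trans (to (flat-≥ (flat-lit x b) L i) h v v∈L) (sym (to (flat-≥ (flat-lit x b) L i) h w w∈L))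
  go : L ≥[ i ] ⊨ lit x true ∨ᵇ lit x false → bit v (i + 0) x ≡ bit w (i + 0) x
  go (inj₁ h) = agree true h
  go (inj₂ h) = agree false h

same-constG : ∀ (x : Fin n) L (f : ℕ → Bool) → (∀ w → w ∈ ∣ L ∣ → ∀ i → bit w i x ≡ f i) → L ⊨ constG x
same-constG x L f h = from (G-correct {φ = lit x true ∨ᵇ lit x false} L) go
  where
  all : ∀ i b → f (i + 0) ≡ b → L ≥[ i ] ⊨ lit x b
  all i b eq = from (flat-≥ (flat-lit x b) L i) (λ w w∈L → trans (h w w∈L (i + 0)) eq)
  go : ∀ i → L ≥[ i ] ⊨ lit x true ∨ᵇ lit x false
  go i with f (i + 0) in eq
  ... | true  = inj₁ (all i true eq)
  ... | false = inj₂ (all i false eq)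

-- Existence of subteams and of traces

module Classical (em : ExcludedMiddle (lsuc 0ℓ)) where

  em₀ : ExcludedMiddle 0ℓ
  em₀ {P} with em {Lift (lsuc 0ℓ) P}
  ... | yes p = yes (lower p)
  ... | no ¬p = no (λ p → ¬p (lift p))

  by-contradiction₀ : {P : Set} → ¬ ¬ P → P
  by-contradiction₀ = decidable-stable em₀

  by-contradiction : {P : Set₁} → ¬ ¬ P → P
  by-contradiction = decidable-stable em

  some-correct : ∀ {φ : InqLTL n} L → L ⊨ some φ ⇔ (Σ (Team n) λ L′ → ∣ L′ ∣ ⊆ ∣ L ∣ × L′ ⊨ φ)
  some-correct L = mk⇔
    (λ h → by-contradiction (λ none → h (λ L′ L′⊆L h′ _ → none (L′ , (λ {w} → L′⊆L {w}) , h′))))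
    (λ (L′ , L′⊆L , h′) none → none L′ L′⊆L h′ (top-true L′))

  somewhere : ∀ {φ : InqLTL n} {P} → Flat φ P → ∀ L → L ⊨ ∼ neg φ ⇔ (∃[ w ] w ∈ ∣ L ∣ × P w)
  somewhere f L = mk⇔
    (λ h → by-contradiction₀ (λ none → h (from (flat (flat-neg f) L) (λ w w∈L p → none (w , w∈L , p)))))
    (λ (w , w∈L , p) h → to (flat (flat-neg f) L) h w w∈L p)

  flat-either : ∀ {φ ψ : InqLTL n} {P Q} → Flat φ P → Flat ψ Q → Flat (either φ ψ) (λ w → P w ⊎ Q w)
  flat-either {P = P} {Q} f g = flat-resp
    (λ w → mk⇔ (λ h → by-contradiction₀ (λ ¬pq → h ((λ p → ¬pq (inj₁ p)) , (λ q → ¬pq (inj₂ q)))))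
               (λ { (inj₁ p) (¬p , _) → ¬p p ; (inj₂ q) (_ , ¬q) → ¬q q }))
    (flat-neg (flat-∧ (flat-neg f) (flat-neg g)))

  flat-eventually : ∀ N (x : Fin n) → Flat (X^ N (neg (G (neg (atom x))))) (λ w → ∃[ a ] bit w (N + a) x ≡ true)
  flat-eventually N x = flat-resp
    (λ w → mk⇔ (λ h → by-contradiction₀ (λ none → h (λ a eq → none (a + 0 , eq))))
               (λ (a , eq) none → none a (subst (λ a → bit w (N + a) x ≡ true) (sym (+-identityʳ a)) eq)))
    (flat-X^ N (flat-neg (flat-G (flat-neg (flat-atom x)))))

  flat-wellFormed : ∀ N → Flat (wellFormed N) (WellFormed N)
  flat-wellFormed N = flat-∧ (flat-once tag) (flat-∧ (flat-once end) (flat-∧ (flat-once mark₁) (flat-∧ (flat-once mark₂)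
    (flat-∧ (flat-X^lit N end true) (flat-∧ (flat-eventually N mark₁) (flat-eventually N mark₂))))))

  Half : Fin n → Fin n → Team n → Set
  Half x y L = ∀ a d → ∃[ w ] w ∈ ∣ L ∣ × bit w a x ≡ true × bit w (a + d) y ≡ true

  half-correct : ∀ (x y : Fin n) L → L ⊨ half x y ⇔ Half x y L
  half-correct {n} x y L = mk⇔ there back
    where
    body = atom x ∧ G (∼ neg (atom y))
    there : L ⊨ half x y → Half x y L
    there h a d
      with L′ , L′⊆ , hx , hy ← to (some-correct {φ = body} (L ≥[ a ])) (to (G-correct {φ = some body} L) h a)
      with v , (u , u∈L′ , v≗u) , yv ← to (somewhere (flat-atom y) (L′ ≥[ d ])) (to (G-correct {φ = ∼ neg (atom y)} L′) hy d)
      with w , w∈L , u≗w ← L′⊆ {u} u∈L′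
      = w , w∈L
      , subst (λ a → bit w a x ≡ true) (+-identityʳ a) (trans (sym (bit-cong u≗w 0 x)) (to (flat (flat-atom x) L′) hx u u∈L′))
      , subst (λ d → bit w (a + d) y ≡ true) (+-identityʳ d) (trans (sym (bit-cong u≗w (d + 0) y)) (trans (sym (bit-cong v≗u 0 y)) yv))
    back : Half x y L → L ⊨ half x y
    back h = from (G-correct {φ = some body} L) (λ a → from (some-correct {φ = body} (L ≥[ a ]))
      (sub a , proj₁ , from (flat (flat-atom x) (sub a)) (λ w → proj₂) ,
       from (G-correct {φ = ∼ neg (atom y)} (sub a)) (λ d → from (somewhere (flat-atom y) (sub a ≥[ d ])) (witness a d))))
      where
      -- The largest subteam with `x` at the current position serves, as the rest only asks for the
      -- presence of traces.
      sub : ℕ → Team n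
      sub a = filter (L ≥[ a ]) (λ w → bit w 0 x ≡ true) (stable (flat-atom x))
      witness : ∀ a d → ∃[ w ] w ∈ ∣ sub a ≥[ d ] ∣ × bit w 0 y ≡ true
      witness a d with w , w∈L , xw , yw ← h a d =
        suffix d (suffix a w)
        , self-suffix {L = sub a} d {suffix a w} (self-suffix {L = L} a w∈L , subst (λ a → bit w a x ≡ true) (sym (+-identityʳ a)) xw)
        , subst (λ d → bit w (a + d) y ≡ true) (sym (+-identityʳ d)) yw

  AllPairs : ℕ → Team 6 → Set
  AllPairs r L = ∀ a b → ∃[ w ] w ∈ ∣ L ∣ × Marks r a b w

  -- Each half yields the pairs with one order of the marks, and `≤` is total.
  pairs-correct : ∀ r L → (∀ w → w ∈ ∣ L ∣ → Once end w × bit w r end ≡ true) → L ⊨ pairs ⇔ AllPairs r L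
  pairs-correct r L ends = mk⇔ there back
    where
    body = atom end ∧ (half mark₁ mark₂ ∧ half mark₂ mark₁)
    -- The half supplies a trace of the team; on the empty team `end` would hold vacuously at every
    -- position.
    start : ∀ i → L ≥[ i ] ⊨ atom end → Half mark₁ mark₂ (L ≥[ i ]) → i ≡ r
    start i he h = let v , (w , w∈L , _) , _ = h 0 0 in
      trans (sym (+-identityʳ i)) (proj₁ (ends w w∈L) (i + 0) r (to (flat-≥ (flat-atom end) L i) he w w∈L) (proj₂ (ends w w∈L)))
    ordered : ∀ i → Half mark₁ mark₂ (L ≥[ i ]) → Half mark₂ mark₁ (L ≥[ i ]) → ∀ a b → a ≤ b ⊎ b ≤ a →
              ∃[ w ] w ∈ ∣ L ∣ × Marks i a b w
    ordered i h₁ h₂ a b (inj₁ a≤b) with d , refl ← m≤n⇒∃[o]m+o≡n a≤b =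
      let v , (w , w∈L , v≗w) , p , q = h₁ a d in
      w , w∈L , trans (sym (bit-cong v≗w a mark₁)) p , trans (sym (bit-cong v≗w (a + d) mark₂)) q
    ordered i h₁ h₂ a b (inj₂ b≤a) with d , refl ← m≤n⇒∃[o]m+o≡n b≤a =
      let v , (w , w∈L , v≗w) , q , p = h₂ b d in
      w , w∈L , trans (sym (bit-cong v≗w (b + d) mark₁)) p , trans (sym (bit-cong v≗w b mark₂)) q
    there : L ⊨ pairs → AllPairs r L
    there h =
      let i , he , h₁ , h₂ = to (F-correct {φ = body} L) h
          h₁′ = to (half-correct mark₁ mark₂ (L ≥[ i ])) h₁
          h₂′ = to (half-correct mark₂ mark₁ (L ≥[ i ])) h₂
      in subst (λ i → AllPairs i L) (start i he h₁′) (λ a b → ordered i h₁′ h₂′ a b (≤-total a b))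
    back : AllPairs r L → L ⊨ pairs
    back h = from (F-correct {φ = body} L) (r ,
      from (flat-≥ (flat-atom end) L r) (λ w w∈L → subst (λ r → bit w r end ≡ true) (sym (+-identityʳ r)) (proj₂ (ends w w∈L))) ,
      from (half-correct mark₁ mark₂ (L ≥[ r ])) (λ a d → let w , w∈L , p , q = h a (a + d) in suffix r w , self-suffix {L = L} r w∈L , p , q) ,
      from (half-correct mark₂ mark₁ (L ≥[ r ])) (λ b d → let w , w∈L , p , q = h (b + d) b in suffix r w , self-suffix {L = L} r w∈L , q , p))

  module Pools (N : ℕ) where

    Base : Team 6 → Set
    Base L = (∀ w → w ∈ ∣ L ∣ → WellFormed N w) × Satisfiable ∣ L ∣

    From : (ℕ → Trace 6 → Set) → ℕ → Team 6 → Set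
    From Q d L = ∀ j → d ≤ j → j < N → ∀ a b → ∃[ w ] w ∈ ∣ L ∣ × Q j w × Marks N a b w

    fromSlot-correct : ∀ {α P} → Flat α P → ∀ {d L} → Base L → d ≤ N →
                   L ⊨ fromSlot d α ⇔ From (λ j w → P (suffix j w)) d L
    fromSlot-correct {α} {P} f {d} {L} (wfL , w₀ , w₀∈L) d≤N = mk⇔ there back
      where
      body = α ∧ pairs
      ends : ∀ j r → j + r ≡ N → ∀ v → v ∈ ∣ L ≥[ j ] ∣ → Once end v × bit v r end ≡ true
      ends j r eq v (w , w∈L , v≗w) = let _ , e-once , _ , _ , e-at , _ = wfL w w∈L in
        stable (flat-once end) (≗-sym v≗w) (λ i k hi hk → +-cancelˡ-≡ j i k (e-once (j + i) (j + k) hi hk)) ,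
        trans (bit-cong v≗w r end) (subst (λ N → bit w N end ≡ true) (sym eq) e-at)

      end-at : ∀ w → w ∈ ∣ L ∣ → bit w N end ≡ true
      end-at w w∈L = proj₁ (proj₂ (proj₂ (proj₂ (proj₂ (wfL w w∈L)))))

      -- The until can stop only at position `N`, since `end` occurs nowhere else in the trace `w₀`.
      limit : ∀ i → (L ≥[ d ]) ≥[ i ] ⊨ atom end → d + i ≡ N
      limit i he = proj₁ (proj₂ (wfL w₀ w₀∈L)) (d + i) N
        (subst (λ k → bit w₀ k end ≡ true) (+-identityʳ (d + i)) (to (flat-≥ (flat-atom end) L (d + i)) (unnest (atom end) L d i he) w₀ w₀∈L))
        (end-at w₀ w₀∈L)

      collect : ∀ j r → j + r ≡ N → L ≥[ j ] ⊨ some body → ∀ a b → ∃[ w ] w ∈ ∣ L ∣ × P (suffix j w) × Marks N a b w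
      collect j r eq h a b =
        let L′ , L′⊆ , hα , hp = to (some-correct {φ = body} (L ≥[ j ])) h
            v , v∈L′ , p , q = to (pairs-correct r L′ (λ v v∈ → ends j r eq v (L′⊆ {v} v∈))) hp a b
            w , w∈L , v≗w = L′⊆ {v} v∈L′
        in w , w∈L , stable f v≗w (to (flat f L′) hα v v∈L′)
           , at w mark₁ a (trans (sym (bit-cong v≗w (r + a) mark₁)) p) , at w mark₂ b (trans (sym (bit-cong v≗w (r + b) mark₂)) q)
        where
        at : ∀ w x a → bit w (j + (r + a)) x ≡ true → bit w (N + a) x ≡ true
        at w x a = subst (λ m → bit w m x ≡ true) (trans (sym (+-assoc j r a)) (cong (_+ a) eq))

      provide : From (λ j w → P (suffix j w)) d L → ∀ j r → j + r ≡ N → d ≤ j → j < N → L ≥[ j ] ⊨ some body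
      provide h j r eq d≤j j<N = from (some-correct {φ = body} (L ≥[ j ]))
        (sub , proj₁ , from (flat f sub) (λ w → proj₂) ,
         from (pairs-correct r sub (λ v (v∈ , _) → ends j r eq v v∈))
           (λ a b → let w , w∈L , Pw , p , q = h j d≤j j<N a b in
             suffix j w , (self-suffix {L = L} j w∈L , Pw) , at w mark₁ a p , at w mark₂ b q))
        where
        sub : Team 6
        sub = filter (L ≥[ j ]) P (stable f)
        at : ∀ w x a → bit w (N + a) x ≡ true → bit w (j + (r + a)) x ≡ true
        at w x a = subst (λ m → bit w m x ≡ true) (trans (cong (_+ a) (sym eq)) (+-assoc j r a))

      there : L ⊨ fromSlot d α → From (λ j w → P (suffix j w)) d L
      there h j d≤j j<N a b =
        let i , he , hk = to (X^-correct (some body U atom end) d L) h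
            k , d+k≡j = m≤n⇒∃[o]m+o≡n d≤j
            k<i = +-cancelˡ-< d k i (subst₂ _<_ (sym d+k≡j) (sym (limit i he)) j<N)
        in collect j (N ∸ j) (m+[n∸m]≡n (<⇒≤ j<N)) (subst (λ j → L ≥[ j ] ⊨ some body) d+k≡j (unnest (some body) L d k (hk k k<i))) a b

      back : From (λ j w → P (suffix j w)) d L → L ⊨ fromSlot d α
      back h =
        let i = N ∸ d
            eq = m+[n∸m]≡n d≤N
        in from (X^-correct (some body U atom end) d L)
        (i , nest (atom end) L d i (from (flat-≥ (flat-atom end) L (d + i))
               (λ w w∈L → subst (λ m → bit w m end ≡ true) (sym (trans (+-identityʳ (d + i)) eq)) (end-at w w∈L))) ,
         λ k k<i → let j<N = subst (d + k <_) eq (+-monoʳ-< d k<i) in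
           nest (some body) L d k (provide h (d + k) (N ∸ (d + k)) (m+[n∸m]≡n (<⇒≤ j<N)) (m≤m+n d k) j<N))

Rel : Set₁
Rel = ℕ → ℕ → Set

-- Variables are kept in slots numbered from the outermost binder.
lev : Fin n → ℕ
lev {suc n} zero    = n
lev {suc n} (suc x) = lev x

lev< : (x : Fin n) → lev x < n
lev< {suc n} zero    = ≤-refl
lev< {suc n} (suc x) = m≤n⇒m≤1+n (lev< x)

once-same : ∀ {x : Fin n} {v w m} → Once x v → Once x w → bit v m x ≡ true → bit w m x ≡ true → ∀ i → bit v i x ≡ bit w i x
once-same {x = x} {v} {w} {m} ov ow vm wm i with bit v i x in vi | bit w i x in wi
... | true  | true  = refl
... | false | false = refl
... | true  | false with refl ← ov i m vi vm with () ← trans (sym wm) wi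
... | false | true  with refl ← ow i m wi wm with () ← trans (sym vm) vi

-- Assigning a relation to a slot by passing to a subteam

module Selection (em : ExcludedMiddle (lsuc 0ℓ)) (N : ℕ) where

  open Classical em
  open Pools N

  module _ {w : Trace 6} (wellFormed : WellFormed N w) where
    tag-once : Once tag w
    tag-once = proj₁ wellFormed
    fst-once : Once mark₁ w
    fst-once = proj₁ (proj₂ (proj₂ wellFormed))
    snd-once : Once mark₂ w
    snd-once = proj₁ (proj₂ (proj₂ (proj₂ wellFormed)))
    marks : ∃[ a ] ∃[ b ] Marks N a b w
    marks = let _ , _ , _ , _ , _ , (a , p) , (b , q) = wellFormed in a , b , p , q

    marks-unique : ∀ {a b a′ b′} → Marks N a b w → Marks N a′ b′ w → a ≡ a′ × b ≡ b′
    marks-unique (p , q) (p′ , q′) = +-cancelˡ-≡ N _ _ (fst-once _ _ p p′) , +-cancelˡ-≡ N _ _ (snd-once _ _ q q′)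

  fst-same : ∀ {v w} → WellFormed N v → WellFormed N w → ∀ {a b b′} → Marks N a b v → Marks N a b′ w → ∀ i → bit v i mark₁ ≡ bit w i mark₁
  fst-same {v} {w} wv ww (p , _) (p′ , _) = once-same {x = mark₁} {v} {w} (fst-once {v} wv) (fst-once {w} ww) p p′

  snd-same : ∀ {v w} → WellFormed N v → WellFormed N w → ∀ {a a′ b} → Marks N a b v → Marks N a′ b w → ∀ i → bit v i mark₂ ≡ bit w i mark₂
  snd-same {v} {w} wv ww (_ , q) (_ , q′) = once-same {x = mark₂} {v} {w} (snd-once {v} wv) (snd-once {w} ww) q q′

  Keeps : Bool → ℕ → Team 6 → Set
  Keeps κ d L = From (InSlot κ) 0 L × (From (Signed κ true) d L × From (Signed κ false) d L)

  -- Together with `Keeps`, which supplies a trace for each pair, this makes the signs in a slot the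
  -- characteristic function of its relation. It only restricts traces, so all subteams inherit it.
  Fixed : Bool → ∀ {d} → Vec Rel d → Team 6 → Set
  Fixed κ {d} Rs L = ∀ (x : Fin d) w → w ∈ ∣ L ∣ → ∀ s a b → Signed κ s (lev x) w → Marks N a b w → Reflects (lookup Rs x a b) s

  record Good {n m} (Rs₁ : Vec Rel n) (Rs₂ : Vec Rel m) (L : Team 6) : Set where
    constructor good
    field
      base   : Base L
      keeps₁ : Keeps true n L
      keeps₂ : Keeps false m L
      fixed₁ : Fixed true Rs₁ L
      fixed₂ : Fixed false Rs₂ L

  fixed-⊆ : ∀ {κ d L L′} (Rs : Vec Rel d) → Fixed κ Rs L → ∣ L′ ∣ ⊆ ∣ L ∣ → Fixed κ Rs L′
  fixed-⊆ Rs f L′⊆L x w w∈ = f x w (L′⊆L w∈)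

  from-map : ∀ {P Q : ℕ → Trace 6 → Set} {d L} → (∀ j w → P j w → Q j w) → From P d L → From Q d L
  from-map f h j d≤j j<N a b = let w , w∈L , p , m = h j d≤j j<N a b in w , w∈L , f j w p , m

  inSlot-shift : ∀ κ j w → InSlot κ 0 (suffix j w) ⇔ InSlot κ j w
  inSlot-shift κ j w rewrite +-identityʳ j = mk⇔ id id

  signed-shift : ∀ κ s j w → Signed κ s 0 (suffix j w) ⇔ Signed κ s j w
  signed-shift κ s j w rewrite +-identityʳ j = mk⇔ id id

  keep-correct : ∀ κ {d L} → Base L → d ≤ N → L ⊨ keep κ d ⇔ Keeps κ d L
  keep-correct κ {d} {L} base d≤N = mk⇔
    (λ (h , h′ , h″) → from-map {d = 0} {L} (λ j w → to (inSlot-shift κ j w)) (to (fromSlot-correct (flat-slot κ) {0} {L} base z≤n) h)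
                     , from-map {d = d} {L} (λ j w → to (signed-shift κ true j w)) (to (fromSlot-correct (flat-signed κ true) base d≤N) h′)
                     , from-map {d = d} {L} (λ j w → to (signed-shift κ false j w)) (to (fromSlot-correct (flat-signed κ false) base d≤N) h″))
    (λ (h , h′ , h″) → from (fromSlot-correct (flat-slot κ) {0} {L} base z≤n) (from-map {d = 0} {L} (λ j w → from (inSlot-shift κ j w)) h)
                     , from (fromSlot-correct (flat-signed κ true) base d≤N) (from-map {d = d} {L} (λ j w → from (signed-shift κ true j w)) h′)
                     , from (fromSlot-correct (flat-signed κ false) base d≤N) (from-map {d = d} {L} (λ j w → from (signed-shift κ false j w)) h″))

  keepBoth-correct : ∀ {n m L} → (∀ w → w ∈ ∣ L ∣ → WellFormed N w) → n ≤ N → m ≤ N →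
                     L ⊨ keepBoth n m ⇔ (Base L × Keeps true n L × Keeps false m L)
  keepBoth-correct {n} {m} {L} wfL n≤N m≤N = mk⇔
    (λ (h , h₁ , h₂) → let base = wfL , by-contradiction₀ (λ none → h (lift (λ w w∈ → none (w , w∈)))) in
                       base , to (keep-correct true base n≤N) h₁ , to (keep-correct false base m≤N) h₂)
    (λ (base , k₁ , k₂) → (λ h → lower h _ (proj₂ (proj₂ base))) ,
                          from (keep-correct true base n≤N) k₁ , from (keep-correct false base m≤N) k₂)

  Agrees : Bool → ℕ → Rel → Trace 6 → Set
  Agrees κ d S w = ∀ s a b → Signed κ s d w → Marks N a b w → Reflects (S a b) s

  -- Removes exactly the traces of slot `d` whose sign contradicts `S`; all other slots stay as they
  -- are.
  select : Bool → ℕ → Rel → Team 6 → Team 6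
  select κ d S L = filter L (Agrees κ d S)
    (λ v≗w h s a b sg mk → h s a b (Signed-resp {κ} {s} {d} (≗-sym v≗w) sg) (Marks-resp {N} {a} {b} (≗-sym v≗w) mk))

  module _ {κ : Bool} {d : ℕ} {S : Rel} {L : Team 6} (base : Base L) where

    other-slot : ∀ {κ′ j w} → w ∈ ∣ L ∣ → InSlot κ′ j w → ¬ (κ′ ≡ κ × j ≡ d) → Agrees κ d S w
    other-slot {κ′} {j} {w} w∈L (t , k) apart s a b ((t′ , k′) , _) _
      with refl ← tag-once {w} (proj₁ base w w∈L) j d t t′ = ⊥-elim (apart (trans (sym k) k′ , refl))

    select-from-other : ∀ {Q : ℕ → Trace 6 → Set} {κ′ e} → (∀ j w → Q j w → InSlot κ′ j w) →
                        (∀ j → e ≤ j → ¬ (κ′ ≡ κ × j ≡ d)) → From Q e L → From Q e (select κ d S L)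
    select-from-other inSlot apart h j e≤j j<N a b =
      let w , w∈L , q , mk = h j e≤j j<N a b in
      w , (w∈L , other-slot {w = w} w∈L (inSlot j w q) (apart j e≤j)) , q , mk

    select-keeps-other : ∀ {κ′ e} → κ′ ≢ κ → Keeps κ′ e L → Keeps κ′ e (select κ d S L)
    select-keeps-other {e = e} κ′≢κ (h , h′ , h″) =
      select-from-other {e = 0} (λ _ _ q → q) (λ _ _ (eq , _) → κ′≢κ eq) h ,
      select-from-other {e = e} (λ _ _ → proj₁) (λ _ _ (eq , _) → κ′≢κ eq) h′ ,
      select-from-other {e = e} (λ _ _ → proj₁) (λ _ _ (eq , _) → κ′≢κ eq) h″

    -- Slot `d` had each pair with both signs. Of the two traces the one with the right sign
    -- survives, and excluded middle on `S a b` tells which one that is.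
    select-keeps : d < N → Keeps κ d L → Keeps κ (suc d) (select κ d S L)
    select-keeps d<N (h , h′ , h″) = covered
      , select-from-other {e = suc d} (λ _ _ → proj₁) (λ { _ lt (_ , refl) → <-irrefl refl lt }) (λ j d<j → h′ j (<⇒≤ d<j))
      , select-from-other {e = suc d} (λ _ _ → proj₁) (λ { _ lt (_ , refl) → <-irrefl refl lt }) (λ j d<j → h″ j (<⇒≤ d<j))
      where
      Covered : ℕ → ℕ → ℕ → Set
      Covered j a b = ∃[ w ] w ∈ ∣ select κ d S L ∣ × InSlot κ j w × Marks N a b w
      with-sign : ∀ s a b → Reflects (S a b) s → (∃[ w ] w ∈ ∣ L ∣ × Signed κ s d w × Marks N a b w) → Covered d a b
      with-sign s a b r (w , w∈L , (t , sg) , mk) = w , (w∈L , agrees) , t , mk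
        where
        agrees : Agrees κ d S w
        agrees s′ a′ b′ (_ , sg′) mk′ with refl ← trans (sym sg) sg′ with refl , refl ← marks-unique {w} (proj₁ base w w∈L) mk mk′ = r
      covered : From (InSlot κ) 0 (select κ d S L)
      covered j _ j<N a b with j ≟ d
      ... | no j≢d = let w , w∈L , q , mk = h j z≤n j<N a b in w , (w∈L , other-slot {w = w} w∈L q (λ (_ , eq) → j≢d eq)) , q , mk
      ... | yes refl with em₀ {S a b}
      ...   | yes r = with-sign true a b (ofʸ r) (h′ j ≤-refl j<N a b)
      ...   | no ¬r = with-sign false a b (ofⁿ ¬r) (h″ j ≤-refl j<N a b)

    select-fixed : ∀ {Rs : Vec Rel d} → Fixed κ Rs L → Fixed κ (S ∷ Rs) (select κ d S L)
    select-fixed f zero    w (w∈L , ag) s a b = ag s a b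
    select-fixed f (suc x) w (w∈L , ag) = f x w w∈L

    select-decided : select κ d S L ⊨ decided κ d
    select-decided L′ L′⊆ (h , h₁ , h₂) with em₀ {Satisfiable ∣ L′ ∣}
    ... | no none = inj₁ (from (flat (flat-X^lit d sign true) L′) (λ w w∈ → ⊥-elim (none (w , w∈))))
    ... | yes (v , v∈) = go (bit v d sign) refl
      where
      wf-of : ∀ w → w ∈ ∣ L′ ∣ → WellFormed N w
      wf-of w w∈ = proj₁ base w (proj₁ (L′⊆ w∈))
      same : ∀ w → w ∈ ∣ L′ ∣ → bit w d sign ≡ bit v d sign
      same w w∈ with a , b , p , q ← marks {v} (wf-of v v∈) =
        agree (proj₂ (L′⊆ v∈) _ a b (to (flat (flat-slotAt κ d) L′) h v v∈ , refl) (p , q))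
              (proj₂ (L′⊆ w∈) _ a b (to (flat (flat-slotAt κ d) L′) h w w∈ , refl)
                (trans (constG-same mark₁ L′ h₁ w∈ v∈ (N + a)) p , trans (constG-same mark₂ L′ h₂ w∈ v∈ (N + b)) q))
        where
        agree : ∀ {A : Set} {s s′} → Reflects A s → Reflects A s′ → s′ ≡ s
        agree (ofʸ a) (ofʸ _) = refl
        agree (ofʸ a) (ofⁿ ¬a) = ⊥-elim (¬a a)
        agree (ofⁿ ¬a) (ofʸ a) = ⊥-elim (¬a a)
        agree (ofⁿ _) (ofⁿ _) = refl
      go : ∀ s → bit v d sign ≡ s → L′ ⊨ X^ d (lit sign true) ∨ᵇ X^ d (lit sign false)
      go true  eq = inj₁ (from (flat (flat-X^lit d sign true) L′) (λ w w∈ → trans (same w w∈) eq))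
      go false eq = inj₂ (from (flat (flat-X^lit d sign false) L′) (λ w w∈ → trans (same w w∈) eq))

  -- The implication is applied to the subteam of just these two traces, on which both marks are
  -- constant because each occurs only once in a trace.
  decided-same : ∀ {κ d L} → (∀ w → w ∈ ∣ L ∣ → WellFormed N w) → L ⊨ decided κ d → ∀ {v w} → v ∈ ∣ L ∣ → w ∈ ∣ L ∣ →
             InSlot κ d v → InSlot κ d w → ∀ {a b} → Marks N a b v → Marks N a b w → bit v d sign ≡ bit w d sign
  decided-same {κ} {d} {L} wfL h {v} {w} v∈ w∈ iv iw mv mw = go (h both sub
      ( from (flat (flat-slotAt κ d) both) (λ { u (inj₁ e) → stable (flat-slotAt κ d) (≗-sym e) iv
                                              ; u (inj₂ e) → stable (flat-slotAt κ d) (≗-sym e) iw })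
      , same-constG mark₁ both (λ i → bit v i mark₁)
          (λ { u (inj₁ e) i → bit-cong e i mark₁
             ; u (inj₂ e) i → trans (bit-cong e i mark₁) (fst-same {w} {v} (wfL w w∈) (wfL v v∈) mw mv i) })
      , same-constG mark₂ both (λ i → bit v i mark₂)
          (λ { u (inj₁ e) i → bit-cong e i mark₂
             ; u (inj₂ e) i → trans (bit-cong e i mark₂) (snd-same {w} {v} (wfL w w∈) (wfL v v∈) mw mv i) })))
    where
    both : Team 6
    both = team (λ u → u ≗ v ⊎ u ≗ w)
      (λ { u≗u′ (inj₁ e) → inj₁ (λ i → trans (sym (u≗u′ i)) (e i)) ; u≗u′ (inj₂ e) → inj₂ (λ i → trans (sym (u≗u′ i)) (e i)) })
    sub : ∣ both ∣ ⊆ ∣ L ∣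
    sub (inj₁ e) = only⊆ L v∈ e
    sub (inj₂ e) = only⊆ L w∈ e
    signs : ∀ s → both ⊨ X^ d (lit sign s) → bit v d sign ≡ bit w d sign
    signs s h = trans (to (flat (flat-X^lit d sign s) both) h v (inj₁ (λ _ → refl)))
                      (sym (to (flat (flat-X^lit d sign s) both) h w (inj₂ (λ _ → refl))))
    go : both ⊨ X^ d (lit sign true) ∨ᵇ X^ d (lit sign false) → bit v d sign ≡ bit w d sign
    go (inj₁ h) = signs true h
    go (inj₂ h) = signs false h

  Read : Bool → ℕ → Team 6 → Rel
  Read κ d L a b = ∃[ w ] w ∈ ∣ L ∣ × Signed κ true d w × Marks N a b w

  -- Conversely to `select`, a decided slot determines a relation, namely the pairs with a positive
  -- trace: no negative trace can share its marks with a positive one.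
  read-correct : ∀ {κ d L} → (∀ w → w ∈ ∣ L ∣ → WellFormed N w) → L ⊨ decided κ d → ∀ w → w ∈ ∣ L ∣ → Agrees κ d (Read κ d L) w
  read-correct wfL h w w∈ true  a b sg mk = ofʸ (w , w∈ , sg , mk)
  read-correct {κ} {d} {L} wfL h w w∈ false a b (iw , sg) mk = ofⁿ (λ { (v , v∈ , (iv , sg′) , mk′) →
    case trans (sym sg′) (trans (decided-same {κ} {d} {L} wfL h v∈ w∈ iv iw {a} {b} mk′ mk) sg) of λ () })

-- Quantifiers

-- Opaque, so that the formulas built from them stay small.
opaque
  ex₁ ex₂ : ℕ → ℕ → Formula → Formula
  ex₁ n m ψ = choose₁ n (suc m) (isPoint n ∧ ψ)
  ex₂ n m ψ = choose₂ n (suc m) ψ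

  ex₁≡ : ∀ n m ψ → choose₁ n (suc m) (isPoint n ∧ ψ) ≡ ex₁ n m ψ
  ex₁≡ n m ψ = refl

  ex₂≡ : ∀ n m ψ → choose₂ n (suc m) ψ ≡ ex₂ n m ψ
  ex₂≡ n m ψ = refl

-- The outer `some` discards the traces that are not well formed, so nothing is assumed of the given
-- team. That its slots contain the pairs is demanded by `keepBoth` inside the formula, and so truth
-- of the sentence follows from any satisfying team.
sentence : ℕ → Formula → Formula
sentence N ψ = some (wellFormed N ∧ (keepBoth 0 0 ∧ choose₂ 0 0 (isNext 0 ∧ ψ)))

Point : ℕ → Rel
Point c a b = a ≡ c × b ≡ c

Next : Rel
Next a b = suc a ≡ b

reflects-true : ∀ {A : Set} {s} → Reflects A s → A → s ≡ true
reflects-true (ofʸ _)  a = refl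
reflects-true (ofⁿ ¬a) a = ⊥-elim (¬a a)

reflects-refl : ∀ {A : Set} {s} → Reflects A s → s ≡ true → A
reflects-refl (ofʸ a) refl = a

-- Formulas that represent predicates of numbers and relations

module Representation (em : ExcludedMiddle (lsuc 0ℓ)) (N : ℕ) where

  open Classical em
  open Pools N
  open Selection em N

  -- ψ expresses P, provided that n + h and suc m + h slots are available
  -- for the two sorts; the slot 0 for sets holds the successor relation.
  record Rep (n m h : ℕ) (ψ : Formula) (P : Vec ℕ n → Vec Rel m → Set₁) : Set₁ where
    field
      rep : n + h ≤ N → suc m + h ≤ N → ∀ L ρ Ss → Good (map Point ρ) (Ss ∷ʳ Next) L → L ⊨ ψ ⇔ P ρ Ss

  open Rep

  weaken : ∀ {n m h h′ ψ P} → h ≤ h′ → Rep n m h ψ P → Rep n m h′ ψ P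
  rep (weaken {n} {m} h≤h′ r) n≤N m≤N = rep r (≤-trans (+-monoʳ-≤ n h≤h′) n≤N) (≤-trans (+-monoʳ-≤ (suc m) h≤h′) m≤N)

  rep-resp : ∀ {n m h ψ} {P Q : Vec ℕ n → Vec Rel m → Set₁} → (∀ ρ Ss → P ρ Ss ⇔ Q ρ Ss) → Rep n m h ψ P → Rep n m h ψ Q
  rep (rep-resp P⇔Q r) n≤N m≤N L ρ Ss g = mk⇔ (λ h → to (P⇔Q ρ Ss) (to (rep r n≤N m≤N L ρ Ss g) h)) (λ q → from (rep r n≤N m≤N L ρ Ss g) (from (P⇔Q ρ Ss) q))

  rep-∼ : ∀ {n m h ψ P} → Rep n m h ψ P → Rep n m h (∼ ψ) (λ ρ Ss → ¬ P ρ Ss)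
  rep (rep-∼ r) n≤N m≤N L ρ Ss g = mk⇔ (λ ¬h p → ¬h (from (rep r n≤N m≤N L ρ Ss g) p)) (λ ¬p h → ¬p (to (rep r n≤N m≤N L ρ Ss g) h))

  rep-∧ : ∀ {n m h φ ψ P Q} → Rep n m h φ P → Rep n m h ψ Q → Rep n m h (φ ∧ ψ) (λ ρ Ss → P ρ Ss × Q ρ Ss)
  rep (rep-∧ r s) n≤N m≤N L ρ Ss g = mk⇔
    (λ (a , b) → to (rep r n≤N m≤N L ρ Ss g) a , to (rep s n≤N m≤N L ρ Ss g) b)
    (λ (a , b) → from (rep r n≤N m≤N L ρ Ss g) a , from (rep s n≤N m≤N L ρ Ss g) b)

  rep-∨ : ∀ {n m h φ ψ P Q} → Rep n m h φ P → Rep n m h ψ Q → Rep n m h (φ ∨ᵇ ψ) (λ ρ Ss → P ρ Ss ⊎ Q ρ Ss)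
  rep (rep-∨ r s) n≤N m≤N L ρ Ss g = mk⇔
    (λ { (inj₁ a) → inj₁ (to (rep r n≤N m≤N L ρ Ss g) a) ; (inj₂ b) → inj₂ (to (rep s n≤N m≤N L ρ Ss g) b) })
    (λ { (inj₁ a) → inj₁ (from (rep r n≤N m≤N L ρ Ss g) a) ; (inj₂ b) → inj₂ (from (rep s n≤N m≤N L ρ Ss g) b) })

  room : ∀ n h → n + suc h ≤ N → suc n + h ≤ N
  room n h = subst (_≤ N) (+-suc n h)

  isPoint-agrees : ∀ {n L} → (∀ w → w ∈ ∣ L ∣ → WellFormed N w) → L ⊨ decided true n → L ⊨ isPoint n →
                  ∃[ a ] (∀ w → w ∈ ∣ L ∣ → Agrees true n (Point a) w)
  isPoint-agrees {n} {L} wfL hd (h , h₁ , h₂)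
    with v , v∈ , sv ← to (somewhere (flat-signedAt true true n) L) h
    with a , b , pv , qv ← marks {v} (wfL v v∈) = a , agrees
    where
    plus : Team 6
    plus = filter L (Signed true true n) (stable (flat-signedAt true true n))
    same : plus ⊨ constG mark₁
    same = h₁ plus proj₁ (from (flat (flat-signedAt true true n) plus) (λ _ → proj₂))
    diagonal : ∀ w → w ∈ ∣ L ∣ → Signed true true n w → bit w (N + a) mark₁ ≡ true → bit w (N + a) mark₂ ≡ true
    diagonal w w∈ sw = subst (λ i → bit w i mark₁ ≡ true → bit w i mark₂ ≡ true) (+-identityʳ (N + a))
      (to (flat (flat-⇒ (flat-signedAt true true n) (flat-G (flat-⇒ (flat-atom mark₁) (flat-atom mark₂)))) L) h₂ w w∈ sw (N + a))
    fst-a : ∀ w → w ∈ ∣ L ∣ → Signed true true n w → bit w (N + a) mark₁ ≡ true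
    fst-a w w∈ sw = trans (constG-same mark₁ plus same (w∈ , sw) (v∈ , sv) (N + a)) pv
    agrees : ∀ w → w ∈ ∣ L ∣ → Agrees true n (Point a) w
    agrees w w∈ true c d sw mk = let p = fst-a w w∈ sw in
      ofʸ (marks-unique {w} (wfL w w∈) mk (p , diagonal w w∈ sw p))
    -- A negative trace at `(a , a)` would share its marks with the positive trace `v`, contrary to
    -- `decided`.
    agrees w w∈ false c d (iw , sw) mk = ofⁿ (λ { (refl , refl) →
      not-¬ (trans (decided-same {true} {n} {L} wfL hd v∈ w∈ (proj₁ sv) iw {a} {a} (pv , diagonal v v∈ sv pv) mk) sw) (proj₂ sv) })

  select-isPoint : ∀ {n L a} → Base L → n < N → Keeps true n L → select true n (Point a) L ⊨ isPoint n
  select-isPoint {n} {L} {a} base n<N k = from (somewhere (flat-signedAt true true n) L′) witness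
    , (λ L″ L″⊆ h → same-constG mark₁ L″ (λ i → bit (proj₁ witness) i mark₁)
        (λ w w∈ → fst-same {w} {proj₁ witness} (wf-of w (L″⊆ {w} w∈)) (wf-of _ (proj₁ (proj₂ witness)))
          (marks-at w (L″⊆ {w} w∈) (to (flat (flat-signedAt true true n) L″) h w w∈))
          (marks-at _ (proj₁ (proj₂ witness)) (proj₂ (proj₂ witness)))))
    , from (flat (flat-⇒ (flat-signedAt true true n) (flat-G (flat-⇒ (flat-atom mark₁) (flat-atom mark₂)))) L′)
        (λ w w∈ sw i p → let p′ , q′ = marks-at w w∈ sw in
          subst (λ i → bit w i mark₂ ≡ true) (fst-once {w} (wf-of w w∈) _ _ p′ p) q′)
    where
    L′ = select true n (Point a) L
    wf-of : ∀ w → w ∈ ∣ L′ ∣ → WellFormed N w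
    wf-of w (w∈ , _) = proj₁ base w w∈
    witness : ∃[ w ] w ∈ ∣ L′ ∣ × Signed true true n w
    witness with w , w∈@(_ , ag) , iw , mk ← proj₁ (select-keeps {true} {n} {Point a} {L} base n<N k) n z≤n n<N a a =
      w , w∈ , iw , reflects-true (ag _ a a (iw , refl) mk) (refl , refl)
    marks-at : ∀ w → w ∈ ∣ L′ ∣ → Signed true true n w → Marks N a a w
    marks-at w w∈ sw with c , d , mk ← marks {w} (wf-of w w∈)
      with refl , refl ← reflects-refl (proj₂ w∈ true c d sw mk) refl = mk

  extend : ∀ {κ d L} (S : Rel) (Ss : Vec Rel d) → Fixed κ Ss L → (∀ w → w ∈ ∣ L ∣ → Agrees κ d S w) → Fixed κ (S ∷ Ss) L
  extend S Ss f ag zero    w w∈ = ag w w∈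
  extend S Ss f ag (suc x) w w∈ = f x w w∈

  -- A chosen subteam is again `Good`: `keepBoth` restores the presence of pairs, earlier relations
  -- are inherited, and the new slot holds a point. Conversely `select` provides a subteam for each
  -- number.
  rep-choose₁ : ∀ {n m h ψ P} → Rep (suc n) m h ψ P → Rep n m (suc h) (choose₁ n (suc m) (isPoint n ∧ ψ)) (λ ρ Ss → ∃[ a ] P (a ∷ ρ) Ss)
  rep (rep-choose₁ {n} {m} {h} {ψ} {P} r) n≤N m≤N L ρ Ss (good base k₁ k₂ f₁ f₂) = mk⇔ there back
    where
    n<N : n < N
    n<N = ≤-trans (m≤m+n (suc n) h) (room n h n≤N)
    m<N : suc m ≤ N
    m<N = ≤-trans (m≤m+n (suc m) (suc h)) m≤N
    body = keepBoth (suc n) (suc m) ∧ (decided true n ∧ (isPoint n ∧ ψ))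
    ih = rep r (room n h n≤N) (≤-trans (+-monoʳ-≤ (suc m) (n≤1+n h)) m≤N)
    there : L ⊨ choose₁ n (suc m) (isPoint n ∧ ψ) → ∃[ a ] P (a ∷ ρ) Ss
    there e =
      let L′ , L′⊆ , hk , hd , hs , hψ = to (some-correct {φ = body} L) e
          wfL′ = λ w w∈ → proj₁ base w (L′⊆ {w} w∈)
          base′ , k₁′ , k₂′ = to (keepBoth-correct {L = L′} wfL′ n<N m<N) hk
          a , ag = isPoint-agrees {n} {L′} wfL′ hd hs
      in a , to (ih L′ (a ∷ ρ) Ss (good base′ k₁′ k₂′ (extend {true} {n} {L′} (Point a) (map Point ρ) (fixed-⊆ {L = L} {L′} (map Point ρ) f₁ L′⊆) ag)
                                          (fixed-⊆ {L = L} {L′} (Ss ∷ʳ Next) f₂ L′⊆))) hψ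
    back : ∃[ a ] P (a ∷ ρ) Ss → L ⊨ choose₁ n (suc m) (isPoint n ∧ ψ)
    back (a , p) = from (some-correct {φ = body} L) (L′ , proj₁ ,
        from (keepBoth-correct {L = L′} wfL′ n<N m<N) (base′ , k₁′ , k₂′) ,
        select-decided {true} {n} {Point a} {L} base , select-isPoint {n} {L} {a} base n<N k₁ ,
        from (ih L′ (a ∷ ρ) Ss (good base′ k₁′ k₂′ (select-fixed {L = L} base {map Point ρ} f₁)
                                       (fixed-⊆ {L = L} {L′} (Ss ∷ʳ Next) f₂ proj₁))) p)
      where
      L′ = select true n (Point a) L
      wfL′ : ∀ w → w ∈ ∣ L′ ∣ → WellFormed N w
      wfL′ w (w∈ , _) = proj₁ base w w∈
      k₁′ = select-keeps {true} {n} {Point a} {L} base n<N k₁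
      k₂′ = select-keeps-other {true} {n} {Point a} {L} base {false} {suc m} (λ ()) k₂
      base′ : Base L′
      base′ = wfL′ , let w , w∈ , _ = proj₁ k₁′ n z≤n n<N 0 0 in w , w∈

  -- As for numbers, except that the relation is not constrained: `Read` recovers it from the chosen
  -- subteam, and `select` realizes any given one.
  rep-choose₂ : ∀ {n m h ψ P} → Rep n (suc m) h ψ P → Rep n m (suc h) (choose₂ n (suc m) ψ) (λ ρ Ss → ∃[ S ] P ρ (S ∷ Ss))
  rep (rep-choose₂ {n} {m} {h} {ψ} {P} r) n≤N m≤N L ρ Ss (good base k₁ k₂ f₁ f₂) = mk⇔ there back
    where
    n≤N′ : n ≤ N
    n≤N′ = ≤-trans (m≤m+n n (suc h)) n≤N
    m<N : suc m < N
    m<N = ≤-trans (m≤m+n (suc (suc m)) h) (room (suc m) h m≤N)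
    body = keepBoth n (suc (suc m)) ∧ (decided false (suc m) ∧ ψ)
    ih = rep r (≤-trans (+-monoʳ-≤ n (n≤1+n h)) n≤N) (room (suc m) h m≤N)
    there : L ⊨ choose₂ n (suc m) ψ → ∃[ S ] P ρ (S ∷ Ss)
    there e =
      let L′ , L′⊆ , hk , hd , hψ = to (some-correct {φ = body} L) e
          wfL′ = λ w w∈ → proj₁ base w (L′⊆ {w} w∈)
          base′ , k₁′ , k₂′ = to (keepBoth-correct {L = L′} wfL′ n≤N′ m<N) hk
          S = Read false (suc m) L′
      in S , to (ih L′ ρ (S ∷ Ss) (good base′ k₁′ k₂′ (fixed-⊆ {L = L} {L′} (map Point ρ) f₁ L′⊆)
                (extend {false} {suc m} {L′} S (Ss ∷ʳ Next) (fixed-⊆ {L = L} {L′} (Ss ∷ʳ Next) f₂ L′⊆) (read-correct {L = L′} wfL′ hd)))) hψ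
    back : ∃[ S ] P ρ (S ∷ Ss) → L ⊨ choose₂ n (suc m) ψ
    back (S , p) = from (some-correct {φ = body} L) (L′ , proj₁ ,
        from (keepBoth-correct {L = L′} wfL′ n≤N′ m<N) (base′ , k₁′ , k₂′) ,
        select-decided {false} {suc m} {S} {L} base ,
        from (ih L′ ρ (S ∷ Ss) (good base′ k₁′ k₂′ (fixed-⊆ {L = L} {L′} (map Point ρ) f₁ proj₁)
                                       (select-fixed {L = L} base {Ss ∷ʳ Next} f₂))) p)
      where
      L′ = select false (suc m) S L
      wfL′ : ∀ w → w ∈ ∣ L′ ∣ → WellFormed N w
      wfL′ w (w∈ , _) = proj₁ base w w∈
      k₁′ = select-keeps-other {false} {suc m} {S} {L} base {true} {n} (λ ()) k₁
      k₂′ = select-keeps {false} {suc m} {S} {L} base m<N k₂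
      base′ : Base L′
      base′ = wfL′ , let w , w∈ , _ = proj₁ k₂′ (suc m) z≤n m<N 0 0 in w , w∈

  rep-related : ∀ {n m} (A : Fin (suc m)) (x y : Fin n) →
            Rep n m 0 (related (lev A) (lev x) (lev y)) (λ ρ Ss → Lift _ (lookup (Ss ∷ʳ Next) A (lookup ρ x) (lookup ρ y)))
  rep (rep-related {n} {m} A x y) n≤N m≤N L ρ Ss (good base k₁ k₂ f₁ f₂) = mk⇔ there back
    where
    S = lookup (Ss ∷ʳ Next) A
    a = lookup ρ x
    b = lookup ρ y
    fA = flat-signedAt false true (lev A)
    fx = flat-signedAt true true (lev x)
    fy = flat-signedAt true true (lev y)
    A<N : lev A < N
    A<N = ≤-trans (lev< A) (≤-trans (m≤m+n (suc m) 0) m≤N)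
    var<N : ∀ z → lev {n} z < N
    var<N z = ≤-trans (lev< z) (≤-trans (m≤m+n n 0) n≤N)
    wfL : ∀ {w} → w ∈ ∣ L ∣ → WellFormed N w
    wfL {w} w∈ = proj₁ base w w∈
    point : ∀ z w → w ∈ ∣ L ∣ → Signed true true (lev z) w → Marks N (lookup ρ z) (lookup ρ z) w
    point z w w∈ sw with c , d , mk ← marks {w} (wfL w∈)
      with refl , refl ← subst (λ S → S c d) (lookup-map z Point ρ) (reflects-refl (f₁ z w w∈ true c d sw mk) refl) = mk
    point-witness : ∀ z → ∃[ w ] w ∈ ∣ L ∣ × Signed true true (lev z) w
    point-witness z with w , w∈ , iw , mk ← proj₁ k₁ (lev z) z≤n (var<N z) (lookup ρ z) (lookup ρ z) =
      w , w∈ , iw , reflects-true (f₁ z w w∈ _ _ _ (iw , refl) mk)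
        (subst (λ S → S (lookup ρ z) (lookup ρ z)) (sym (lookup-map z Point ρ)) (refl , refl))
    body = (∼ neg (signedAt false true (lev A))) ∧ ((∼ neg (signedAt true true (lev x))) ∧ ((∼ neg (signedAt true true (lev y))) ∧
      ((either (signedAt false true (lev A)) (signedAt true true (lev x)) ⇒ constG mark₁) ∧
       (either (signedAt false true (lev A)) (signedAt true true (lev y)) ⇒ constG mark₂))))
    agreeing : ∀ z (mark : Fin 6) L′ → L′ ⊨ (either (signedAt false true (lev A)) (signedAt true true (lev z)) ⇒ constG mark) →
               ∀ {w u} → w ∈ ∣ L′ ∣ → Signed false true (lev A) w → u ∈ ∣ L′ ∣ → Signed true true (lev z) u →
               ∀ i → bit w i mark ≡ bit u i mark
    agreeing z mark L′ h w∈ sw u∈ su =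
      constG-same mark part (h part proj₁ (from (flat f part) (λ _ → proj₂))) (w∈ , inj₁ sw) (u∈ , inj₂ su)
      where
      f = flat-either fA (flat-signedAt true true (lev z))
      part : Team 6
      part = filter L′ (λ t → Signed false true (lev A) t ⊎ Signed true true (lev z) t) (stable f)
    there : L ⊨ related (lev A) (lev x) (lev y) → Lift _ (S a b)
    there h =
      let L′ , L′⊆ , hA , hx , hy , h₁ , h₂ = to (some-correct {φ = body} L) h
          w , w∈ , sw = to (somewhere fA L′) hA
          u , u∈ , su = to (somewhere fx L′) hx
          v , v∈ , sv = to (somewhere fy L′) hy
          first  = trans (agreeing x mark₁ L′ h₁ w∈ sw u∈ su (N + a)) (proj₁ (point x u (L′⊆ {u} u∈) su))
          second = trans (agreeing y mark₂ L′ h₂ w∈ sw v∈ sv (N + b)) (proj₂ (point y v (L′⊆ {v} v∈) sv))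
      in lift (reflects-refl (f₂ A w (L′⊆ {w} w∈) true a b sw (first , second)) refl)
    reachable : ∃[ w ] w ∈ ∣ L ∣ × InSlot false (lev A) w × Marks N a b w
    reachable = proj₁ k₂ (lev A) z≤n A<N a b
    -- The positive traces of slot `A` are cut down to the pair `(a , b)`; the slots of `x` and `y`
    -- are untouched, being of the other sort.
    L′ : Team 6
    L′ = filter L (λ t → Signed false true (lev A) t → Marks N a b t)
      (λ t≗t′ h st → Marks-resp {N} {a} {b} t≗t′ (h (Signed-resp {false} {true} {lev A} (≗-sym t≗t′) st)))
    in-slot : ∀ z → ∃[ t ] t ∈ ∣ L′ ∣ × Signed true true (lev z) t
    in-slot z =
      let t , t∈ , st = point-witness z in
      t , (t∈ , (λ ((τ , k) , _) → ⊥-elim (not-¬ (subst (λ j → bit t j sort ≡ false) (tag-once {t} (wfL t∈) _ _ τ (proj₁ (proj₁ st))) k) (proj₂ (proj₁ st))))) , st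
    back : Lift _ (S a b) → L ⊨ related (lev A) (lev x) (lev y)
    back (lift s) =
      let w , w∈ , iw , mk = reachable
          sw = iw , reflects-true (f₂ A w w∈ _ a b (iw , refl) mk) s
      in from (some-correct {φ = body} L)
      (L′ , proj₁ , from (somewhere fA L′) (w , (w∈ , λ _ → mk) , sw) , from (somewhere fx L′) (in-slot x) , from (somewhere fy L′) (in-slot y) ,
       (λ L″ L″⊆ h → same-constG mark₁ L″ (λ i → bit w i mark₁) (λ t t∈ → first w (wfL w∈) mk t (L″⊆ {t} t∈) (to (flat (flat-either fA fx) L″) h t t∈))) ,
       (λ L″ L″⊆ h → same-constG mark₂ L″ (λ i → bit w i mark₂) (λ t t∈ → second w (wfL w∈) mk t (L″⊆ {t} t∈) (to (flat (flat-either fA fy) L″) h t t∈))))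
      where
      first : ∀ w → WellFormed N w → Marks N a b w → ∀ t → t ∈ ∣ L′ ∣ → Signed false true (lev A) t ⊎ Signed true true (lev x) t →
              ∀ i → bit t i mark₁ ≡ bit w i mark₁
      first w wellFormed mk t (t∈ , h) (inj₁ st) = fst-same {t} {w} (wfL t∈) wellFormed (h st) mk
      first w wellFormed mk t (t∈ , h) (inj₂ st) = fst-same {t} {w} (wfL t∈) wellFormed (point x t t∈ st) mk
      second : ∀ w → WellFormed N w → Marks N a b w → ∀ t → t ∈ ∣ L′ ∣ → Signed false true (lev A) t ⊎ Signed true true (lev y) t →
               ∀ i → bit t i mark₂ ≡ bit w i mark₂
      second w wellFormed mk t (t∈ , h) (inj₁ st) = snd-same {t} {w} (wfL t∈) wellFormed (h st) mk
      second w wellFormed mk t (t∈ , h) (inj₂ st) = snd-same {t} {w} (wfL t∈) wellFormed (point y t t∈ st) mk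

  cast : ∀ {n m h ψ ψ′ P} → ψ ≡ ψ′ → Rep n m h ψ P → Rep n m h ψ′ P
  cast refl r = r

  rep-ex₁ : ∀ {n m h ψ P} → Rep (suc n) m h ψ P → Rep n m (suc h) (ex₁ n m ψ) (λ ρ Ss → ∃[ a ] P (a ∷ ρ) Ss)
  rep-ex₁ r = cast (ex₁≡ _ _ _) (rep-choose₁ r)

  rep-ex₂ : ∀ {n m h ψ P} → Rep n (suc m) h ψ P → Rep n m (suc h) (ex₂ n m ψ) (λ ρ Ss → ∃[ S ] P ρ (S ∷ Ss))
  rep-ex₂ r = cast (ex₂≡ _ _ _) (rep-choose₂ r)

  rep-rel : ∀ {n m} (A : Fin (suc m)) (x y : Fin n) →
            Rep n m 0 (rel (lev A) (lev x) (lev y)) (λ ρ Ss → Lift _ (lookup (Ss ∷ʳ Next) A (lookup ρ x) (lookup ρ y)))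
  rep-rel A x y = cast (rel≡ _ _ _) (rep-related A x y)

  next-agrees : ∀ {L} → (∀ w → w ∈ ∣ L ∣ → WellFormed N w) → L ⊨ isNext 0 → ∀ w → w ∈ ∣ L ∣ → Agrees false 0 Next w
  next-agrees {L} wfL (hs , _) w w∈ true a b sw (p , q) =
    ofʸ (+-cancelˡ-≡ N (suc a) b (trans (+-suc N a) (snd-once {w} (wfL w w∈) _ _
      (subst (λ i → bit w i mark₂ ≡ true) (+-comm (N + a) 1) (follow (subst (λ i → bit w i mark₁ ≡ true) (sym (+-identityʳ (N + a))) p))) q)))
    where
    follow = to (flat (flat-⇒ (flat-signedAt false true 0) (flat-G (flat-⇒ (flat-atom mark₁) (flat-X (flat-atom mark₂))))) L) hs w w∈ sw (N + a)
  next-agrees {L} wfL (_ , hs) w w∈ false a b sw (p , q) =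
    ofⁿ (λ { refl → follow (subst (λ i → bit w i mark₁ ≡ true) (sym (+-identityʳ (N + a))) p)
                           (subst (λ i → bit w i mark₂ ≡ true) (trans (+-suc N a) (+-comm 1 (N + a))) q) })
    where
    follow = to (flat (flat-⇒ (flat-signedAt false false 0) (flat-G (flat-⇒ (flat-atom mark₁) (flat-X (flat-neg (flat-atom mark₂)))))) L) hs w w∈ sw (N + a)

  rep-sentence-sound : ∀ {h ψ P L} → suc h ≤ N → Rep 0 0 h ψ P → L ⊨ sentence N ψ → P [] []
  rep-sentence-sound {h} {ψ} {P} {L} h<N r s =
    let L₀ , _ , hwf , hk₀ , hc = to (some-correct {φ = wellFormed N ∧ (keepBoth 0 0 ∧ choose₂ 0 0 (isNext 0 ∧ ψ))} L) s
        L₁ , L₁⊆ , hk , hd , hs , hψ = to (some-correct {φ = keepBoth 0 1 ∧ (decided false 0 ∧ (isNext 0 ∧ ψ))} L₀) hc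
        wfL₁ = λ w w∈ → to (flat (flat-wellFormed N) L₀) hwf w (L₁⊆ {w} w∈)
        base , k₁ , k₂ = to (keepBoth-correct {L = L₁} wfL₁ z≤n (≤-trans (s≤s z≤n) h<N)) hk
    in to (rep r (<⇒≤ h<N) h<N L₁ [] [] (good base k₁ k₂ (λ ()) (extend {false} {0} {L₁} Next [] (λ ()) (next-agrees {L₁} wfL₁ hs)))) hψ

  poolTrace : Bool → Bool → ℕ → ℕ → ℕ → Trace 6
  poolTrace κ s j a b i = at j ∷ κ ∷ s ∷ at N ∷ at (N + a) ∷ at (N + b) ∷ []
    where
    at : ℕ → Bool
    at c = does (i ≟ c)

  at-refl : ∀ c → does (c ≟ c) ≡ true
  at-refl c = dec-true (c ≟ c) refl

  at-unique : ∀ c i j → does (i ≟ c) ≡ true → does (j ≟ c) ≡ true → i ≡ j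
  at-unique c i j p q = trans (at-true i p) (sym (at-true j q))
    where
    at-true : ∀ i → does (i ≟ c) ≡ true → i ≡ c
    at-true i p = ≡ᵇ⇒≡ i c (subst T (sym p) tt)

  poolTrace-wellFormed : ∀ κ s j a b → WellFormed N (poolTrace κ s j a b)
  poolTrace-wellFormed κ s j a b = at-unique j , at-unique N , at-unique (N + a) , at-unique (N + b) ,
    at-refl N , (a , at-refl (N + a)) , (b , at-refl (N + b))

  -- The full team contains `poolTrace κ s j a b` for all parameters, so its well-formed part has
  -- every pair with both signs in every slot. Selecting the successor relation in slot `0` then
  -- yields a `Good` team.
  rep-sentence-complete : ∀ {h ψ P L} → suc h ≤ N → Rep 0 0 h ψ P → P [] [] → (∀ w → w ∈ ∣ L ∣) → L ⊨ sentence N ψ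
  rep-sentence-complete {h} {ψ} {P} {L} h<N r p full =
    from (some-correct {φ = wellFormed N ∧ (keepBoth 0 0 ∧ choose₂ 0 0 (isNext 0 ∧ ψ))} L) (L₀ , proj₁ ,
      from (flat (flat-wellFormed N) L₀) (λ _ → proj₂) ,
      from (keepBoth-correct {L = L₀} (λ _ → proj₂) z≤n z≤n) (base₀ , pool true , pool false) ,
      from (some-correct {φ = keepBoth 0 1 ∧ (decided false 0 ∧ (isNext 0 ∧ ψ))} L₀) (L₁ , proj₁ ,
        from (keepBoth-correct {L = L₁} (λ w (w∈ , _) → proj₂ w∈) z≤n 0<N) (base₁ , k₁ , k₂) ,
        select-decided {false} {0} {Next} {L₀} base₀ ,
        (from (flat (flat-⇒ (flat-signedAt false true 0) (flat-G (flat-⇒ (flat-atom mark₁) (flat-X (flat-atom mark₂))))) L₁) positive ,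
         from (flat (flat-⇒ (flat-signedAt false false 0) (flat-G (flat-⇒ (flat-atom mark₁) (flat-X (flat-neg (flat-atom mark₂)))))) L₁) negative) ,
        from (rep r (<⇒≤ h<N) h<N L₁ [] [] (good base₁ k₁ k₂ (λ ()) (select-fixed {L = L₀} base₀ {[]} (λ ())))) p))
    where
    0<N : 0 < N
    0<N = ≤-trans (s≤s z≤n) h<N
    L₀ = filter L (WellFormed N) (stable (flat-wellFormed N))
    pool-signed : ∀ κ s → From (Signed κ s) 0 L₀
    pool-signed κ s j _ j<N a b = poolTrace κ s j a b , (full _ , poolTrace-wellFormed κ s j a b) ,
      ((at-refl j , refl) , refl) , at-refl (N + a) , at-refl (N + b)
    pool : ∀ κ → Keeps κ 0 L₀
    pool κ = from-map {d = 0} {L₀} (λ _ _ → proj₁) (pool-signed κ true) , pool-signed κ true , pool-signed κ false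
    base₀ : Base L₀
    base₀ = (λ _ → proj₂) , let w , w∈ , _ = pool-signed true true 0 z≤n 0<N 0 0 in w , w∈
    L₁ = select false 0 Next L₀
    k₁ = select-keeps-other {false} {0} {Next} {L₀} base₀ {true} {0} (λ ()) (pool true)
    k₂ = select-keeps {false} {0} {Next} {L₀} base₀ 0<N (pool false)
    base₁ : Base L₁
    base₁ = (λ w (w∈ , _) → proj₂ w∈) , let w , w∈ , _ = proj₁ k₂ 0 z≤n 0<N 0 0 in w , w∈
    next-mark : ∀ w → WellFormed N w → ∀ i a → bit w (i + 0) mark₁ ≡ true → bit w (N + a) mark₁ ≡ true → N + suc a ≡ i + 1
    next-mark w wfw i a p p′ = trans (+-suc N a) (trans (cong suc (trans (fst-once {w} wfw _ _ p′ p) (+-identityʳ i))) (+-comm 1 i))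
    positive : ∀ w → w ∈ ∣ L₁ ∣ → Signed false true 0 w → ∀ i → bit w (i + 0) mark₁ ≡ true → bit w (i + 1) mark₂ ≡ true
    positive w ((_ , wfw) , ag) sw i p with a , b , p′ , q′ ← marks {w} wfw
      with refl ← reflects-refl (ag true a b sw (p′ , q′)) refl = subst (λ i → bit w i mark₂ ≡ true) (next-mark w wfw i a p p′) q′
    negative : ∀ w → w ∈ ∣ L₁ ∣ → Signed false false 0 w → ∀ i → bit w (i + 0) mark₁ ≡ true → ¬ bit w (i + 1) mark₂ ≡ true
    negative w ((_ , wfw) , ag) sw i p q with a , b , p′ , q′ ← marks {w} wfw
      with ag false a b sw (p′ , q′)
    ... | ofⁿ ¬next = ¬next (+-cancelˡ-≡ N (suc a) b (trans (next-mark w wfw i a p p′) (snd-once {w} wfw _ _ q q′)))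

-- Arithmetic

imp : Formula → Formula → Formula
imp φ ψ = (∼ φ) ∨ᵇ ψ

all₁ all₂ : ℕ → ℕ → Formula → Formula
all₁ n m ψ = ∼ ex₁ n m (∼ ψ)
all₂ n m ψ = ∼ ex₂ n m (∼ ψ)

isZeroF : ℕ → ℕ → ℕ → Formula
isZeroF n m x = ∼ ex₁ n m (rel 0 n x)

-- Two numbers are equal if they have a common successor.
eqF : ℕ → ℕ → ℕ → ℕ → Formula
eqF n m x y = ex₁ n m (rel 0 x n ∧ rel 0 y n)

startF : ℕ → ℕ → ℕ → Formula
startF n m b = all₁ n (suc m) (imp (isZeroF (suc n) (suc m) n) (rel (suc m) n b))

stepF : ℕ → ℕ → Formula → Formula
stepF n m st = all₁ n (suc m) (all₁ (1 + n) (suc m) (all₁ (2 + n) (suc m) (all₁ (3 + n) (suc m)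
  (imp (rel (suc m) n (2 + n)) (imp (rel 0 n (1 + n)) (imp st (rel (suc m) (1 + n) (3 + n))))))))

-- y and z belong to every relation that contains (0 , b) and is closed under
-- st, which speaks about the slots 2 + n and 3 + n.
iterF : ℕ → ℕ → ℕ → Formula → ℕ → ℕ → Formula
iterF n m b st y z = all₂ n m (imp (startF n m b) (imp (stepF n m st) (rel (suc m) y z)))

-- Addition iterates the successor from `x`, multiplication iterates the addition of `x` from zero,
-- each `y` times. The start value `n` in `mulF` is the slot that `startF` binds and requires to be
-- zero.
addF mulF : ℕ → ℕ → ℕ → ℕ → ℕ → Formula
addF n m x y z = iterF n m x (rel 0 (2 + n) (3 + n)) y z
mulF n m x y z = iterF n m n (addF (4 + n) (suc m) (2 + n) x (3 + n)) y z

-- Slot `n` holds the successor of `x`, and adding some number to it gives `y`.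
lessF : ℕ → ℕ → ℕ → ℕ → Formula
lessF n m x y = ex₁ n m (rel 0 x n ∧ ex₁ (suc n) m (addF (2 + n) m n (suc n) y))

-- Slot z holds the value of the term.
valueF : ∀ {k} → Term k → ℕ → ℕ → Formula
valueF (var x) z m = eqF (suc z) m (lev x) z
valueF (s ⊕ t) z m = ex₁ (suc z) m (valueF s (suc z) m ∧ ex₁ (2 + z) m (valueF t (2 + z) m ∧ addF (3 + z) m (suc z) (2 + z) z))
valueF (s ⊗ t) z m = ex₁ (suc z) m (valueF s (suc z) m ∧ ex₁ (2 + z) m (valueF t (2 + z) m ∧ mulF (3 + z) m (suc z) (2 + z) z))

-- Membership is tested on the diagonal of a relation. Relation slots are shifted by one, as slot
-- `0` holds the successor.
translate : ∀ {n m} → SOFormula n m → Formula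
translate {n} {m} (s ≐ t) = ex₁ n m (valueF s n m ∧ valueF t n m)
translate {n} {m} (s ≺ t) = ex₁ n m (valueF s n m ∧ ex₁ (suc n) m (valueF t (suc n) m ∧ lessF (2 + n) m n (suc n)))
translate {n} {m} (t ϵ A) = ex₁ n m (valueF t n m ∧ rel (suc (lev A)) n n)
translate (¬ᶠ φ)          = ∼ translate φ
translate (φ ∧ ψ)         = translate φ ∧ translate ψ
translate (φ ∨ ψ)         = translate φ ∨ᵇ translate ψ
translate (φ ⇒ ψ)         = imp (translate φ) (translate ψ)
translate {n} {m} (∀₁ φ)  = all₁ n m (translate φ)
translate {n} {m} (∃₁ φ)  = ex₁ n m (translate φ)
translate {n} {m} (∀₂ φ)  = all₂ n m (translate φ)
translate {n} {m} (∃₂ φ)  = ex₂ n m (translate φ)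

-- Bounds the quantifier depth of the translation as well as the number of
-- steps that compute it.
heightT : ∀ {k} → Term k → ℕ
heightT (var x) = 1
heightT (s ⊕ t) = 12 + (heightT s + heightT t)
-- `12` is two quantifiers for the values of the subterms plus the depth `10` of `mulF`.
heightT (s ⊗ t) = 12 + (heightT s + heightT t)

height : ∀ {n m} → SOFormula n m → ℕ
height (s ≐ t) = 12 + (heightT s + heightT t)
height (s ≺ t) = 12 + (heightT s + heightT t)
height (t ϵ A) = 12 + heightT t
-- `3` is what a unary node costs the machine: two steps of its own and one for a dummy right child.
height (¬ᶠ φ)  = 3 + height φ
height (φ ∧ ψ) = 2 + (height φ + height ψ)
height (φ ∨ ψ) = 2 + (height φ + height ψ)
height (φ ⇒ ψ) = 2 + (height φ + height ψ)
height (∀₁ φ)  = 3 + height φ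
height (∃₁ φ)  = 3 + height φ
height (∀₂ φ)  = 3 + height φ
height (∃₂ φ)  = 3 + height φ

iterate : (ℕ → ℕ) → ℕ → ℕ → ℕ
iterate f a zero    = a
iterate f a (suc k) = f (iterate f a k)

dropV : ∀ i {k} → Vec ℕ (i + k) → Vec ℕ k
dropV zero    ρ       = ρ
dropV (suc i) (_ ∷ ρ) = dropV i ρ

lookup-raise : ∀ i {k} (ρ : Vec ℕ (i + k)) (x : Fin k) → lookup ρ (i ↑ʳ x) ≡ lookup (dropV i ρ) x
lookup-raise zero    ρ       x = refl
lookup-raise (suc i) (_ ∷ ρ) x = lookup-raise i ρ x

lev-raise : ∀ i {k} (x : Fin k) → lev (i ↑ʳ x) ≡ lev x
lev-raise zero    x = refl
lev-raise (suc i) x = lev-raise i x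

lookup-∷ʳ-inject₁ : ∀ {A : Set₁} {m} (xs : Vec A m) a (x : Fin m) → lookup (xs ∷ʳ a) (inject₁ x) ≡ lookup xs x
lookup-∷ʳ-inject₁ (y ∷ xs) a zero    = refl
lookup-∷ʳ-inject₁ (y ∷ xs) a (suc x) = lookup-∷ʳ-inject₁ xs a x

lookup-∷ʳ-last : ∀ {A : Set₁} {m} (xs : Vec A m) a → lookup (xs ∷ʳ a) (fromℕ m) ≡ a
lookup-∷ʳ-last []       a = refl
lookup-∷ʳ-last (y ∷ xs) a = lookup-∷ʳ-last xs a

lev-inject₁ : ∀ {m} (x : Fin m) → lev (inject₁ x) ≡ suc (lev x)
lev-inject₁ {suc m} zero    = refl
lev-inject₁ {suc m} (suc x) = lev-inject₁ x

lev-last : ∀ m → lev (fromℕ m) ≡ 0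
lev-last zero    = refl
lev-last (suc m) = lev-last m

diagonal : Rel → Pred ℕ 0ℓ
diagonal S a = S a a

-- Correctness of the arithmetic formulas and of the translation

module Translation (em : ExcludedMiddle (lsuc 0ℓ)) (N : ℕ) where

  open Classical em
  open Representation em N

  rep-next : ∀ {n m h} (x y : Fin n) → Rep n m h (rel 0 (lev x) (lev y)) (λ ρ Ss → Lift _ (suc (lookup ρ x) ≡ lookup ρ y))
  rep-next {n} {m} x y = weaken z≤n (rep-resp
    (λ ρ Ss → mk⇔ (λ (lift h) → lift (subst (λ S → S (lookup ρ x) (lookup ρ y)) (lookup-∷ʳ-last Ss Next) h))
                  (λ (lift h) → lift (subst (λ S → S (lookup ρ x) (lookup ρ y)) (sym (lookup-∷ʳ-last Ss Next)) h)))
    (cast (cong (λ A → rel A (lev x) (lev y)) (lev-last m)) (rep-rel {n} {m} (fromℕ m) x y)))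

  rep-var : ∀ {n m h} (A : Fin m) (x y : Fin n) →
            Rep n m h (rel (suc (lev A)) (lev x) (lev y)) (λ ρ Ss → Lift _ (lookup Ss A (lookup ρ x) (lookup ρ y)))
  rep-var {n} {m} A x y = weaken z≤n (rep-resp
    (λ ρ Ss → mk⇔ (λ (lift h) → lift (subst (λ S → S (lookup ρ x) (lookup ρ y)) (lookup-∷ʳ-inject₁ Ss Next A) h))
                  (λ (lift h) → lift (subst (λ S → S (lookup ρ x) (lookup ρ y)) (sym (lookup-∷ʳ-inject₁ Ss Next A)) h)))
    (cast (cong (λ A → rel A (lev x) (lev y)) (lev-inject₁ A)) (rep-rel {n} {m} (inject₁ A) x y)))

  rep-imp : ∀ {n m h φ ψ P Q} → Rep n m h φ P → Rep n m h ψ Q → Rep n m h (imp φ ψ) (λ ρ Ss → P ρ Ss → Q ρ Ss)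
  rep-imp {n} {m} {P = P} {Q} r s = rep-resp (λ ρ Ss → mk⇔
      (λ { (inj₁ ¬p) p → ⊥-elim (¬p p) ; (inj₂ q) _ → q })
      (λ h → by-contradiction (λ ¬pq → ¬pq (inj₁ (λ p → ¬pq (inj₂ (h p)))))))
    (rep-∨ (rep-∼ r) s)

  rep-all₁ : ∀ {n m h ψ P} → Rep (suc n) m h ψ P → Rep n m (suc h) (all₁ n m ψ) (λ ρ Ss → ∀ a → P (a ∷ ρ) Ss)
  rep-all₁ {n} {m} r = rep-resp (λ ρ Ss → mk⇔
      (λ none a → by-contradiction (λ ¬p → none (a , ¬p))) (λ h (a , ¬p) → ¬p (h a)))
    (rep-∼ (rep-ex₁ (rep-∼ r)))

  rep-all₂ : ∀ {n m h ψ P} → Rep n (suc m) h ψ P → Rep n m (suc h) (all₂ n m ψ) (λ ρ Ss → ∀ S → P ρ (S ∷ Ss))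
  rep-all₂ {n} {m} r = rep-resp (λ ρ Ss → mk⇔
      (λ none S → by-contradiction (λ ¬p → none (S , ¬p))) (λ h (S , ¬p) → ¬p (h S)))
    (rep-∼ (rep-ex₂ (rep-∼ r)))

  rep-isZero : ∀ {n m h} (x : Fin n) → Rep n m (suc h) (isZeroF n m (lev x)) (λ ρ _ → Lift _ (lookup ρ x ≡ 0))
  rep-isZero {n} {m} x = rep-resp (λ ρ Ss → mk⇔
      (λ none → lift (zero-of (lookup ρ x) (λ (a , eq) → none (a , lift eq))))
      (λ (lift eq) (a , lift eq′) → case trans eq′ eq of λ ()))
    (rep-∼ (rep-ex₁ (rep-next {suc n} {m} zero (suc x))))
    where
    zero-of : ∀ b → ¬ (∃[ a ] suc a ≡ b) → b ≡ 0
    zero-of zero    _    = refl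
    zero-of (suc b) none = ⊥-elim (none (b , refl))

  rep-eq : ∀ {n m h} (x y : Fin n) → Rep n m (suc h) (eqF n m (lev x) (lev y)) (λ ρ _ → Lift _ (lookup ρ x ≡ lookup ρ y))
  rep-eq {n} {m} x y = rep-resp (λ ρ Ss → mk⇔
      (λ { (a , lift eq , lift eq′) → lift (suc-injective (trans eq (sym eq′))) })
      (λ (lift eq) → _ , lift refl , lift (cong suc (sym eq))))
    (rep-ex₁ (rep-∧ (rep-next {suc n} {m} (suc x) zero) (rep-next {suc n} {m} (suc y) zero)))

  -- The graph of the iteration is the least closed relation: it is an admissible instance itself,
  -- and induction places it inside every other one. The `5` counts the relation and the four
  -- numbers quantified around `st`. The start value is looked up in `0 ∷ ρ` because `b` may name
  -- the zero bound by `startF`.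
  rep-iter : ∀ {n m h st} (b : Fin (suc n)) (f : Vec ℕ n → ℕ → ℕ) (y z : Fin n) →
             Rep (4 + n) (suc m) h st (λ ρ _ → Lift _ (f (dropV 4 ρ) (lookup ρ 1F) ≡ lookup ρ 0F)) →
             Rep n m (5 + h) (iterF n m (lev b) st (lev y) (lev z))
                 (λ ρ _ → Lift _ (iterate (f ρ) (lookup (0 ∷ ρ) b) (lookup ρ y) ≡ lookup ρ z))
  rep-iter {n} {m} {h} b f y z r = rep-resp (λ ρ Ss → mk⇔ (there ρ) (back ρ))
    (rep-all₂ (rep-imp start (rep-imp step (rep-var {n} {m₁} zero y z))))
    where
    m₁ = suc m
    start = rep-all₁ {n} {m₁} {3 + h} (rep-imp (rep-isZero {suc n} {m₁} zero) (rep-var {suc n} {m₁} zero zero b))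
    step = rep-all₁ (rep-all₁ (rep-all₁ (rep-all₁
      (rep-imp (rep-var {4 + n} {m₁} zero 3F 1F) (rep-imp (rep-next {4 + n} {m₁} 3F 2F)
        (rep-imp r (rep-var {4 + n} {m₁} zero 2F 0F)))))))
    Closure : Vec ℕ n → Set₁
    Closure ρ = (S : Rel) → (∀ a → Lift (lsuc 0ℓ) (a ≡ 0) → Lift (lsuc 0ℓ) (S a (lookup (a ∷ ρ) b))) →
      (∀ i i′ j j′ → Lift (lsuc 0ℓ) (S i j) → Lift (lsuc 0ℓ) (suc i ≡ i′) → Lift (lsuc 0ℓ) (f ρ j ≡ j′) → Lift (lsuc 0ℓ) (S i′ j′)) →
      Lift (lsuc 0ℓ) (S (lookup ρ y) (lookup ρ z))
    there : ∀ ρ → Closure ρ → Lift _ (iterate (f ρ) (lookup (0 ∷ ρ) b) (lookup ρ y) ≡ lookup ρ z)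
    there ρ h = h (λ i j → iterate (f ρ) (lookup (0 ∷ ρ) b) i ≡ j) (λ { a (lift refl) → lift refl })
      (λ { i i′ j j′ (lift refl) (lift refl) (lift refl) → lift refl })
    back : ∀ ρ → Lift _ (iterate (f ρ) (lookup (0 ∷ ρ) b) (lookup ρ y) ≡ lookup ρ z) → Closure ρ
    back ρ (lift eq) S h₀ h₁ = subst (λ z → Lift (lsuc 0ℓ) (S (lookup ρ y) z)) eq (go (lookup ρ y))
      where
      go : ∀ i → Lift (lsuc 0ℓ) (S i (iterate (f ρ) (lookup (0 ∷ ρ) b) i))
      go zero    = h₀ 0 (lift refl)
      go (suc i) = h₁ i (suc i) _ _ (go i) (lift refl) (lift refl)

  lift-cong : ∀ {a b c : ℕ} → a ≡ b → Lift (lsuc 0ℓ) (a ≡ c) ⇔ Lift (lsuc 0ℓ) (b ≡ c)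
  lift-cong refl = mk⇔ id id

  rep-add : ∀ {n m} (x y z : Fin n) → Rep n m 5 (addF n m (lev x) (lev y) (lev z)) (λ ρ _ → Lift _ (lookup ρ x + lookup ρ y ≡ lookup ρ z))
  rep-add {n} {m} x y z = rep-resp (λ ρ _ → lift-cong (iterate-suc (lookup ρ x) (lookup ρ y)))
    (rep-iter {n} {m} (suc x) (λ _ → suc) y z (rep-next {4 + n} {suc m} 1F 0F))
    where
    iterate-suc : ∀ a k → iterate suc a k ≡ a + k
    iterate-suc a zero    = sym (+-identityʳ a)
    iterate-suc a (suc k) = trans (cong suc (iterate-suc a k)) (sym (+-suc a k))

  rep-mul : ∀ {n m} (x y z : Fin n) → Rep n m 10 (mulF n m (lev x) (lev y) (lev z)) (λ ρ _ → Lift _ (lookup ρ x * lookup ρ y ≡ lookup ρ z))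
  rep-mul {n} {m} x y z = rep-resp (λ ρ _ → lift-cong (iterate-+ (lookup ρ x) (lookup ρ y)))
    (rep-iter {n} {m} zero (λ ρ j → j + lookup ρ x) y z
      (rep-resp (λ ρ _ → lift-cong (cong (lookup ρ 1F +_) (lookup-raise 4 ρ x)))
        (rep-add {4 + n} {suc m} 1F (4 ↑ʳ x) 0F)))
    where
    iterate-+ : ∀ a k → iterate (_+ a) 0 k ≡ a * k
    iterate-+ a zero    = sym (*-zeroʳ a)
    iterate-+ a (suc k) = trans (cong (_+ a) (iterate-+ a k)) (trans (+-comm (a * k) a) (sym (*-suc a k)))

  rep-less : ∀ {n m h} (x y : Fin n) → Rep n m (7 + h) (lessF n m (lev x) (lev y)) (λ ρ _ → Lift _ (lookup ρ x < lookup ρ y))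
  rep-less {n} {m} {h} x y = rep-resp (λ ρ Ss → mk⇔
      (λ { (a , lift refl , d , lift eq) → lift (subst (suc (lookup ρ x) ≤_) eq (m≤m+n _ d)) })
      (λ (lift lt) → let d , eq = m≤n⇒∃[o]m+o≡n lt in _ , lift refl , d , lift eq))
    (rep-ex₁ (rep-∧ (rep-next {suc n} {m} (suc x) zero)
      (rep-ex₁ (weaken (m≤m+n 5 h) (rep-add {2 + n} {m} 1F 0F (suc (suc y)))))))

  rep-value : ∀ {k m} (t : Term k) i → Rep (suc i + k) m (heightT t) (valueF t (i + k) m)
                                           (λ ρ _ → Lift _ (lookup ρ 0F ≡ ⟦ t ⟧ (dropV (suc i) ρ)))
  rep-value {k} {m} (var x) i = rep-resp
    (λ ρ _ → mk⇔ (λ (lift eq) → lift (trans (sym eq) (lookup-raise (suc i) ρ x)))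
                 (λ (lift eq) → lift (trans (lookup-raise (suc i) ρ x) (sym eq))))
    (cast (cong (λ l → eqF (suc i + k) m l (i + k)) (lev-raise (suc i) x)) (rep-eq {suc i + k} {m} (suc i ↑ʳ x) zero))
  rep-value {k} {m} (s ⊕ t) i = rep-resp
    (λ { (c ∷ ρ) _ → mk⇔ (λ { (a , lift refl , b , lift refl , lift eq) → lift (sym eq) })
                         (λ (lift eq) → _ , lift refl , _ , lift refl , lift (sym eq)) })
    (rep-ex₁ (rep-∧
      (weaken (≤-trans (m≤m+n (heightT s) (heightT t)) (m≤n+m _ 11)) (rep-value s (suc i)))
      (rep-ex₁ (rep-∧
        (weaken (≤-trans (m≤n+m (heightT t) (heightT s)) (m≤n+m _ 10)) (rep-value t (2 + i)))
        (weaken (≤-trans (m≤n+m 5 5) (m≤m+n 10 _)) (rep-add {3 + (i + k)} {m} 1F 0F 2F))))))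
  rep-value {k} {m} (s ⊗ t) i = rep-resp
    (λ { (c ∷ ρ) _ → mk⇔ (λ { (a , lift refl , b , lift refl , lift eq) → lift (sym eq) })
                         (λ (lift eq) → _ , lift refl , _ , lift refl , lift (sym eq)) })
    (rep-ex₁ (rep-∧
      (weaken (≤-trans (m≤m+n (heightT s) (heightT t)) (m≤n+m _ 11)) (rep-value s (suc i)))
      (rep-ex₁ (rep-∧
        (weaken (≤-trans (m≤n+m (heightT t) (heightT s)) (m≤n+m _ 10)) (rep-value t (2 + i)))
        (weaken (m≤m+n 10 _) (rep-mul {3 + (i + k)} {m} 1F 0F 2F))))))

  Truth : ∀ {n m} → SOFormula n m → Vec ℕ n → Vec Rel m → Set₁
  Truth φ ρ Ss = Holds ρ (map diagonal Ss) φ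

  rep-translate : ∀ {n m} (φ : SOFormula n m) → Rep n m (height φ) (translate φ) (Truth φ)
  rep-translate {n} {m} (s ≐ t) = rep-resp
    (λ ρ _ → mk⇔ (λ { (a , lift eq , lift eq′) → lift (trans (sym eq) eq′) }) (λ (lift eq) → _ , lift refl , lift eq))
    (rep-ex₁ (rep-∧
      (weaken (≤-trans (m≤m+n (heightT s) (heightT t)) (m≤n+m _ 11)) (rep-value s 0))
      (weaken (≤-trans (m≤n+m (heightT t) (heightT s)) (m≤n+m _ 11)) (rep-value t 0))))
  rep-translate {n} {m} (s ≺ t) = rep-resp
    (λ ρ _ → mk⇔ (λ { (a , lift refl , b , lift refl , lift lt) → lift lt })
                 (λ (lift lt) → _ , lift refl , _ , lift refl , lift lt))
    (rep-ex₁ (rep-∧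
      (weaken (≤-trans (m≤m+n (heightT s) (heightT t)) (m≤n+m _ 11)) (rep-value s 0))
      (rep-ex₁ (rep-∧
        (weaken (≤-trans (m≤n+m (heightT t) (heightT s)) (m≤n+m _ 10)) (rep-value t 1))
        (rep-less {2 + n} {m} 1F 0F)))))
  rep-translate {n} {m} (t ϵ A) = rep-resp
    (λ ρ Ss → mk⇔ (λ { (a , lift refl , lift p) → lift (subst (λ S → S (⟦ t ⟧ ρ)) (sym (lookup-map A diagonal Ss)) p) })
                  (λ (lift p) → _ , lift refl , lift (subst (λ S → S (⟦ t ⟧ ρ)) (lookup-map A diagonal Ss) p)))
    (rep-ex₁ (rep-∧ (weaken (m≤n+m (heightT t) 11) (rep-value t 0)) (rep-var {suc n} {m} A zero zero)))
  rep-translate {n} {m} (¬ᶠ φ) = weaken (m≤n+m (height φ) 3) (rep-∼ (rep-translate φ))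
  rep-translate {n} {m} (φ ∧ ψ) = rep-∧
    (weaken (≤-trans (m≤m+n (height φ) (height ψ)) (m≤n+m _ 2)) (rep-translate φ))
    (weaken (≤-trans (m≤n+m (height ψ) (height φ)) (m≤n+m _ 2)) (rep-translate ψ))
  rep-translate {n} {m} (φ ∨ ψ) = rep-∨
    (weaken (≤-trans (m≤m+n (height φ) (height ψ)) (m≤n+m _ 2)) (rep-translate φ))
    (weaken (≤-trans (m≤n+m (height ψ) (height φ)) (m≤n+m _ 2)) (rep-translate ψ))
  rep-translate {n} {m} (φ ⇒ ψ) = rep-imp
    (weaken (≤-trans (m≤m+n (height φ) (height ψ)) (m≤n+m _ 2)) (rep-translate φ))
    (weaken (≤-trans (m≤n+m (height ψ) (height φ)) (m≤n+m _ 2)) (rep-translate ψ))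
  rep-translate {n} {m} (∀₁ φ) = rep-all₁ (weaken (m≤n+m (height φ) 2) (rep-translate φ))
  rep-translate {n} {m} (∃₁ φ) = rep-ex₁ (weaken (m≤n+m (height φ) 2) (rep-translate φ))
  -- Each set is the diagonal of some relation, here of the one that ignores its second argument.
  rep-translate {n} {m} (∀₂ φ) = rep-resp (λ ρ Ss → mk⇔ (λ h A → h (λ a _ → A a)) (λ h S → h (diagonal S)))
    (rep-all₂ (weaken (m≤n+m (height φ) 2) (rep-translate φ)))
  rep-translate {n} {m} (∃₂ φ) = rep-resp (λ ρ Ss → mk⇔ (λ (S , h) → diagonal S , h) (λ (A , h) → (λ a _ → A a) , h))
    (rep-ex₂ (weaken (m≤n+m (height φ) 2) (rep-translate φ)))

-- Computing the translation

-- A formula or term in the course of its translation: the code of the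
-- arguments of its outermost constructor, the number base of number variables in
-- its scope, the depths, and the translations of its immediate constituents.
-- For a term, depth₁ is the slot that receives its value.
record Node : Set where
  constructor node
  field
    args base depth₁ depth₂ : ℕ
    left right              : Formula

open Node

encode : Node → Vec ℕ 6
encode (node a k z m φ ψ) = a ∷ k ∷ z ∷ m ∷ codeI φ ∷ codeI ψ ∷ []

-- The combinators below mirror the syntax of `f`, so that a program for the code is obtained by
-- repeating the definition of the formula.
record Computed (f : Node → ℕ) : Set where
  constructor computed
  field
    by    : Comp 6
    equal : ∀ γ → fun by (encode γ) ≡ f γ

open Computed

record Coded (f : Node → Formula) : Set where
  constructor coded
  field
    code-of : Computed (λ γ → codeI (f γ))

open Coded

`args : Computed args
`args = computed ($ 0F) (λ _ → refl)
`base : Computed base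
`base = computed ($ 1F) (λ _ → refl)
`depth₁ : Computed depth₁
`depth₁ = computed ($ 2F) (λ _ → refl)
`depth₂ : Computed depth₂
`depth₂ = computed ($ 3F) (λ _ → refl)
`left : Coded left
`left = coded (computed ($ 4F) (λ _ → refl))
`right : Coded right
`right = coded (computed ($ 5F) (λ _ → refl))

`# : ∀ c → Computed (λ _ → c)
`# c = computed (const c) (λ _ → refl)

`suc : ∀ {f} → Computed f → Computed (λ γ → suc (f γ))
`suc (computed f e) = computed (sucᶜ ⟪ f ∷ [] ⟫) (λ γ → cong suc (e γ))

_`∸_ : ∀ {f g} → Computed f → Computed g → Computed (λ γ → f γ ∸ g γ)
computed f e `∸ computed g e′ = computed (monus ⟪ f ∷ g ∷ [] ⟫) (λ γ → cong₂ _∸_ (e γ) (e′ γ))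

`snd : ∀ {f} → Computed f → Computed (λ γ → snd (f γ))
`snd (computed f e) = computed (sndᶜ ⟪ f ∷ [] ⟫) (λ γ → cong snd (e γ))

`pair : ∀ {f g} → Computed f → Computed g → Computed (λ γ → pair (f γ) (g γ))
`pair (computed f e) (computed g e′) = computed (pairᶜ ⟪ f ∷ g ∷ [] ⟫) (λ γ → cong₂ pair (e γ) (e′ γ))

`formula : ∀ φ → Coded (λ _ → φ)
`formula φ = coded (`# (codeI φ))

infixr 7 _`∧_
infixr 6 _`∨_
infixr 5 _`⇒_

_`∧_ : ∀ {f g} → Coded f → Coded g → Coded (λ γ → f γ ∧ g γ)
coded f `∧ coded g = coded (`pair (`# 3) (`pair f g))

_`∨_ : ∀ {f g} → Coded f → Coded g → Coded (λ γ → f γ ∨ᵇ g γ)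
coded f `∨ coded g = coded (`pair (`# 2) (`pair f g))

_`⇒_ : ∀ {f g} → Coded f → Coded g → Coded (λ γ → f γ ⇒ g γ)
coded f `⇒ coded g = coded (`pair (`# 4) (`pair f g))

_`U_ : ∀ {f g} → Coded f → Coded g → Coded (λ γ → f γ U g γ)
coded f `U coded g = coded (`pair (`# 6) (`pair f g))

`∼ : ∀ {f} → Coded f → Coded (λ γ → ∼ f γ)
`∼ (coded f) = coded (`pair (`# 8) f)

`X^ : ∀ {d f} → Computed d → Coded f → Coded (λ γ → X^ (d γ) (f γ))
`X^ {d} {f} (computed g e) (coded (computed h e′)) = coded (computed (nexts ⟪ g ∷ h ∷ [] ⟫)
  (λ γ → trans (cong₂ (λ d c → fun nexts (d ∷ c ∷ [])) (e γ) (e′ γ)) (nexts-code (d γ) (f γ))))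
  where
  nexts : Comp 2
  nexts = primRec ($ 0F) (pairᶜ ⟪ const 5 ∷ $ 1F ∷ [] ⟫)
  nexts-code : ∀ d φ → fun nexts (d ∷ codeI φ ∷ []) ≡ codeI (X^ d φ)
  nexts-code zero    φ = refl
  nexts-code (suc d) φ = cong (pair 5) (nexts-code d φ)

`neg : ∀ {f} → Coded f → Coded (λ γ → neg (f γ))
`neg f = f `⇒ `formula ⊥ᶠ

`some : ∀ {f} → Coded f → Coded (λ γ → some (f γ))
`some f = `∼ (f `⇒ `formula never)

`either : ∀ {f g} → Coded f → Coded g → Coded (λ γ → either (f γ) (g γ))
`either f g = `neg (`neg f `∧ `neg g)

`fromSlot : ∀ {d} → Computed d → ∀ α → Coded (λ γ → fromSlot (d γ) α)
`fromSlot d α = `X^ d (`formula (some (α ∧ pairs) U atom end))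

`keep : ∀ κ {d} → Computed d → Coded (λ γ → keep κ (d γ))
`keep κ d = `formula (fromSlot 0 (slot κ)) `∧ `fromSlot d (signed κ true) `∧ `fromSlot d (signed κ false)

`keepBoth : ∀ {n m} → Computed n → Computed m → Coded (λ γ → keepBoth (n γ) (m γ))
`keepBoth n m = `formula (∼ ⊥ᶠ) `∧ `keep true n `∧ `keep false m

`decided : ∀ κ {d} → Computed d → Coded (λ γ → decided κ (d γ))
`decided κ d = (`X^ d (`formula (slot κ)) `∧ `formula (constG mark₁ ∧ constG mark₂)) `⇒
           (`X^ d (`formula (lit sign true)) `∨ `X^ d (`formula (lit sign false)))

`signedAt : ∀ κ s {d} → Computed d → Coded (λ γ → signedAt κ s (d γ))
`signedAt κ s d = `X^ d (`formula (signed κ s))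

`isPoint : ∀ {n} → Computed n → Coded (λ γ → isPoint (n γ))
`isPoint n = `∼ (`neg (`signedAt true true n)) `∧ (`signedAt true true n `⇒ `formula (constG mark₁)) `∧
            (`signedAt true true n `⇒ `formula (G (atom mark₁ ⇒ atom mark₂)))

`cast : ∀ {f g} → (∀ γ → f γ ≡ g γ) → Coded f → Coded g
`cast f≡g (coded (computed f e)) = coded (computed f (λ γ → trans (e γ) (cong codeI (f≡g γ))))

`rel : ∀ {A x y} → Computed A → Computed x → Computed y → Coded (λ γ → rel (A γ) (x γ) (y γ))
`rel A x y = `cast (λ γ → rel≡ _ _ _) (`some (`∼ (`neg (`signedAt false true A)) `∧ `∼ (`neg (`signedAt true true x)) `∧ `∼ (`neg (`signedAt true true y)) `∧
  (`either (`signedAt false true A) (`signedAt true true x) `⇒ `formula (constG mark₁)) `∧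
  (`either (`signedAt false true A) (`signedAt true true y) `⇒ `formula (constG mark₂))))

`ex₁ : ∀ {n m f} → Computed n → Computed m → Coded f → Coded (λ γ → ex₁ (n γ) (m γ) (f γ))
`ex₁ n m f = `cast (λ γ → ex₁≡ _ _ _) (`some (`keepBoth (`suc n) (`suc m) `∧ `decided true n `∧ `isPoint n `∧ f))

`ex₂ : ∀ {n m f} → Computed n → Computed m → Coded f → Coded (λ γ → ex₂ (n γ) (m γ) (f γ))
`ex₂ n m f = `cast (λ γ → ex₂≡ _ _ _) (`some (`keepBoth n (`suc (`suc m)) `∧ `decided false (`suc m) `∧ f))

`imp : ∀ {f g} → Coded f → Coded g → Coded (λ γ → imp (f γ) (g γ))
`imp f g = `∼ f `∨ g

`all₁ : ∀ {n m f} → Computed n → Computed m → Coded f → Coded (λ γ → all₁ (n γ) (m γ) (f γ))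
`all₁ n m f = `∼ (`ex₁ n m (`∼ f))

`all₂ : ∀ {n m f} → Computed n → Computed m → Coded f → Coded (λ γ → all₂ (n γ) (m γ) (f γ))
`all₂ n m f = `∼ (`ex₂ n m (`∼ f))

`eqF : ∀ {n m x y} → Computed n → Computed m → Computed x → Computed y → Coded (λ γ → eqF (n γ) (m γ) (x γ) (y γ))
`eqF n m x y = `ex₁ n m (`rel (`# 0) x n `∧ `rel (`# 0) y n)

`startF : ∀ {n m b} → Computed n → Computed m → Computed b → Coded (λ γ → startF (n γ) (m γ) (b γ))
`startF n m b = `all₁ n (`suc m) (`imp (`∼ (`ex₁ (`suc n) (`suc m) (`rel (`# 0) (`suc n) n))) (`rel (`suc m) n b))

`stepF : ∀ {n m st} → Computed n → Computed m → Coded st → Coded (λ γ → stepF (n γ) (m γ) (st γ))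
`stepF n m st = `all₁ n m′ (`all₁ n₁ m′ (`all₁ n₂ m′ (`all₁ n₃ m′
  (`imp (`rel m′ n n₂) (`imp (`rel (`# 0) n n₁) (`imp st (`rel m′ n₁ n₃)))))))
  where
  m′ = `suc m
  n₁ = `suc n
  n₂ = `suc n₁
  n₃ = `suc n₂

`iterF : ∀ {n m b st y z} → Computed n → Computed m → Computed b → Coded st → Computed y → Computed z →
         Coded (λ γ → iterF (n γ) (m γ) (b γ) (st γ) (y γ) (z γ))
`iterF n m b st y z = `all₂ n m (`imp (`startF n m b) (`imp (`stepF n m st) (`rel (`suc m) y z)))

`addF : ∀ {n m x y z} → Computed n → Computed m → Computed x → Computed y → Computed z →
        Coded (λ γ → addF (n γ) (m γ) (x γ) (y γ) (z γ))
`addF n m x y z = `iterF n m x (`rel (`# 0) (`suc (`suc n)) (`suc (`suc (`suc n)))) y z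

`mulF : ∀ {n m x y z} → Computed n → Computed m → Computed x → Computed y → Computed z →
        Coded (λ γ → mulF (n γ) (m γ) (x γ) (y γ) (z γ))
`mulF n m x y z = `iterF n m n (`addF (`suc n₃) (`suc m) n₂ x n₃) y z
  where
  n₂ = `suc (`suc n)
  n₃ = `suc n₂

`lessF : ∀ {n m x y} → Computed n → Computed m → Computed x → Computed y → Coded (λ γ → lessF (n γ) (m γ) (x γ) (y γ))
`lessF n m x y = `ex₁ n m (`rel (`# 0) x n `∧ `ex₁ (`suc n) m (`addF (`suc (`suc n)) m n (`suc n) y))

`once : ∀ N → Coded (λ _ → once N)
`once N = `formula (once N)

`sentence : ∀ {N f} → Computed N → Coded f → Coded (λ γ → sentence (N γ) (f γ))
`sentence N f = `some ((`once tag `∧ `once end `∧ `once mark₁ `∧ `once mark₂ `∧ `X^ N (`formula (atom end)) `∧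
    `X^ N (`formula (neg (G (neg (atom mark₁))))) `∧ `X^ N (`formula (neg (G (neg (atom mark₂)))))) `∧
  `formula (keepBoth 0 0) `∧ `some (`formula (keepBoth 0 1) `∧ `formula (decided false 0) `∧ `formula (isNext 0) `∧ f))

-- The offset o is 0 for formulas and 11 for terms, so that adding it to the
-- number of the outermost constructor distinguishes all constructors.
task : ℕ → ℕ → ℕ → ℕ → ℕ → ℕ
task o c k z m = pair o (pair c (pair k (pair z m)))

taskᶜ : ∀ {n} → ℕ → Comp n → Comp n → Comp n → Comp n → Comp n
taskᶜ o c k z m = pairᶜ ⟪ const o ∷ pairᶜ ⟪ c ∷ pairᶜ ⟪ k ∷ pairᶜ ⟪ z ∷ m ∷ [] ⟫ ∷ [] ⟫ ∷ [] ⟫ ∷ [] ⟫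

decode : ℕ → Vec ℕ 5
decode v = fst v + fst c ∷ snd c ∷ fst p ∷ fst (snd p) ∷ snd (snd p) ∷ []
  where
  c = fst (snd v)
  p = snd (snd v)

decode-task : ∀ o t a k z m → decode (task o (pair t a) k z m) ≡ o + t ∷ a ∷ k ∷ z ∷ m ∷ []
decode-task o t a k z m
  rewrite fst-pair o (pair (pair t a) (pair k (pair z m))) | snd-pair o (pair (pair t a) (pair k (pair z m)))
        | fst-pair (pair t a) (pair k (pair z m)) | snd-pair (pair t a) (pair k (pair z m))
        | fst-pair t a | snd-pair t a | fst-pair k (pair z m) | snd-pair k (pair z m)
        | fst-pair z m | snd-pair z m = refl

onTask : Comp 5 → Comp 1
onTask f = withFun (f ⟪ add ⟪ fstᶜ ∷ fstᶜ ⟪ c ∷ [] ⟫ ∷ [] ⟫ ∷ sndᶜ ⟪ c ∷ [] ⟫ ∷ fstᶜ ⟪ p ∷ [] ⟫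
                     ∷ fstᶜ ⟪ sndᶜ ⟪ p ∷ [] ⟫ ∷ [] ⟫ ∷ sndᶜ ⟪ sndᶜ ⟪ p ∷ [] ⟫ ∷ [] ⟫ ∷ [] ⟫)
  (λ { (v ∷ []) → fun f (decode v) }) (λ { (v ∷ []) → refl })
  where
  c = fstᶜ ⟪ sndᶜ ∷ [] ⟫
  p = sndᶜ ⟪ sndᶜ ∷ [] ⟫

onTask₃ : Comp 7 → Comp 3
onTask₃ f = withFun (f ⟪ field′ 0F ∷ field′ 1F ∷ field′ 2F ∷ field′ 3F ∷ field′ 4F ∷ $ 1F ∷ $ 2F ∷ [] ⟫)
  (λ { (v ∷ y ∷ z ∷ []) → fun f (decode v Vec.++ y ∷ z ∷ []) }) (λ { (v ∷ y ∷ z ∷ []) → refl })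
  where
  field′ : Fin 5 → Comp 3
  field′ i = onTask ($ i) ⟪ $ 0F ∷ [] ⟫

-- The right child of the unary constructors: a variable, hence a leaf.
dummy : ℕ
dummy = task 11 (pair 0 0) 0 0 0

-- The value `0` marks a leaf, and only `11`, the number of a variable, gets it.
leafCase : Comp 5
leafCase = switch (one ∷ one ∷ one ∷ one ∷ one ∷ one ∷ one ∷ one ∷ one ∷ one ∷ one ∷ const 0 ∷ []) one
  where
  one : Comp 4
  one = const 1

-- The depths handed to the children are those in `translate` and `valueF`: a subterm gets a fresh
-- slot for its value, beyond the slots still in use for its parent and its left sibling.
leftCase rightCase : Comp 5
leftCase = switch
    (term ∷ term ∷ term ∷ same ∷ both ∷ both ∷ both ∷ bind₁ ∷ bind₁ ∷ bind₂ ∷ bind₂ ∷ const 0 ∷ []) deeper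
  where
  term same both bind₁ bind₂ deeper : Comp 4
  term   = taskᶜ 11 (fstᶜ ⟪ $ 0F ∷ [] ⟫) ($ 1F) ($ 2F) ($ 3F)
  same   = taskᶜ 0 ($ 0F) ($ 1F) ($ 2F) ($ 3F)
  both   = taskᶜ 0 (fstᶜ ⟪ $ 0F ∷ [] ⟫) ($ 1F) ($ 2F) ($ 3F)
  bind₁  = taskᶜ 0 ($ 0F) (sucᶜ ⟪ $ 1F ∷ [] ⟫) (sucᶜ ⟪ $ 2F ∷ [] ⟫) ($ 3F)
  bind₂  = taskᶜ 0 ($ 0F) ($ 1F) ($ 2F) (sucᶜ ⟪ $ 3F ∷ [] ⟫)
  deeper = taskᶜ 11 (fstᶜ ⟪ $ 0F ∷ [] ⟫) ($ 1F) (sucᶜ ⟪ $ 2F ∷ [] ⟫) ($ 3F)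
rightCase = switch
    (term ∷ deeper ∷ none ∷ none ∷ both ∷ both ∷ both ∷ none ∷ none ∷ none ∷ none ∷ none ∷ []) deepest
  where
  term deeper both none deepest : Comp 4
  term    = taskᶜ 11 (sndᶜ ⟪ $ 0F ∷ [] ⟫) ($ 1F) ($ 2F) ($ 3F)
  deeper  = taskᶜ 11 (sndᶜ ⟪ $ 0F ∷ [] ⟫) ($ 1F) (sucᶜ ⟪ $ 2F ∷ [] ⟫) ($ 3F)
  both    = taskᶜ 0 (sndᶜ ⟪ $ 0F ∷ [] ⟫) ($ 1F) ($ 2F) ($ 3F)
  none    = const dummy
  deepest = taskᶜ 11 (sndᶜ ⟪ $ 0F ∷ [] ⟫) ($ 1F) (sucᶜ ⟪ sucᶜ ⟪ $ 2F ∷ [] ⟫ ∷ [] ⟫) ($ 3F)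

private
  z₀ m₀ z₁ z₂ z₃ : Computed _
  z₀  = `depth₁
  m₀  = `depth₂
  z₁ = `suc z₀
  z₂ = `suc z₁
  z₃ = `suc z₂

abstract
  varᶜ : Coded (λ γ → eqF (suc (Node.depth₁ γ)) (Node.depth₂ γ) (Node.base γ ∸ suc (Node.args γ)) (Node.depth₁ γ))
  varᶜ = `eqF z₁ m₀ (`base `∸ `suc `args) z₀

  equationᶜ : Coded (λ γ → ex₁ (Node.depth₁ γ) (Node.depth₂ γ) (Node.left γ ∧ Node.right γ))
  equationᶜ = `ex₁ z₀ m₀ (`left `∧ `right)

  inequalityᶜ : Coded (λ γ → let z = Node.depth₁ γ; m = Node.depth₂ γ in
                  ex₁ z m (Node.left γ ∧ ex₁ (suc z) m (Node.right γ ∧ lessF (2 + z) m z (suc z))))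
  inequalityᶜ = `ex₁ z₀ m₀ (`left `∧ `ex₁ z₁ m₀ (`right `∧ `lessF z₂ m₀ z₀ z₁))

  membershipᶜ : Coded (λ γ → let z = Node.depth₁ γ; m = Node.depth₂ γ in
                  ex₁ z m (Node.left γ ∧ rel (suc (m ∸ suc (snd (Node.args γ)))) z z))
  membershipᶜ = `ex₁ z₀ m₀ (`left `∧ `rel (`suc (m₀ `∸ `suc (`snd `args))) z₀ z₀)

  sumᶜ : Coded (λ γ → let z = Node.depth₁ γ; m = Node.depth₂ γ in
           ex₁ (suc z) m (Node.left γ ∧ ex₁ (2 + z) m (Node.right γ ∧ addF (3 + z) m (suc z) (2 + z) z)))
  sumᶜ = `ex₁ z₁ m₀ (`left `∧ `ex₁ z₂ m₀ (`right `∧ `addF z₃ m₀ z₁ z₂ z₀))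

  productᶜ : Coded (λ γ → let z = Node.depth₁ γ; m = Node.depth₂ γ in
               ex₁ (suc z) m (Node.left γ ∧ ex₁ (2 + z) m (Node.right γ ∧ mulF (3 + z) m (suc z) (2 + z) z)))
  productᶜ = `ex₁ z₁ m₀ (`left `∧ `ex₁ z₂ m₀ (`right `∧ `mulF z₃ m₀ z₁ z₂ z₀))

  notᶜ : Coded (λ γ → ∼ Node.left γ)
  notᶜ = `∼ `left

  andᶜ : Coded (λ γ → Node.left γ ∧ Node.right γ)
  andᶜ = `left `∧ `right

  orᶜ : Coded (λ γ → Node.left γ ∨ᵇ Node.right γ)
  orᶜ = `left `∨ `right

  impᶜ : Coded (λ γ → imp (Node.left γ) (Node.right γ))
  impᶜ = `imp `left `right

  all₁ᶜ : Coded (λ γ → all₁ (Node.depth₁ γ) (Node.depth₂ γ) (Node.left γ))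
  all₁ᶜ = `all₁ z₀ m₀ `left

  ex₁ᶜ : Coded (λ γ → ex₁ (Node.depth₁ γ) (Node.depth₂ γ) (Node.left γ))
  ex₁ᶜ = `ex₁ z₀ m₀ `left

  all₂ᶜ : Coded (λ γ → all₂ (Node.depth₁ γ) (Node.depth₂ γ) (Node.left γ))
  all₂ᶜ = `all₂ z₀ m₀ `left

  ex₂ᶜ : Coded (λ γ → ex₂ (Node.depth₁ γ) (Node.depth₂ γ) (Node.left γ))
  ex₂ᶜ = `ex₂ z₀ m₀ `left

combineCase : Comp 7
combineCase = switch
  ( by-code equationᶜ ∷ by-code inequalityᶜ ∷ by-code membershipᶜ
  ∷ by-code notᶜ ∷ by-code andᶜ ∷ by-code orᶜ ∷ by-code impᶜ
  ∷ by-code all₁ᶜ ∷ by-code ex₁ᶜ ∷ by-code all₂ᶜ ∷ by-code ex₂ᶜ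
  ∷ const 0 ∷ by-code sumᶜ ∷ [])
  (by-code productᶜ)
  where
  by-code : ∀ {f} → Coded f → Comp 6
  by-code c = by (code-of c)

valueCase : Comp 5
valueCase = dropFirst (by (code-of varᶜ) ⟪ $ 0F ∷ $ 1F ∷ $ 2F ∷ $ 3F ∷ const (codeI {6} ⊥ᶠ) ∷ const (codeI {6} ⊥ᶠ) ∷ [] ⟫)

-- The program sees only the de Bruijn index in a code; subtracting it from the number of variables
-- in scope recovers the slot.
lev-toℕ : ∀ {n} (x : Fin n) → lev x ≡ n ∸ suc (toℕ x)
lev-toℕ {suc n} zero    = refl
lev-toℕ {suc n} (suc x) = lev-toℕ x

module TaskEvaluation (leafCase valueCase leftCase rightCase : Comp 5) (combineCase : Comp 7) where

  open TreeEvaluation (onTask leafCase) (onTask valueCase) (onTask leftCase) (onTask rightCase) (onTask₃ combineCase) public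

  module _ (o t a k z m : ℕ) where
    private
      v = task o (pair t a) k z m

    leafAt : ∀ {y} → fun leafCase (o + t ∷ a ∷ k ∷ z ∷ m ∷ []) ≡ 0 →
             fun valueCase (o + t ∷ a ∷ k ∷ z ∷ m ∷ []) ≡ y → Eval v y 1
    leafAt leaf refl = subst (λ y → Eval v y 1) (cong (fun valueCase) (decode-task o t a k z m))
      (at-leaf (trans (cong (fun leafCase) (decode-task o t a k z m)) leaf))

    nodeAt : ∀ {l r} φ ψ {s s′ j y} → fun leafCase (o + t ∷ a ∷ k ∷ z ∷ m ∷ []) ≡ suc j →
             fun leftCase (o + t ∷ a ∷ k ∷ z ∷ m ∷ []) ≡ l → Eval l (codeI φ) s →
             fun rightCase (o + t ∷ a ∷ k ∷ z ∷ m ∷ []) ≡ r → Eval r (codeI ψ) s′ →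
             fun combineCase (o + t ∷ encode (node a k z m φ ψ)) ≡ y → Eval v y (suc (s′ + (s + 1)))
    nodeAt φ ψ leaf lft e rgt e′ comb = subst (λ y → Eval v y _)
      (trans (cong (λ d → fun combineCase (d Vec.++ codeI φ ∷ codeI ψ ∷ [])) (decode-task o t a k z m)) comb)
      (at-node (trans (cong (fun leafCase) (decode-task o t a k z m)) leaf)
        (subst (λ l → Eval l (codeI φ) _) (sym (trans (cong (fun leftCase) (decode-task o t a k z m)) lft)) e)
        (subst (λ r → Eval r (codeI ψ) _) (sym (trans (cong (fun rightCase) (decode-task o t a k z m)) rgt)) e′))

open TaskEvaluation leafCase valueCase leftCase rightCase combineCase

fst-pair-task : ∀ o x y k z m → task o (fst (pair x y)) k z m ≡ task o x k z m
fst-pair-task o x y k z m = cong (λ c → task o c k z m) (fst-pair x y)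

snd-pair-task : ∀ o x y k z m → task o (snd (pair x y)) k z m ≡ task o y k z m
snd-pair-task o x y k z m = cong (λ c → task o c k z m) (snd-pair x y)

dummyF : Formula
dummyF = eqF 1 0 0 0

eval-dummy : Eval dummy (codeI dummyF) 1
eval-dummy = leafAt 11 0 0 0 0 0 refl (equal (code-of varᶜ) (node 0 0 0 0 ⊥ᶠ ⊥ᶠ))

size-node : ∀ c s s′ {h h′} → s ≤ h → s′ ≤ h′ → suc (s′ + (s + 1)) ≤ suc (suc c) + (h + h′)
size-node c s s′ {h} {h′} p p′ = begin
  suc (s′ + (s + 1))   ≡⟨ cong suc (trans (cong (s′ +_) (+-comm s 1)) (+-suc s′ s)) ⟩
  2 + (s′ + s)         ≡⟨ cong (2 +_) (+-comm s′ s) ⟩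
  2 + (s + s′)         ≤⟨ +-mono-≤ (s≤s (s≤s (z≤n {c}))) (+-mono-≤ p p′) ⟩
  2 + c + (h + h′)     ∎
  where open ≤-Reasoning

size-unary : ∀ c s {h} → s ≤ h → suc (1 + (s + 1)) ≤ suc (suc (suc c)) + h
size-unary c s {h} p = begin
  2 + (s + 1)  ≡⟨ cong (2 +_) (+-comm s 1) ⟩
  3 + s        ≤⟨ +-mono-≤ (s≤s (s≤s (s≤s (z≤n {c})))) p ⟩
  3 + c + h    ∎
  where open ≤-Reasoning

eval-term : ∀ {k} (t : Term k) z m → ∃[ s ] s ≤ heightT t × Eval (task 11 (codeT t) k z m) (codeI (valueF t z m)) s
eval-term {k} (var x) z m = 1 , ≤-refl ,
  leafAt 11 0 (toℕ x) k z m refl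
    (trans (equal (code-of varᶜ) (node (toℕ x) k z m ⊥ᶠ ⊥ᶠ)) (cong (λ l → codeI (eqF (suc z) m l z)) (sym (lev-toℕ x))))
eval-term {k} (s ⊕ t) z m =
  let i , i≤ , e  = eval-term s (suc z) m
      j , j≤ , e′ = eval-term t (2 + z) m
  in _ , size-node 10 i j i≤ j≤ ,
  nodeAt 11 1 (pair (codeT s) (codeT t)) k z m (valueF s (suc z) m) (valueF t (2 + z) m) refl
    (fst-pair-task 11 (codeT s) (codeT t) k (suc z) m) e (snd-pair-task 11 (codeT s) (codeT t) k (2 + z) m) e′
    (equal (code-of sumᶜ) (node (pair (codeT s) (codeT t)) k z m (valueF s (suc z) m) (valueF t (2 + z) m)))
eval-term {k} (s ⊗ t) z m =
  let i , i≤ , e  = eval-term s (suc z) m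
      j , j≤ , e′ = eval-term t (2 + z) m
  in _ , size-node 10 i j i≤ j≤ ,
  nodeAt 11 2 (pair (codeT s) (codeT t)) k z m (valueF s (suc z) m) (valueF t (2 + z) m) refl
    (fst-pair-task 11 (codeT s) (codeT t) k (suc z) m) e (snd-pair-task 11 (codeT s) (codeT t) k (2 + z) m) e′
    (equal (code-of productᶜ) (node (pair (codeT s) (codeT t)) k z m (valueF s (suc z) m) (valueF t (2 + z) m)))

eval-formula : ∀ {n m} (φ : SOFormula n m) → ∃[ s ] s ≤ height φ × Eval (task 0 (codeSO φ) n n m) (codeI (translate φ)) s
eval-formula {n} {m} (s ≐ t) =
  let i , i≤ , e  = eval-term s n m
      j , j≤ , e′ = eval-term t n m
  in _ , size-node 10 i j i≤ j≤ ,
  nodeAt 0 0 (pair (codeT s) (codeT t)) n n m (valueF s n m) (valueF t n m) refl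
    (fst-pair-task 11 (codeT s) (codeT t) n n m) e (snd-pair-task 11 (codeT s) (codeT t) n n m) e′
    (equal (code-of equationᶜ) (node (pair (codeT s) (codeT t)) n n m (valueF s n m) (valueF t n m)))
eval-formula {n} {m} (s ≺ t) =
  let i , i≤ , e  = eval-term s n m
      j , j≤ , e′ = eval-term t (suc n) m
  in _ , size-node 10 i j i≤ j≤ ,
  nodeAt 0 1 (pair (codeT s) (codeT t)) n n m (valueF s n m) (valueF t (suc n) m) refl
    (fst-pair-task 11 (codeT s) (codeT t) n n m) e (snd-pair-task 11 (codeT s) (codeT t) n (suc n) m) e′
    (equal (code-of inequalityᶜ) (node (pair (codeT s) (codeT t)) n n m (valueF s n m) (valueF t (suc n) m)))
eval-formula {n} {m} (t ϵ A) =
  let i , i≤ , e  = eval-term t n m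
  in _ , size-unary 9 i i≤ ,
  nodeAt 0 2 (pair (codeT t) (toℕ A)) n n m (valueF t n m) dummyF refl
    (fst-pair-task 11 (codeT t) (toℕ A) n n m) e refl eval-dummy
    (trans (equal (code-of membershipᶜ) (node (pair (codeT t) (toℕ A)) n n m (valueF t n m) dummyF))
      (cong (λ l → codeI (ex₁ n m (valueF t n m ∧ rel (suc l) n n)))
        (trans (cong (λ a → m ∸ suc a) (snd-pair (codeT t) (toℕ A))) (sym (lev-toℕ A)))))
eval-formula {n} {m} (¬ᶠ φ) =
  let i , i≤ , e = eval-formula φ in _ , size-unary 0 i i≤ ,
  nodeAt 0 3 (codeSO φ) n n m (translate φ) dummyF refl refl e refl eval-dummy
    (equal (code-of notᶜ) (node (codeSO φ) n n m (translate φ) dummyF))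
eval-formula {n} {m} (φ ∧ ψ) =
  let i , i≤ , e  = eval-formula φ
      j , j≤ , e′ = eval-formula ψ
  in _ , size-node 0 i j i≤ j≤ ,
  nodeAt 0 4 (pair (codeSO φ) (codeSO ψ)) n n m (translate φ) (translate ψ) refl
    (fst-pair-task 0 (codeSO φ) (codeSO ψ) n n m) e (snd-pair-task 0 (codeSO φ) (codeSO ψ) n n m) e′
    (equal (code-of andᶜ) (node (pair (codeSO φ) (codeSO ψ)) n n m (translate φ) (translate ψ)))
eval-formula {n} {m} (φ ∨ ψ) =
  let i , i≤ , e  = eval-formula φ
      j , j≤ , e′ = eval-formula ψ
  in _ , size-node 0 i j i≤ j≤ ,
  nodeAt 0 5 (pair (codeSO φ) (codeSO ψ)) n n m (translate φ) (translate ψ) refl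
    (fst-pair-task 0 (codeSO φ) (codeSO ψ) n n m) e (snd-pair-task 0 (codeSO φ) (codeSO ψ) n n m) e′
    (equal (code-of orᶜ) (node (pair (codeSO φ) (codeSO ψ)) n n m (translate φ) (translate ψ)))
eval-formula {n} {m} (φ ⇒ ψ) =
  let i , i≤ , e  = eval-formula φ
      j , j≤ , e′ = eval-formula ψ
  in _ , size-node 0 i j i≤ j≤ ,
  nodeAt 0 6 (pair (codeSO φ) (codeSO ψ)) n n m (translate φ) (translate ψ) refl
    (fst-pair-task 0 (codeSO φ) (codeSO ψ) n n m) e (snd-pair-task 0 (codeSO φ) (codeSO ψ) n n m) e′
    (equal (code-of impᶜ) (node (pair (codeSO φ) (codeSO ψ)) n n m (translate φ) (translate ψ)))
eval-formula {n} {m} (∀₁ φ) =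
  let i , i≤ , e = eval-formula φ in _ , size-unary 0 i i≤ ,
  nodeAt 0 7 (codeSO φ) n n m (translate φ) dummyF refl refl e refl eval-dummy
    (equal (code-of all₁ᶜ) (node (codeSO φ) n n m (translate φ) dummyF))
eval-formula {n} {m} (∃₁ φ) =
  let i , i≤ , e = eval-formula φ in _ , size-unary 0 i i≤ ,
  nodeAt 0 8 (codeSO φ) n n m (translate φ) dummyF refl refl e refl eval-dummy
    (equal (code-of ex₁ᶜ) (node (codeSO φ) n n m (translate φ) dummyF))
eval-formula {n} {m} (∀₂ φ) =
  let i , i≤ , e = eval-formula φ in _ , size-unary 0 i i≤ ,
  nodeAt 0 9 (codeSO φ) n n m (translate φ) dummyF refl refl e refl eval-dummy
    (equal (code-of all₂ᶜ) (node (codeSO φ) n n m (translate φ) dummyF))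
eval-formula {n} {m} (∃₂ φ) =
  let i , i≤ , e = eval-formula φ in _ , size-unary 0 i i≤ ,
  nodeAt 0 10 (codeSO φ) n n m (translate φ) dummyF refl refl e refl eval-dummy
    (equal (code-of ex₂ᶜ) (node (codeSO φ) n n m (translate φ) dummyF))

-- Bounding the height by the code

module _ where
  open ≤-Reasoning

  pair₃-≥ : ∀ t x y → t + (x + y) ≤ pair₃ t x y
  pair₃-≥ t x y = ≤-trans (+-monoʳ-≤ t (pair-≥ x y)) (pair-≥ t (pair x y))

  private
    sum-bound : ∀ t {x y h h′} → h ≤ 16 * x + 1 → h′ ≤ 16 * y + 1 → 12 + (h + h′) ≤ 16 * pair₃ (suc t) x y + 1
    sum-bound t {x} {y} {h} {h′} p p′ = begin
      12 + (h + h′)                          ≤⟨ +-monoʳ-≤ 12 (+-mono-≤ p p′) ⟩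
      12 + ((16 * x + 1) + (16 * y + 1))     ≤⟨ m≤m+n _ (16 * t + 3) ⟩
      _                                      ≡⟨ eq t x y ⟩
      16 * (suc t + (x + y)) + 1             ≤⟨ +-monoˡ-≤ 1 (*-monoʳ-≤ 16 (pair₃-≥ (suc t) x y)) ⟩
      16 * pair₃ (suc t) x y + 1             ∎
      where
      eq : ∀ t x y → (12 + ((16 * x + 1) + (16 * y + 1))) + (16 * t + 3) ≡ 16 * (suc t + (x + y)) + 1
      eq = solve-∀

    atom-bound : ∀ t {x y h h′} → h ≤ 16 * x + 1 → h′ ≤ 16 * y + 1 → suc (12 + (h + h′)) ≤ 16 * suc (pair₃ t x y)
    atom-bound t {x} {y} {h} {h′} p p′ = begin
      13 + (h + h′)                          ≤⟨ +-monoʳ-≤ 13 (+-mono-≤ p p′) ⟩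
      13 + ((16 * x + 1) + (16 * y + 1))     ≤⟨ m≤m+n _ (16 * t + 1) ⟩
      _                                      ≡⟨ eq t x y ⟩
      16 * suc (t + (x + y))                 ≤⟨ *-monoʳ-≤ 16 (s≤s (pair₃-≥ t x y)) ⟩
      16 * suc (pair₃ t x y)                 ∎
      where
      eq : ∀ t x y → (13 + ((16 * x + 1) + (16 * y + 1))) + (16 * t + 1) ≡ 16 * suc (t + (x + y))
      eq = solve-∀

    binary-bound : ∀ t {x y h h′} → suc h ≤ 16 * suc x → suc h′ ≤ 16 * suc y → suc (2 + (h + h′)) ≤ 16 * suc (pair₃ (2 + t) x y)
    binary-bound t {x} {y} {h} {h′} p p′ = begin
      3 + (h + h′)                           ≡⟨ cong (λ k → suc (suc k)) (sym (+-suc h h′)) ⟩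
      1 + (suc h + suc h′)                   ≤⟨ +-monoʳ-≤ 1 (+-mono-≤ p p′) ⟩
      1 + (16 * suc x + 16 * suc y)          ≤⟨ m≤m+n _ (16 * t + 15) ⟩
      _                                      ≡⟨ eq t x y ⟩
      16 * suc ((2 + t) + (x + y))           ≤⟨ *-monoʳ-≤ 16 (s≤s (pair₃-≥ (2 + t) x y)) ⟩
      16 * suc (pair₃ (2 + t) x y)           ∎
      where
      eq : ∀ t x y → (1 + (16 * suc x + 16 * suc y)) + (16 * t + 15) ≡ 16 * suc ((2 + t) + (x + y))
      eq = solve-∀

    unary-bound : ∀ t {x h} → suc h ≤ 16 * suc x → suc (3 + h) ≤ 16 * suc (pair (suc t) x)
    unary-bound t {x} {h} p = begin
      3 + suc h                              ≤⟨ +-monoʳ-≤ 3 p ⟩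
      3 + 16 * suc x                         ≤⟨ m≤m+n _ (16 * t + 13) ⟩
      _                                      ≡⟨ eq t x ⟩
      16 * suc (suc t + x)                   ≤⟨ *-monoʳ-≤ 16 (s≤s (pair-≥ (suc t) x)) ⟩
      16 * suc (pair (suc t) x)              ∎
      where
      eq : ∀ t x → (3 + 16 * suc x) + (16 * t + 13) ≡ 16 * suc (suc t + x)
      eq = solve-∀

  -- A variable may have code `0` but has height `1`, whence the summand. An operation has
  -- constructor number at least `1`, so its code exceeds the sum of the codes of its operands,
  -- which pays for its `12`.
  heightT-bound : ∀ {k} (t : Term k) → heightT t ≤ 16 * codeT t + 1
  heightT-bound (var x) = m≤n+m 1 _
  heightT-bound (s ⊕ t) = sum-bound 0 (heightT-bound s) (heightT-bound t)
  heightT-bound (s ⊗ t) = sum-bound 1 (heightT-bound s) (heightT-bound t)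

  -- An atomic formula costs `12`, its two terms contribute a summand `1` each, and strictness,
  -- which leaves room for the slot of the successor relation, takes one more. This fits below `16`,
  -- a power of two that `budget` computes by doubling.
  height-bound : ∀ {n m} (φ : SOFormula n m) → suc (height φ) ≤ 16 * suc (codeSO φ)
  height-bound (s ≐ t) = atom-bound 0 (heightT-bound s) (heightT-bound t)
  height-bound (s ≺ t) = atom-bound 1 (heightT-bound s) (heightT-bound t)
  height-bound (t ϵ A) = ≤-trans (+-monoʳ-≤ 13 (m≤m+n (heightT t) 0)) (atom-bound 2 (heightT-bound t) z≤n)
  height-bound (¬ᶠ φ)  = unary-bound 2 (height-bound φ)
  height-bound (φ ∧ ψ) = binary-bound 2 (height-bound φ) (height-bound ψ)
  height-bound (φ ∨ ψ) = binary-bound 3 (height-bound φ) (height-bound ψ)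
  height-bound (φ ⇒ ψ) = binary-bound 4 (height-bound φ) (height-bound ψ)
  height-bound (∀₁ φ)  = unary-bound 6 (height-bound φ)
  height-bound (∃₁ φ)  = unary-bound 7 (height-bound φ)
  height-bound (∀₂ φ)  = unary-bound 8 (height-bound φ)
  height-bound (∃₂ φ)  = unary-bound 9 (height-bound φ)

  budget : Comp 1
  budget = withFun (double ⟪ double ⟪ double ⟪ double ⟪ sucᶜ ∷ [] ⟫ ∷ [] ⟫ ∷ [] ⟫ ∷ [] ⟫)
    (λ { (c ∷ []) → 16 * suc c }) (λ { (c ∷ []) → eq c })
    where
    double : Comp 1
    double = withFun (add ⟪ $ 0F ∷ $ 0F ∷ [] ⟫) (λ { (x ∷ []) → x + x }) (λ { (x ∷ []) → refl })
    quadruple : ℕ → ℕ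
    quadruple x = (x + x) + (x + x)
    eq : ∀ c → quadruple (quadruple (suc c)) ≡ 16 * suc c
    eq c = lemma c
      where
      lemma : ∀ c → (((suc c + suc c) + (suc c + suc c)) + ((suc c + suc c) + (suc c + suc c)))
                  + (((suc c + suc c) + (suc c + suc c)) + ((suc c + suc c) + (suc c + suc c))) ≡ 16 * suc c
      lemma = solve-∀

-- The number of slots exceeds the quantifier depth of the sentence.
opaque
  reduction : SOSentence → Formula
  reduction φ = sentence (16 * suc (codeSO φ)) (translate φ)

  reduction≡ : ∀ φ → sentence (16 * suc (codeSO φ)) (translate φ) ≡ reduction φ
  reduction≡ φ = refl

-- `budget` serves twice, as the number of slots and as the fuel of the evaluation. The node is a
-- mere carrier for this number, in `depth₁`, and for the translation, in `left`.
reductionᶜ : Comp 1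
reductionᶜ = by (code-of (`sentence `depth₁ `left)) ⟪ const 0 ∷ const 0 ∷ budget ∷ const 0
  ∷ evalWithin ⟪ budget ∷ taskᶜ 0 ($ 0F) (const 0) (const 0) (const 0) ∷ [] ⟫ ∷ const (codeI {6} ⊥ᶠ) ∷ [] ⟫

reductionᶜ-code : ∀ φ → fun reductionᶜ (codeSO φ ∷ []) ≡ codeI (reduction φ)
reductionᶜ-code φ = trans
  (cong (λ c → fun (by (code-of (`sentence `depth₁ `left))) (0 ∷ 0 ∷ 16 * suc (codeSO φ) ∷ 0 ∷ c ∷ codeI {6} ⊥ᶠ ∷ []))
    (let s , s≤ , e = eval-formula φ in evalWithin-correct e (≤-trans s≤ (≤-trans (n≤1+n _) (height-bound φ)))))
  (trans (equal (code-of (`sentence `depth₁ `left)) (node 0 0 (16 * suc (codeSO φ)) 0 (translate φ) ⊥ᶠ)) (cong codeI (reduction≡ φ)))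

-- The complete Kripke structure and the reductions

∣subsets∣ : ℕ → ℕ
∣subsets∣ zero    = 1
∣subsets∣ (suc n) = ∣subsets∣ n + ∣subsets∣ n

subsets : ∀ n → Vec (Subset n) (∣subsets∣ n)
subsets zero    = [] ∷ []
subsets (suc n) = Vec.map (true ∷_) (subsets n) ++ Vec.map (false ∷_) (subsets n)

∈-subsets : ∀ {n} (S : Subset n) → S ∈ᵥ subsets n
∈-subsets []          = here refl
∈-subsets (true  ∷ S) = ∈-++⁺ˡ (∈-map⁺ (true ∷_) (∈-subsets S))
∈-subsets (false ∷ S) = ∈-++⁺ʳ (Vec.map (true ∷_) (subsets _)) (∈-map⁺ (false ∷_) (∈-subsets S))

abstract
  completeKripke : FiniteKripke 6
  completeKripke = record
    -- One state for each of the `64` labels; with all transitions present, any word of labels is a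
    -- trace.
    { size       = 63
    ; initial    = ⊤
    ; successors = replicate 64 ⊤
    ; leftTotal  = λ s → zero , subst (zero ∈ₛ_) (sym (lookup-replicate s ⊤)) ∈⊤
    ; labels     = subsets 6
    }

  completeKripke-traces : ∀ w → w ∈ ∣ Kripke.traces (toKripke completeKripke) ∣
  completeKripke-traces w = (λ i → index (∈-subsets (w i)))
    , (λ i → subst (index (∈-subsets (w (suc i))) ∈ₛ_) (sym (lookup-replicate (index (∈-subsets (w i))) ⊤)) ∈⊤)
    , ∈⊤ , λ i → lookup-index (∈-subsets (w i))

allTraces : Team 6
allTraces = team (λ _ → Unit) (λ _ _ → tt)

module Reduction (em : ExcludedMiddle (lsuc 0ℓ)) (φ : SOSentence) where

  private
    N = 16 * suc (codeSO φ)
    open Representation em N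
    open Translation em N

  -- The generality in `L` is what satisfiability requires, since the satisfying team may be any.
  -- Completeness is stated for full teams, which both `allTraces` and the traces of
  -- `completeKripke` are.
  reduction-sound : ∀ L → L ⊨ reduction φ → Holds [] [] φ
  reduction-sound L h = rep-sentence-sound {L = L} (height-bound φ) (rep-translate φ) (subst (L ⊨_) (sym (reduction≡ φ)) h)

  reduction-complete : ∀ L → (∀ w → w ∈ ∣ L ∣) → Holds [] [] φ → L ⊨ reduction φ
  reduction-complete L full h = subst (L ⊨_) (reduction≡ φ) (rep-sentence-complete {L = L} (height-bound φ) (rep-translate φ) h full)

reductionᶜ-computes : ∀ φ → fun reductionᶜ (codeSOFormula φ ∷ []) ≡ codeInqLTL (reduction φ)
reductionᶜ-computes φ = trans (cong (λ c → fun reductionᶜ (c ∷ [])) (sym (codeSO≡ φ)))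
  (trans (reductionᶜ-code φ) (codeI≡ (reduction φ)))

truth≤satisfiability : ExcludedMiddle (lsuc 0ℓ) → SecondOrderTruth ≤ₘ InqLTL-Satisfiability
truth≤satisfiability em =
  (λ φ → 6 , reduction φ) ,
  (rec f , λ φ → subst (rec f · codeSOFormula φ ∷ [] ⇓_) (pair-cong refl (reductionᶜ-computes φ)) (computes f _)) ,
  (λ φ → let open Reduction em φ in mk⇔
    (λ h → allTraces , ((λ _ → ⊤) , tt) , reduction-complete allTraces (λ _ → tt) h)
    (λ (L , _ , h) → reduction-sound L h))
  where
  f : Comp 1
  f = pairᶜ ⟪ const 6 ∷ reductionᶜ ∷ [] ⟫

truth≤modelChecking : ExcludedMiddle (lsuc 0ℓ) → SecondOrderTruth ≤ₘ InqLTL-ModelChecking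
truth≤modelChecking em =
  (λ φ → 6 , completeKripke , reduction φ) ,
  (rec f , λ φ → subst (rec f · codeSOFormula φ ∷ [] ⇓_) (pair-cong refl (pair-cong refl (reductionᶜ-computes φ))) (computes f _)) ,
  (λ φ → let open Reduction em φ in mk⇔
    (reduction-complete (Kripke.traces (toKripke completeKripke)) completeKripke-traces)
    (reduction-sound (Kripke.traces (toKripke completeKripke))))
  where
  f : Comp 1
  f = pairᶜ ⟪ const 6 ∷ pairᶜ ⟪ const (codeKripke completeKripke) ∷ reductionᶜ ∷ [] ⟫ ∷ [] ⟫

≤ₘ-undecidable : ∀ {P Q} → P ≤ₘ Q → Undecidable P → Undecidable Q
≤ₘ-undecidable (r , (f , f-computes) , iff) undecidable (d , decides) = undecidable
  (comp d (f ∷ []) , λ x →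
    (λ yes → ⇓-comp (f-computes x ∷ []) (proj₁ (decides (r x)) (to (iff x) yes))) ,
    (λ no → ⇓-comp (f-computes x ∷ []) (proj₂ (decides (r x)) (λ yes → no (from (iff x) yes)))))

theorem1 : ExcludedMiddle (lsuc 0ℓ) →
    Undecidable InqLTL-ModelChecking
    × Undecidable InqLTL-Satisfiability
    × SecondOrderTruth ≤ₘ InqLTL-ModelChecking
    × SecondOrderTruth ≤ₘ InqLTL-Satisfiability
theorem1 em =
    ≤ₘ-undecidable (truth≤modelChecking em) SecondOrderTruth-undecidable
  , ≤ₘ-undecidable (truth≤satisfiability em) SecondOrderTruth-undecidable
  , truth≤modelChecking em
  , truth≤satisfiability em
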